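{- For all integers $r$ and $k$ with $k\geq 2r+2\geq 8$, there exists $N_{r,k}$ such that for every $n\geq N_{r,k}$, if $\mathcal{H}$ is an $n$-vertex $2$-connected $r$-graph with no Berge cycle of length at least $k$, then $$e(\mathcal{H})\leq \binom{\lfloor (k-1)/2\rfloor}{r-1}\left(n-\lceil (k+1)/2\rceil\right)+\binom{\lceil (k+1)/2\rceil}{r}.$$
   Context: An $r$-graph is a hypergraph all of whose hyperedges are $r$-element subsets of the vertex set; $e(\mathcal{H})$ is its number of hyperedges. A Berge cycle of length $\ell$ is a sequence of $\ell$ distinct vertices $v_1,\dots,v_\ell$ and $\ell$ distinct hyperedges $e_1,\dots,e_\ell$ with $\{v_i,v_{i+1}\}\subseteq e_i$ for all $i$ (indices mod $\ell$). A hypergraph is connected if its vertex set cannot be partitioned into two nonempty parts with no hyperedge meeting both parts. A hypergraph $\mathcal{H}$ is $2$-connected if it is connected and has neither a cut vertex (a vertex $v$ such that $V(\mathcal{H})=\{v\}\cup V_1\cup V_2$ with $V_1,V_2$ nonempty and disjoint and every hyperedge contained in $\{v\}\cup V_1$ or in $\{v\}\cup V_2$) nor a cut hyperedge (a hyperedge $e$ such that $V(\mathcal{H})=V_1\cup V_2$ with $V_1,V_2$ nonempty and disjoint and every hyperedge $f\neq e$ contained in $V_1$ or in $V_2$). -}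

module Defs where

open import Data.Nat using (ℕ; zero; suc; _+_; _*_; _∸_; _≤_; ⌊_/2⌋; ⌈_/2⌉)
open import Data.Nat.DivMod using (_mod_)
open import Data.Nat.Combinatorics using (_C_)
open import Data.Fin using (Fin; toℕ)
open import Data.Fin.Subset using (Subset; _∈_; ∣_∣)
open import Data.List using (List; length; lookup)
open import Data.List.Relation.Unary.All using (All)
open import Data.List.Relation.Unary.Unique.Propositional using (Unique)
open import Data.Bool using (Bool; true; false)
open import Data.Product using (Σ; ∃; ∃-syntax; _×_)
open import Data.Sum using (_⊎_)
open import Function.Definitions using (Injective)
open import Relation.Binary.PropositionalEquality using (_≡_; _≢_)
open import Relation.Nullary using (¬_)

record RGraph (r n : ℕ) : Set where
  field
    edges   : List (Subset n)
    unique  : Unique edges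
    uniform : All (λ e → ∣ e ∣ ≡ r) edges

open RGraph public

e : ∀ {r n} → RGraph r n → ℕ
e H = length (edges H)

edge : ∀ {r n} (H : RGraph r n) → Fin (e H) → Subset n
edge H j = lookup (edges H) j

next : ∀ {ℓ} → Fin ℓ → Fin ℓ
next {suc l} i = suc (toℕ i) mod suc l

-- A Berge cycle of length ℓ: ℓ distinct vertices v_i and ℓ distinct hyperedges e_i
-- with {v_i, v_{i+1}} ⊆ e_i (indices mod ℓ). Distinct list indices = distinct
-- hyperedges since the edge list is duplicate-free.
BergeCycle : ∀ {r n} → RGraph r n → ℕ → Set
BergeCycle {r} {n} H ℓ =
  Σ (Fin ℓ → Fin n) λ v → Σ (Fin ℓ → Fin (e H)) λ f →
    Injective _≡_ _≡_ v × Injective _≡_ _≡_ f ×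
    (∀ i → (v i ∈ edge H (f i)) × (v (next i) ∈ edge H (f i)))

Connected : ∀ {r n} → RGraph r n → Set
Connected {r} {n} H =
  ¬ (Σ (Fin n → Bool) λ side →
       (∃[ a ] side a ≡ true) × (∃[ b ] side b ≡ false) ×
       (∀ j → (∀ u → u ∈ edge H j → side u ≡ true)
            ⊎ (∀ u → u ∈ edge H j → side u ≡ false)))

CutVertex : ∀ {r n} → RGraph r n → Fin n → Set
CutVertex {r} {n} H v =
  Σ (Fin n → Bool) λ side →
    (∃[ a ] a ≢ v × side a ≡ true) × (∃[ b ] b ≢ v × side b ≡ false) ×
    (∀ j → (∀ u → u ∈ edge H j → u ≢ v → side u ≡ true)
         ⊎ (∀ u → u ∈ edge H j → u ≢ v → side u ≡ false))

CutEdge : ∀ {r n} (H : RGraph r n) → Fin (e H) → Set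
CutEdge {r} {n} H j =
  Σ (Fin n → Bool) λ side →
    (∃[ a ] side a ≡ true) × (∃[ b ] side b ≡ false) ×
    (∀ i → i ≢ j → (∀ u → u ∈ edge H i → side u ≡ true)
                 ⊎ (∀ u → u ∈ edge H i → side u ≡ false))

TwoConnected : ∀ {r n} → RGraph r n → Set
TwoConnected H = Connected H × (∀ v → ¬ CutVertex H v) × (∀ j → ¬ CutEdge H j)

bound : ℕ → ℕ → ℕ → ℕ
bound r k n = (⌊ k ∸ 1 /2⌋ C (r ∸ 1)) * (n ∸ ⌈ k + 1 /2⌉) + (⌈ k + 1 /2⌉ C r)

{-# OPTIONS --safe #-}
-- Put t = ⌊(k-1)/2⌋ and let Γ be the graph of the pairs matched by a maximum matching of hyperedges to
-- pairs inside them, so that distinct edges of Γ have distinct owners and cycles of Γ are Berge cycles.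
-- A hyperedge is blue if an alternating path from an unmatched hyperedge reaches it; all pairs in blue
-- hyperedges are matched, and a red hyperedge is charged to its own pair.  Deleting a vertex with at
-- most t neighbours in Γ then costs at most C(t, r-1) hyperedges (here t ≥ r is used), so too many
-- hyperedges leave a set W of more than k - t vertices with degrees above t in Γ[W]; and, for large n,
-- a set V ⊇ W of at least k vertices with degrees at least t in Γ[V].  If Γ[V] is 2-connected, Kopylov's
-- argument gives a cycle of length at least k in Γ.  Otherwise Γ[V] has two dense pieces sharing at most one
-- vertex; take in each a path to its last neighbour from an end all of whose neighbours are on the
-- path, link the two by two disjoint paths of the incidence graph of the 2-connected hypergraph, and
-- close up to a Berge cycle through all those neighbours, of length at least 2t + 2 ≥ k.
module Submission where

open import Defs
open import Data.Bool using (Bool; true; false)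
open import Data.Empty using (⊥; ⊥-elim)
open import Data.Fin using (Fin; zero; suc; toℕ) renaming (_<_ to _<ᶠ_)
import Data.Fin.Properties as Fin
open import Data.Fin.Subset.Properties using (⊆-antisym) renaming (_∈?_ to _∈ₛ?_)
open import Data.Fin.Subset using (Subset; ∣_∣) renaming (_∈_ to _∈ₛ_)
open import Data.List using (List; []; _∷_; _++_; [_]; length; map; filter; lookup; allFin; cartesianProduct)
import Data.List.Properties as List
open import Data.List.Membership.Propositional using (_∈_; _∉_; find; lose)
open import Data.List.Membership.Propositional.Properties
open import Data.List.Relation.Binary.Permutation.Propositional as Perm using (_↭_; prep; swap; ↭-sym)
open import Data.List.Relation.Binary.Permutation.Propositional.Properties
  using (∈-resp-↭; ↭-length; shift; drop-∷; ∷↭∷ʳ; ++-comm; ++⁺ˡ)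
  renaming (map⁺ to ↭-map⁺)
import Data.List.Relation.Binary.Permutation.Setoid.Properties as PermSetoid
open import Data.List.Relation.Binary.Subset.Propositional using (_⊆_)
open import Data.List.Relation.Unary.All as All using (All; []; _∷_)
open import Data.List.Relation.Unary.All.Properties using (¬All⇒Any¬)
open import Data.List.Relation.Unary.AllPairs using ([]; _∷_)
open import Data.List.Relation.Unary.Any as Any using (here; there)
open import Data.List.Relation.Unary.Unique.Propositional using (Unique)
import Data.List.Relation.Unary.Unique.Propositional.Properties as Uniq
open import Data.Nat
  using (ℕ; zero; suc; _+_; _*_; _∸_; _≤_; _<_; z≤n; s≤s; s≤s⁻¹; ⌊_/2⌋; ⌈_/2⌉; _≤?_; _<?_; _≤′_; ≤′-refl; ≤′-step)
open import Data.Nat.Combinatorics using (_C_; nCk+nC[k+1]≡[n+1]C[k+1]; nCn≡1; nC1≡n; nCk≡nC[n∸k]; k>n⇒nCk≡0)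
open import Data.Nat.DivMod using (_%_; m%n<n; m<n⇒m%n≡m; n%n≡0)
open import Data.Nat.Properties
  using (≤-refl; ≤-reflexive; ≤-trans; ≤-antisym; <-irrefl; n≤1+n; m≤n+m; m≤m+n; ≰⇒>; <⇒≱; +-mono-≤;
         +-monoʳ-≤; +-monoˡ-≤; +-suc; +-identityʳ; +-comm; +-assoc; suc-injective; m+n∸n≡m; m+n∸m≡n; m+[n∸m]≡n; <-cmp; ≤⇒≤′; *-comm; *-monoˡ-≤; *-distribʳ-+; ∸-monoˡ-≤; m∸n+n≡m;
         ⌊n/2⌋-mono; ⌈n/2⌉-mono; ⌊n/2⌋+⌈n/2⌉≡n;
         module ≤-Reasoning)
open import Data.Product using (Σ; ∃; ∃₂; ∃-syntax; _×_; _,_; proj₁; proj₂)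
open import Data.Product.Properties using () renaming (≡-dec to ×-≡-dec)
open import Data.Sum using (_⊎_; inj₁; inj₂)
open import Data.Sum.Properties using (≡-dec; inj₁-injective; inj₂-injective)
open import Data.Unit using (⊤; tt)
open import Function using (_∘_; case_of_)
open import Function.Definitions using (Injective)
open import Data.Vec using ([]; _∷_; here; there)
open import Relation.Binary.Definitions using (tri<; tri≈; tri>)
open import Relation.Binary.PropositionalEquality
  using (_≡_; _≢_; refl; sym; trans; cong; subst; setoid)
open import Relation.Nullary using (¬_; Dec; yes; no)
open import Relation.Nullary.Decidable using (¬¬-excluded-middle; ¬?; _×-dec_; _⊎-dec_; decidable-stable)

-- The existence arguments below are classical and are run inside ¬¬; this loses nothing, since the
-- theorem is a decidable inequality.
infixl 1 _>>=_

-- The size ⌈(k+1)/2⌉ in the bound equals k - t, and at least r + 2 because k ≥ 2r + 2. From r + 2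
-- vertices on, the mixed count (blue hyperedges by their vertices, red ones by their pairs) obeys
-- the bound C(s, r) of a complete r-graph, so the peeling may stop at k - t vertices. Two dense
-- sets are needed because neither meets all requirements. In W two path ends contribute t + 1 each,
-- and 2t + 2 ≥ k, but W may have fewer than k vertices. V has k vertices but degrees only t; there
-- the other path end lies in a clique containing W, where it has at least k - t neighbours. The
-- obstacle in the linking is that a link may run through any hyperedge, even one that owns a pair
-- of a dense piece. Hence such owners are counted as elements of the piece. A link may then arrive
-- at a hyperedge instead of a vertex, and the piece has to be traversed from there without using
-- that hyperedge again. Moreover only traversals that end at the last neighbour are known to cover
-- all neighbours, so the links must use this vertex on both sides: Menger's theorem is needed with
-- a prescribed end in each piece.

_>>=_ : {A B : Set} → ¬ ¬ A → (A → ¬ ¬ B) → ¬ ¬ B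
(m >>= f) k = m λ a → f a k

return : {A : Set} → A → ¬ ¬ A
return a k = k a

em : (P : Set) → ¬ ¬ Dec P
em P = ¬¬-excluded-middle

¬¬-∀Fin : ∀ {n} {P : Fin n → Set} → (∀ i → ¬ ¬ P i) → ¬ ¬ (∀ i → P i)
¬¬-∀Fin {zero} f = return λ ()
¬¬-∀Fin {suc n} {P} f = f zero >>= λ p → ¬¬-∀Fin (λ i → f (suc i)) >>= λ ps →
  return λ { zero → p ; (suc i) → ps i }

-- Source of the extremal objects below: longest paths, a largest clique, a maximum matching.
¬¬-max : (P : ℕ → Set) (b : ℕ) → (∀ m → P m → m ≤ b) → ∃ P →
  ¬ ¬ (∃ λ m → P m × (∀ m' → P m' → m' ≤ m))
¬¬-max P b bd (m , pm) = go b m (m≤n+m b m) pm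
  where
  go : ∀ fuel m → b ≤ m + fuel → P m → ¬ ¬ (∃ λ m → P m × (∀ m' → P m' → m' ≤ m))
  go zero m le pm =
    return (m , pm , λ m' p → ≤-trans (bd m' p) (≤-trans le (≤-reflexive (+-identityʳ m))))
  go (suc f) m le pm = em (∃ λ m' → P m' × m < m') >>= λ
    { (yes (m' , pm' , lt)) →
        go f m' (≤-trans le (≤-trans (≤-reflexive (+-suc m f)) (+-monoˡ-≤ f lt))) pm'
    ; (no none) → return (m , pm , λ m' p → case m' ≤? m of λ
        { (yes q) → q ; (no nq) → ⊥-elim (none (m' , p , ≰⇒> nq)) }) }

-- Duplicate-free lists and weights

Disjoint : {A : Set} → List A → List A → Set
Disjoint xs ys = ∀ {v} → v ∈ xs → v ∈ ys → ⊥

Only : {A : Set} → (A → Set) → List A → A → Set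
Only P xs x = ∀ {v} → v ∈ xs → P v → v ≡ x

None : {A : Set} → (A → Set) → List A → Set
None P xs = ∀ {v} → v ∈ xs → ¬ P v

module _ {A : Set} where

  uniq-∷ : {x : A} {xs : List A} → x ∉ xs → Unique xs → Unique (x ∷ xs)
  uniq-∷ x∉ u = All.tabulate (λ {v} v∈ eq → x∉ (subst (_∈ _) (sym eq) v∈)) ∷ u

  uniq-head : {x : A} {xs : List A} → Unique (x ∷ xs) → x ∉ xs
  uniq-head = Uniq.Unique[x∷xs]⇒x∉xs

  uniq-tail : {x : A} {xs : List A} → Unique (x ∷ xs) → Unique xs
  uniq-tail (_ ∷ u) = u

  uniq-++ : {xs ys : List A} → Unique xs → Unique ys → Disjoint xs ys → Unique (xs ++ ys)
  uniq-++ u v d = Uniq.++⁺ u v (λ { (p , q) → d p q })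

  uniq-++⁻ : ∀ (xs : List A) {ys} → Unique (xs ++ ys) → Unique xs × Unique ys × Disjoint xs ys
  uniq-++⁻ [] u = [] , u , λ ()
  uniq-++⁻ (x ∷ xs) (px ∷ u) with uniq-++⁻ xs u
  ... | ux , uy , d = uniq-∷ (λ x∈ → All.lookup px (∈-++⁺ˡ x∈) refl) ux , uy ,
    λ { (here refl) q → All.lookup px (∈-++⁺ʳ xs q) refl ; (there p) q → d p q }

  uniq-↭ : {xs ys : List A} → xs ↭ ys → Unique xs → Unique ys
  uniq-↭ p = PermSetoid.Unique-resp-↭ (setoid A) (Perm.↭⇒↭ₛ p)

  uniq-⊆-length : {xs ys : List A} → Unique xs → xs ⊆ ys → length xs ≤ length ys
  uniq-⊆-length {[]} u s = z≤n
  uniq-⊆-length {x ∷ xs} {ys} u s with ∈-∃++ (s (here refl))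
  ... | as , bs , refl = ≤-trans (s≤s (uniq-⊆-length (uniq-tail u) sub))
                           (≤-reflexive (sym (↭-length (shift x as bs))))
    where
    sub : xs ⊆ as ++ bs
    sub v∈ with ∈-resp-↭ (shift x as bs) (s (there v∈))
    ... | here refl = ⊥-elim (uniq-head u v∈)
    ... | there q = q

  total : (A → ℕ) → List A → ℕ
  total w [] = 0
  total w (x ∷ xs) = w x + total w xs

  total-++ : ∀ w (xs ys : List A) → total w (xs ++ ys) ≡ total w xs + total w ys
  total-++ w [] ys = refl
  total-++ w (x ∷ xs) ys rewrite total-++ w xs ys = sym (+-assoc (w x) _ _)

  total-↭ : ∀ w {xs ys : List A} → xs ↭ ys → total w xs ≡ total w ys
  total-↭ w Perm.refl = refl
  total-↭ w (prep x p) = cong (w x +_) (total-↭ w p)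
  total-↭ w (swap {xs} {ys} x y p) rewrite total-↭ w p =
    trans (sym (+-assoc (w x) _ _)) (trans (cong (_+ total w ys) (+-comm (w x) (w y))) (+-assoc (w y) _ _))
  total-↭ w (Perm.trans p q) = trans (total-↭ w p) (total-↭ w q)

  ∈⇒≤total : ∀ w {x : A} {xs} → x ∈ xs → w x ≤ total w xs
  ∈⇒≤total w {xs = x ∷ xs} (here refl) = m≤m+n (w x) _
  ∈⇒≤total w {xs = y ∷ xs} (there p) = ≤-trans (∈⇒≤total w p) (m≤n+m _ (w y))

  total-ones : ∀ (xs : List A) → total (λ _ → 1) xs ≡ length xs
  total-ones [] = refl
  total-ones (x ∷ xs) = cong suc (total-ones xs)

length-allFin : ∀ n → length (allFin n) ≡ n
length-allFin n = List.length-tabulate {n = n} (λ i → i)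

uniq-length : ∀ {n} {xs : List (Fin n)} → Unique xs → length xs ≤ n
uniq-length {n} u = ≤-trans (uniq-⊆-length u (λ {v} _ → ∈-allFin v)) (≤-reflexive (length-allFin n))

-- Walks

-- The list of a walk omits its first vertex, so that concatenation of walks is concatenation of lists.
data Walk {A : Set} (R : A → A → Set) : A → List A → A → Set where
  []  : ∀ {x} → Walk R x [] x
  _∷_ : ∀ {x z zs y} → R x z → Walk R z zs y → Walk R x (z ∷ zs) y

module _ {A : Set} {R : A → A → Set} where

  infixr 5 _⊕_

  _⊕_ : ∀ {x xs y ys z} → Walk R x xs y → Walk R y ys z → Walk R x (xs ++ ys) z
  [] ⊕ w = w
  (r ∷ v) ⊕ w = r ∷ (v ⊕ w)

  cut : ∀ xs {x y ys z} → Walk R x (xs ++ y ∷ ys) z → Walk R x (xs ++ [ y ]) y × Walk R y ys z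
  cut [] (r ∷ w) = (r ∷ []) , w
  cut (_ ∷ xs) (r ∷ w) with cut xs w
  ... | w₁ , w₂ = (r ∷ w₁) , w₂

  split-at : ∀ {x xs y} as {a bs} → Walk R x xs y → x ∷ xs ≡ as ++ a ∷ bs →
    ∃ λ ps → Walk R x ps a × x ∷ ps ≡ as ++ [ a ] × Walk R a bs y
  split-at [] w refl = [] , [] , refl , w
  split-at (_ ∷ as) w refl with cut as w
  ... | w₁ , w₂ = _ , w₁ , refl , w₂

  end∈ : ∀ {x xs y} → Walk R x xs y → y ∈ x ∷ xs
  end∈ [] = here refl
  end∈ (_ ∷ w) = there (end∈ w)

  end∈-tail : ∀ {x xs y} → Walk R x xs y → y ≢ x → y ∈ xs
  end∈-tail w ne with end∈ w
  ... | here eq = ⊥-elim (ne eq)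
  ... | there p = p

  walk-map⁺ : ∀ {S : A → A → Set} {x xs y} → (∀ {a b} → a ∈ x ∷ xs → b ∈ xs → R a b → S a b) →
    Walk R x xs y → Walk S x xs y
  walk-map⁺ f [] = []
  walk-map⁺ f (r ∷ w) = f (here refl) (here refl) r ∷ walk-map⁺ (λ p q → f (there p) (there q)) w

  walk-map : ∀ {S : A → A → Set} {x xs y} → (∀ {a b} → a ∈ x ∷ xs → b ∈ x ∷ xs → R a b → S a b) →
    Walk R x xs y → Walk S x xs y
  walk-map f = walk-map⁺ (λ p q → f p (there q))

  suffix : ∀ {x xs y v} → v ∈ x ∷ xs → Walk R x xs y → Unique (x ∷ xs) →
    ∃ λ vs → Walk R v vs y × Unique (v ∷ vs) × vs ⊆ xs
  suffix (here refl) w u = _ , w , u , λ p → p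
  suffix (there p) (r ∷ w) (_ ∷ u) with suffix p w u
  ... | vs , w' , u' , s = vs , w' , u' , there ∘ s

  rev : (∀ {a b} → R a b → R b a) → ∀ {x xs y} → Walk R x xs y →
    ∃ λ ys → Walk R y ys x × x ∷ xs ↭ y ∷ ys
  rev R-sym [] = [] , [] , Perm.refl
  rev R-sym {x} (r ∷ w) with rev R-sym w
  ... | ys , w' , p = ys ++ [ x ] , w' ⊕ (R-sym r ∷ []) , Perm.trans (prep x p) (∷↭∷ʳ x _)

  module _ (_≟_ : (x y : A) → Dec (x ≡ y)) where
    open import Data.List.Membership.DecPropositional _≟_ using (_∈?_)

    simplify : ∀ {x xs y} → Walk R x xs y →
      ∃ λ ys → Walk R x ys y × Unique (x ∷ ys) × ys ⊆ xs
    simplify [] = [] , [] , [] ∷ [] , λ ()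
    simplify {x} (_∷_ {z = z} r w) with simplify w
    ... | ys , w' , u , s with x ∈? (z ∷ ys)
    ... | no x∉ = z ∷ ys , r ∷ w' , uniq-∷ x∉ u , λ { (here eq) → here eq ; (there p) → there (s p) }
    ... | yes x∈ with suffix x∈ w' u
    ... | vs , w'' , u' , s' = vs , w'' , u' , λ p → there (s (s' p))

  module _ {P : A → Set} (P? : ∀ v → Dec (P v)) where

    first-hit : ∀ {x xs y} → Walk R x xs y → P y →
      ∃₂ λ s ss → Walk R x ss s × P s × Only P (x ∷ ss) s × (∃ λ rest → xs ≡ ss ++ rest)
    first-hit {x} {xs} w Py with P? x
    first-hit {x} {xs} w Py | yes Px = x , [] , [] , Px , (λ { (here eq) _ → eq }) , xs , refl
    first-hit [] Py | no ¬Px = ⊥-elim (¬Px Py)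
    first-hit (r ∷ w) Py | no ¬Px with first-hit w Py
    ... | s , ss , w' , Ps , only , rest , refl = s , _ ∷ ss , r ∷ w' , Ps ,
      (λ { (here refl) Px → ⊥-elim (¬Px Px) ; (there p) Pv → only p Pv }) , rest , refl

    last-hit : ∀ {x xs y} → Walk R x xs y → None P (x ∷ xs) ⊎
      (∃₂ λ s as → ∃ λ bs → Walk R x as s × P s × Walk R s bs y × xs ≡ as ++ bs × None P bs)
    last-hit {x} w with P? x
    last-hit [] | yes Px = inj₂ (_ , [] , [] , [] , Px , [] , refl , λ ())
    last-hit [] | no ¬Px = inj₁ (λ { (here refl) → ¬Px })
    last-hit (r ∷ w) | Px? with last-hit w
    ... | inj₂ (s , as , bs , w₁ , Ps , w₂ , refl , none) =
      inj₂ (s , _ ∷ as , bs , r ∷ w₁ , Ps , w₂ , refl , none)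
    last-hit (r ∷ w) | yes Px | inj₁ none = inj₂ (_ , [] , _ , [] , Px , r ∷ w , refl , none)
    last-hit (r ∷ w) | no ¬Px | inj₁ none = inj₁ (λ { (here refl) → ¬Px ; (there p) → none p })

-- Linking two blocks

-- All that the linking needs to know of a block: wherever the second link arrives, the block can be
-- crossed from there to the fixed element `p` with weight `α`.
ReachesAll : {A : Set} → (A → A → Set) → (A → ℕ) → (A → Set) → A → ℕ → Set
ReachesAll R w Z p α = ∀ {a} → Z a → a ≢ p →
  ∃ λ us → Walk R p us a × Unique (p ∷ us) × (∀ {v} → v ∈ us → Z v) × α ≤ total w (p ∷ us)

module Linking {A : Set} (_≟_ : (x y : A) → Dec (x ≡ y)) (R : A → A → Set)
  (symmetric : ∀ a b → R a b → R b a) (In : A → Set)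
  (conn : ∀ {x y} z → In x → In y → x ≢ z → y ≢ z → ∃ λ xs → Walk R x xs y × z ∉ x ∷ xs)
  (X Y : A → Set) (X? : ∀ v → Dec (X v)) (Y? : ∀ v → Dec (Y v))
  (X⊆In : ∀ {v} → X v → In v) (Y⊆In : ∀ {v} → Y v → In v) where

  open import Data.List.Membership.DecPropositional _≟_ using (_∈?_)

  private
    R-sym : ∀ {a b} → R a b → R b a
    R-sym = symmetric _ _

  -- Menger's fan of two paths from `c` to `X`, with `p` prescribed as one of the two ends.
  record Fan (p c : A) : Set where
    constructor fan
    field
      a        : A
      ys zs    : List A
      to-p     : Walk R c ys p
      to-a     : Walk R c zs a
      Xa       : X a
      distinct : Unique (c ∷ ys ++ zs)
      ys-X     : Only X ys p
      zs-X     : Only X zs a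

  private
    reroute : ∀ {c c' s : A} ss as bs zs → Unique (c ∷ (as ++ s ∷ bs) ++ zs) → Unique (c' ∷ ss) →
      c ∉ c' ∷ ss → (∀ {v} → v ∈ c' ∷ ss → v ∈ (as ++ s ∷ bs) ⊎ v ∈ zs → v ≡ s) →
      Unique (c' ∷ (ss ++ bs) ++ c ∷ zs)
    reroute {c} {c'} {s} ss as bs zs u uS c∉ only =
      uniq-++ (uniq-++ uS (uniq-tail usbs) dSb) ucz dd
      where
      parts = uniq-++⁻ (as ++ s ∷ bs) (uniq-tail u)
      usbs = proj₁ (proj₂ (uniq-++⁻ as (proj₁ parts)))
      ucz = uniq-∷ (λ p → uniq-head u (∈-++⁺ʳ (as ++ s ∷ bs) p)) (proj₁ (proj₂ parts))
      dSb : Disjoint (c' ∷ ss) bs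
      dSb p q with only p (inj₁ (∈-++⁺ʳ as (there q)))
      ... | refl = uniq-head usbs q
      dd : Disjoint ((c' ∷ ss) ++ bs) (c ∷ zs)
      dd p q with ∈-++⁻ (c' ∷ ss) p
      dd p (here refl) | inj₁ pS = c∉ pS
      dd p (there q) | inj₁ pS with only pS (inj₂ q)
      ... | refl = proj₂ (proj₂ parts) (∈-++⁺ʳ as (here refl)) q
      dd p (here refl) | inj₂ pb = uniq-head u (∈-++⁺ˡ (∈-++⁺ʳ as (there pb)))
      dd p (there q) | inj₂ pb = proj₂ (proj₂ parts) (∈-++⁺ʳ as (there pb)) q

    swapped : ∀ {c : A} ys zs → Unique (c ∷ ys ++ zs) → Unique (c ∷ zs ++ ys)
    swapped ys zs = uniq-↭ (prep _ (++-comm ys zs))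

  -- A path from `c'` to `p` that avoids `c` is stopped at its first vertex `s` on the fan or in
  -- `X`. If `s` lies on a branch, that branch is now entered at `s`, and the other one is reached
  -- through `c`. If `s` is a new vertex of `X`, the path to `s` replaces the branch to `a`, and the
  -- branch to `p` is prolonged by `c`.
  fan-step : ∀ {p c c'} → X p → ¬ X c → ¬ X c' → In c' → c' ≢ c → R c' c → Fan p c → Fan p c'
  fan-step {p} {c} {c'} Xp ¬Xc ¬Xc' Inc' c'≢c r (fan a ys zs wp wa Xa u ysX zsX)
    with conn c Inc' (X⊆In Xp) c'≢c (λ { refl → ¬Xc Xp })
  ... | ss₀ , w₀ , c∉₀ with simplify _≟_ w₀
  ... | ss₁ , w₁ , u₁ , sub with first-hit (λ v → (v ∈? ys ⊎-dec v ∈? zs) ⊎-dec X? v) w₁ (inj₂ Xp)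
  ... | s , ss , w , Hs , only , rest , refl = go Hs
    where
    c∉ : c ∉ c' ∷ ss
    c∉ (here refl) = c'≢c refl
    c∉ (there q) = c∉₀ (there (sub (∈-++⁺ˡ q)))
    uS : Unique (c' ∷ ss)
    uS = proj₁ (uniq-++⁻ (c' ∷ ss) u₁)
    go : (s ∈ ys ⊎ s ∈ zs) ⊎ X s → Fan p c'
    go (inj₁ (inj₁ s∈)) with ∈-∃++ s∈
    ... | as , bs , refl = fan a (ss ++ bs) (c ∷ zs) (w ⊕ proj₂ (cut as wp)) (r ∷ wa) Xa
      (reroute ss as bs zs u uS c∉ (λ q h → only q (inj₁ h)))
      (λ q Xv → case ∈-++⁻ ss q of λ
        { (inj₁ q') → case only (there q') (inj₂ Xv) of λ { refl → ysX (∈-++⁺ʳ as (here refl)) Xv }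
        ; (inj₂ q') → ysX (∈-++⁺ʳ as (there q')) Xv })
      (λ { (here refl) Xc → ⊥-elim (¬Xc Xc) ; (there q) → zsX q })
    go (inj₁ (inj₂ s∈)) with ∈-∃++ s∈
    ... | as , bs , refl = fan a (c ∷ ys) (ss ++ bs) (r ∷ wp) (w ⊕ proj₂ (cut as wa)) Xa
      (swapped (ss ++ bs) (c ∷ ys) (reroute ss as bs ys (swapped ys (as ++ s ∷ bs) u) uS c∉
        (λ { q (inj₁ h) → only q (inj₁ (inj₂ h)) ; q (inj₂ h) → only q (inj₁ (inj₁ h)) })))
      (λ { (here refl) Xc → ⊥-elim (¬Xc Xc) ; (there q) → ysX q })
      (λ q Xv → case ∈-++⁻ ss q of λ
        { (inj₁ q') → case only (there q') (inj₂ Xv) of λ { refl → zsX (∈-++⁺ʳ as (here refl)) Xv }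
        ; (inj₂ q') → zsX (∈-++⁺ʳ as (there q')) Xv })
    go (inj₂ Xs) with s ∈? ys | s ∈? zs
    ... | yes q | _ = go (inj₁ (inj₁ q))
    ... | no _ | yes q = go (inj₁ (inj₂ q))
    ... | no s∉ys | no s∉zs = fan s (c ∷ ys) ss (r ∷ wp) w Xs
      (swapped ss (c ∷ ys) (uniq-++ uS (proj₁ (uniq-++⁻ (c ∷ ys) u))
        (λ { q (here refl) → c∉ q
           ; q (there q') → case only q (inj₁ (inj₁ q')) of λ { refl → s∉ys q' } })))
      (λ { (here refl) Xc → ⊥-elim (¬Xc Xc) ; (there q) → ysX q })
      (λ q Xv → only (there q) (inj₂ Xv))

  fan-along : ∀ {p c ts q} → X p → Walk R c ts q → Unique (c ∷ ts) →
    None X (c ∷ ts) → (∀ {v} → v ∈ ts → In v) → Fan p c → Fan p q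
  fan-along Xp [] u ¬X In-ts f = f
  fan-along Xp (r ∷ w) u ¬X In-ts f =
    fan-along Xp w (uniq-tail u) (¬X ∘ there) (In-ts ∘ there)
      (fan-step Xp (¬X (here refl)) (¬X (there (here refl))) (In-ts (here refl))
        (λ { refl → uniq-head u (here refl) }) (R-sym r) f)

  fan-start : ∀ {p c a₀} → X p → X a₀ → a₀ ≢ p → ¬ X c → In c → R c p → Fan p c
  fan-start {p} {c} Xp Xa₀ a₀≢p ¬Xc Inc r
    with conn p Inc (X⊆In Xa₀) (λ { refl → ¬Xc Xp }) a₀≢p
  ... | ss₀ , w₀ , p∉₀ with simplify _≟_ w₀
  ... | ss₁ , w₁ , u₁ , sub with first-hit X? w₁ Xa₀
  ... | s , ss , w , Xs , only , rest , refl =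
    fan s [ p ] ss (r ∷ []) w Xs
      (uniq-∷ (λ { (here refl) → ¬Xc Xp ; (there q) → uniq-head u₁ (∈-++⁺ˡ q) })
        (uniq-∷ (λ q → p∉₀ (there (sub (∈-++⁺ˡ q)))) (proj₁ (uniq-++⁻ ss (uniq-tail u₁)))))
      (λ { (here refl) _ → refl }) (λ q Xv → only (there q) Xv)

  -- Which of `p` and `a` is joined to `q` cannot be prescribed, so `ends` leaves it open; it
  -- matters only that `p` and `q` are both among the four ends.
  record Links (p q : A) : Set where
    constructor links
    field
      a b ue ve : A
      us vs     : List A
      Xa        : X a
      a≢p       : a ≢ p
      Yb        : Y b
      b≢q       : b ≢ q
      from-q    : Walk R q us ue
      from-b    : Walk R b vs ve
      ends      : (ue ≡ p × ve ≡ a) ⊎ (ue ≡ a × ve ≡ p)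
      distinct  : Unique (us ++ vs)
      us-X      : Only X us ue
      vs-X      : Only X vs ve
      us-Y      : None Y us
      vs-Y      : None Y vs

  module _ (X∩Y : ∀ {v} → X v → Y v → ⊥) where

    private
      sub-uniq : ∀ (as : List A) {bs} cs {ds} → Unique ((as ++ bs) ++ (cs ++ ds)) → Unique (bs ++ ds)
      sub-uniq as {bs} cs {ds} u with uniq-++⁻ (as ++ bs) u
      ... | u₁ , u₂ , d = uniq-++ (proj₁ (proj₂ (uniq-++⁻ as u₁))) (proj₁ (proj₂ (uniq-++⁻ cs u₂)))
                           (λ p q → d (∈-++⁺ʳ as p) (∈-++⁺ʳ cs q))

      extend : ∀ {s : A} ss as bs cs → Unique ((as ++ s ∷ bs) ++ cs) → Unique ss →
        (∀ {v} → v ∈ ss → v ∈ (as ++ s ∷ bs) ⊎ v ∈ cs → v ≡ s) → Unique ((ss ++ bs) ++ cs)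
      extend {s} ss as bs cs u uS only = uniq-++ (uniq-++ uS (uniq-tail usbs) dSb) (proj₁ (proj₂ parts)) dd
        where
        parts = uniq-++⁻ (as ++ s ∷ bs) u
        usbs = proj₁ (proj₂ (uniq-++⁻ as (proj₁ parts)))
        dSb : Disjoint ss bs
        dSb p q with only p (inj₁ (∈-++⁺ʳ as (there q)))
        ... | refl = uniq-head usbs q
        dd : Disjoint (ss ++ bs) cs
        dd p q with ∈-++⁻ ss p
        ... | inj₂ pb = proj₂ (proj₂ parts) (∈-++⁺ʳ as (there pb)) q
        ... | inj₁ pS with only pS (inj₂ q)
        ... | refl = proj₂ (proj₂ parts) (∈-++⁺ʳ as (here refl)) q

    -- Both branches leave `Y` at `q`, so a second exit is needed. A path from `b₀` that avoids `q`
    -- is followed from its last vertex `b` in `Y` to the first branch it meets and continues there;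
    -- the other branch still starts at `q`.
    both-at-q : ∀ {p q a bs cs b₀} → X p → Y q → Walk R q bs p → Walk R q cs a → X a → a ≢ p →
      Unique (q ∷ bs ++ cs) →
      Only X bs p → Only X cs a →
      None Y bs → None Y cs → Y b₀ → b₀ ≢ q → Links p q
    both-at-q {p} {q} {a} {bs} {cs} {b₀} Xp Yq wp wa Xa a≢p u bsX csX bsY csY Yb₀ b₀≢q
      with conn q (Y⊆In Yb₀) (X⊆In Xp) b₀≢q (λ { refl → X∩Y Xp Yq })
    ... | ss₀ , w₀ , q∉₀ with simplify _≟_ w₀
    ... | ss₁ , w₁ , u₁ , sub with first-hit (λ v → (v ∈? bs ⊎-dec v ∈? cs) ⊎-dec X? v) w₁ (inj₂ Xp)
    ... | s , ss₂ , w₂ , Hs , only₂ , rest , refl with last-hit Y? w₂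
    ... | inj₁ none = ⊥-elim (none (here refl) Yb₀)
    ... | inj₂ (b , as , ss , wab , Yb , w , refl , ssY) = go Hs
      where
      u₂ = proj₁ (uniq-++⁻ (b₀ ∷ as ++ ss) u₁)
      uS : Unique ss
      uS = proj₁ (proj₂ (uniq-++⁻ as (uniq-tail u₂)))
      only : ∀ {v} → v ∈ ss → (v ∈ bs ⊎ v ∈ cs) ⊎ X v → v ≡ s
      only p = only₂ (there (∈-++⁺ʳ as p))
      b∈ : b ∈ b₀ ∷ as
      b∈ = end∈ wab
      b≢q : b ≢ q
      b≢q refl with b∈
      ... | here eq = b₀≢q (sym eq)
      ... | there p = q∉₀ (there (sub (∈-++⁺ˡ (∈-++⁺ˡ p))))
      go : (s ∈ bs ⊎ s ∈ cs) ⊎ X s → Links p q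
      go (inj₁ (inj₁ s∈)) with ∈-∃++ s∈
      ... | as' , bs' , refl = links a b a p cs (ss ++ bs') Xa a≢p Yb b≢q wa (w ⊕ proj₂ (cut as' wp))
        (inj₂ (refl , refl))
        (uniq-↭ (++-comm (ss ++ bs') cs) (extend ss as' bs' cs (uniq-tail u) uS (λ p h → only p (inj₁ h))))
        csX
        (λ p Xv → case ∈-++⁻ ss p of λ
          { (inj₁ p') → case only p' (inj₂ Xv) of λ { refl → bsX (∈-++⁺ʳ as' (here refl)) Xv }
          ; (inj₂ p') → bsX (∈-++⁺ʳ as' (there p')) Xv })
        csY
        (λ p → case ∈-++⁻ ss p of λ { (inj₁ p') → ssY p' ; (inj₂ p') → bsY (∈-++⁺ʳ as' (there p')) })
      go (inj₁ (inj₂ s∈)) with ∈-∃++ s∈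
      ... | as' , cs' , refl = links a b p a bs (ss ++ cs') Xa a≢p Yb b≢q wp (w ⊕ proj₂ (cut as' wa))
        (inj₁ (refl , refl))
        (uniq-↭ (++-comm (ss ++ cs') bs)
          (extend ss as' cs' bs (uniq-↭ (++-comm bs (as' ++ s ∷ cs')) (uniq-tail u)) uS
            (λ { p (inj₁ h) → only p (inj₁ (inj₂ h)) ; p (inj₂ h) → only p (inj₁ (inj₁ h)) })))
        bsX
        (λ p Xv → case ∈-++⁻ ss p of λ
          { (inj₁ p') → case only p' (inj₂ Xv) of λ { refl → csX (∈-++⁺ʳ as' (here refl)) Xv }
          ; (inj₂ p') → csX (∈-++⁺ʳ as' (there p')) Xv })
        bsY
        (λ p → case ∈-++⁻ ss p of λ { (inj₁ p') → ssY p' ; (inj₂ p') → csY (∈-++⁺ʳ as' (there p')) })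
      go (inj₂ Xs) with s ∈? bs | s ∈? cs
      ... | yes h | _ = go (inj₁ (inj₁ h))
      ... | no _ | yes h = go (inj₁ (inj₂ h))
      ... | no s∉bs | no s∉cs = links s b p s bs ss Xs
        (λ { refl → s∉bs (end∈-tail wp (λ { refl → X∩Y Xp Yq })) }) Yb b≢q wp w (inj₁ (refl , refl))
        (uniq-++ (proj₁ (uniq-++⁻ bs (uniq-tail u))) uS
          (λ h p → case only p (inj₁ (inj₁ h)) of λ { refl → s∉bs h }))
        bsX (λ p Xv → only p (inj₂ Xv)) bsY ssY

    -- Neither branch leaves `Y` at `q`. The given path from `q` is followed until it first meets a
    -- branch, and replaces the beginning of that branch. A meeting occurs since the path runs to
    -- `p`, and `p` stays an end in either case.
    both-off-q : ∀ {p q a ts bs cs b c} → X p → Y q → Walk R q ts p → Unique (q ∷ ts) →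
      Only X ts p → None Y ts →
      Walk R b bs p → Walk R c cs a → X a → a ≢ p → Y b → b ≢ q → Y c → c ≢ q → Unique (bs ++ cs) →
      q ∉ bs ++ cs →
      Only X bs p → Only X cs a →
      None Y bs → None Y cs → Links p q
    both-off-q {p} {q} {a} {ts} {bs} {cs} {b} {c} Xp Yq wt ut tsX tsY wp wa Xa a≢p Yb b≢q Yc c≢q u q∉ bsX csX bsY csY
      with first-hit (λ v → v ∈? bs ⊎-dec v ∈? cs) wt (inj₁ (end∈-tail wp (λ { refl → X∩Y Xp Yb })))
    ... | s , ss , w , Hs , only , rest , refl = go Hs
      where
      uS = proj₁ (uniq-++⁻ ss (uniq-tail ut))
      go : s ∈ bs ⊎ s ∈ cs → Links p q
      go (inj₁ s∈) with ∈-∃++ s∈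
      ... | as' , bs' , refl = links a c p a (ss ++ bs') cs Xa a≢p Yc c≢q (w ⊕ proj₂ (cut as' wp)) wa
        (inj₁ (refl , refl)) (extend ss as' bs' cs u uS (λ h → only (there h)))
        (λ h Xv → case ∈-++⁻ ss h of λ
          { (inj₁ h') → tsX (∈-++⁺ˡ h') Xv ; (inj₂ h') → bsX (∈-++⁺ʳ as' (there h')) Xv })
        csX
        (λ h → case ∈-++⁻ ss h of λ { (inj₁ h') → tsY (∈-++⁺ˡ h') ; (inj₂ h') → bsY (∈-++⁺ʳ as' (there h')) })
        csY
      go (inj₂ s∈) with ∈-∃++ s∈
      ... | as' , cs' , refl = links a b a p (ss ++ cs') bs Xa a≢p Yb b≢q (w ⊕ proj₂ (cut as' wa)) wp
        (inj₂ (refl , refl))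
        (extend ss as' cs' bs (uniq-↭ (++-comm bs (as' ++ s ∷ cs')) u) uS
          (λ { h (inj₁ h') → only (there h) (inj₂ h') ; h (inj₂ h') → only (there h) (inj₁ h') }))
        (λ {v} h Xv → case ∈-++⁻ ss h of λ
          { (inj₁ h') → ⊥-elim (clash (tsX (∈-++⁺ˡ h') Xv) h') ; (inj₂ h') → csX (∈-++⁺ʳ as' (there h')) Xv })
        bsX
        (λ h → case ∈-++⁻ ss h of λ { (inj₁ h') → tsY (∈-++⁺ˡ h') ; (inj₂ h') → csY (∈-++⁺ʳ as' (there h')) })
        bsY
        where
        p∈ : p ∈ bs
        p∈ = end∈-tail wp (λ { refl → X∩Y Xp Yb })
        clash : ∀ {v} → v ≡ p → v ∈ ss → ⊥
        clash refl h with only (there h) (inj₁ p∈)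
        ... | refl = proj₂ (proj₂ (uniq-++⁻ bs u)) p∈ s∈

    target≢p : ∀ {p q a ys zs} → X p → Y q → Unique (q ∷ ys ++ zs) → Walk R q ys p → Walk R q zs a → a ≢ p
    target≢p {ys = ys} Xp Yq u wp wa refl = proj₂ (proj₂ (uniq-++⁻ ys (uniq-tail u)))
      (end∈-tail wp (λ { refl → X∩Y Xp Yq })) (end∈-tail wa (λ { refl → X∩Y Xp Yq }))

    -- The fan starts at the neighbour of `p` on the given path and is carried along that path to
    -- `q`. Cutting each branch at its last vertex in `Y` leaves two disjoint links that already end
    -- at `p` and at `a`; the cases concern which of them still starts at `q`.
    link : ∀ {p q a₀ b₀ ts} → X p → Y q → X a₀ → a₀ ≢ p → Y b₀ → b₀ ≢ q → Walk R p ts q → Unique (p ∷ ts) →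
      None X ts → Only Y ts q → (∀ {v} → v ∈ ts → In v) → Links p q
    link Xp Yq Xa₀ a₀≢p Yb₀ b₀≢q [] ut tsX tsY In-ts = ⊥-elim (X∩Y Xp Yq)
    link {p} {q} {ts = c ∷ ts} Xp Yq Xa₀ a₀≢p Yb₀ b₀≢q (r ∷ w) ut tsX tsY In-ts
      with fan-along Xp w (uniq-tail ut) tsX (In-ts ∘ there)
             (fan-start Xp Xa₀ a₀≢p (tsX (here refl)) (In-ts (here refl)) (R-sym r))
    ... | fan a ys zs wp wa Xa u ysX zsX with last-hit Y? wp | last-hit Y? wa
    ... | inj₁ none | _ = ⊥-elim (none (here refl) Yq)
    ... | inj₂ _ | inj₁ none = ⊥-elim (none (here refl) Yq)
    ... | inj₂ (b , as , bs , wb , Yb , wp' , refl , bsY) | inj₂ (c' , as' , cs , wc , Yc , wa' , refl , csY)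
      with b ≟ q | c' ≟ q
    ... | yes refl | yes refl = both-at-q Xp Yq wp' wa' Xa (target≢p Xp Yq u wp wa)
            (uniq-∷ (λ h → case ∈-++⁻ bs h of λ
                { (inj₁ h') → bsY h' Yq ; (inj₂ h') → csY h' Yq })
              (sub-uniq as as' (uniq-tail u)))
            (ysX ∘ ∈-++⁺ʳ as) (zsX ∘ ∈-++⁺ʳ as') bsY csY Yb₀ b₀≢q
    ... | yes refl | no c'≢q = links a c' p a bs cs Xa (target≢p Xp Yq u wp wa) Yc c'≢q wp' wa' (inj₁ (refl , refl))
            (sub-uniq as as' (uniq-tail u)) (ysX ∘ ∈-++⁺ʳ as) (zsX ∘ ∈-++⁺ʳ as') bsY csY
    ... | no b≢q | yes refl = links a b a p cs bs Xa (target≢p Xp Yq u wp wa) Yb b≢q wa' wp' (inj₂ (refl , refl))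
            (uniq-↭ (++-comm bs cs) (sub-uniq as as' (uniq-tail u))) (zsX ∘ ∈-++⁺ʳ as') (ysX ∘ ∈-++⁺ʳ as) csY bsY
    ... | no b≢q | no c'≢q with rev R-sym (r ∷ w)
    ... | rs , wr , perm = both-off-q Xp Yq wr (uniq-↭ perm ut)
            (λ h Xv → case ∈-resp-↭ (↭-sym perm) (there h) of λ
              { (here eq) → eq ; (there h') → ⊥-elim (tsX h' Xv) })
            (λ h Yv → case ∈-resp-↭ (↭-sym perm) (there h) of λ
              { (here refl) → X∩Y Xp Yv
              ; (there h') → case tsY h' Yv of λ { refl → uniq-head (uniq-↭ perm ut) h } })
            wp' wa' Xa (target≢p Xp Yq u wp wa) Yb b≢q Yc c'≢q (sub-uniq as as' (uniq-tail u))
            (λ h → case ∈-++⁻ bs h of λ { (inj₁ h') → bsY h' Yq ; (inj₂ h') → csY h' Yq })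
            (ysX ∘ ∈-++⁺ʳ as) (zsX ∘ ∈-++⁺ʳ as') bsY csY

  module _ (w : A → ℕ) where

    private
      -- The cycle runs from `q` to `X`, through `X`, back along the other link to `b`, and through
      -- `Y` to `q`. A walk omits its first vertex from its list, so in the weight `ue` and `b` are
      -- recovered as last entries of the links that lead to them.
      assemble : ∀ {α β q b ue ve us vs xs ys} → (∀ {v} → X v → Y v → ⊥) → Y b → b ≢ q →
        Walk R q us ue → Walk R b vs ve →
        Unique (us ++ vs) → Only X us ue → Only X vs ve →
        None Y us → None Y vs →
        Walk R ue xs ve → Unique (ue ∷ xs) → (∀ {v} → v ∈ ue ∷ xs → X v) → α ≤ total w (ue ∷ xs) →
        Walk R q ys b → Unique (q ∷ ys) → (∀ {v} → v ∈ q ∷ ys → Y v) → β ≤ total w (q ∷ ys) →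
        ∃₂ λ x zs → Walk R x zs x × Unique zs × α + β ≤ total w zs
      assemble {α} {β} {q} {b} {ue} {ve} {us} {vs} {xs} {ys} X∩Y Yb b≢q wu wv uu usX vsX usY vsY wx ux xX α≤ wy uy yY β≤
        with rev R-sym wv | rev R-sym wy
      ... | vr , wvr , pv | yr , wyr , py =
        q , us ++ xs ++ vr ++ yr , wu ⊕ wx ⊕ wvr ⊕ wyr ,
        uniq-++ (proj₁ u-parts) (uniq-++ (uniq-tail ux) (uniq-++ (uniq-tail uvr) (uniq-tail uyr) vr-yr)
            xs-rest) us-rest ,
        weight
        where
        u-parts = uniq-++⁻ us uu
        Xue = xX (here refl)
        Xve : X ve
        Xve = xX (end∈ wx)
        uvr : Unique (ve ∷ vr)
        uvr = uniq-↭ pv (uniq-∷ (λ p → vsY p Yb) (proj₁ (proj₂ u-parts)))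
        uyr : Unique (b ∷ yr)
        uyr = uniq-↭ py uy
        vr⊆ : ∀ {v} → v ∈ vr → v ≡ b ⊎ v ∈ vs
        vr⊆ p with ∈-resp-↭ (↭-sym pv) (there p)
        ... | here eq = inj₁ eq
        ... | there p' = inj₂ p'
        vr-¬X : None X vr
        vr-¬X p Xv with vr⊆ p
        ... | inj₁ refl = X∩Y Xv Yb
        ... | inj₂ p' with vsX p' Xv
        ... | refl = uniq-head uvr p
        vr-Y : Only Y vr b
        vr-Y p Yv with vr⊆ p
        ... | inj₁ eq = eq
        ... | inj₂ p' = ⊥-elim (vsY p' Yv)
        yr-Y : ∀ {v} → v ∈ yr → Y v
        yr-Y p = yY (∈-resp-↭ (↭-sym py) (there p))
        vr-yr : Disjoint vr yr
        vr-yr p p' with vr-Y p (yr-Y p')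
        ... | refl = uniq-head uyr p'
        xs-rest : Disjoint xs (vr ++ yr)
        xs-rest p p' with ∈-++⁻ vr p'
        ... | inj₁ h = vr-¬X h (xX (there p))
        ... | inj₂ h = X∩Y (xX (there p)) (yr-Y h)
        us-rest : Disjoint us (xs ++ vr ++ yr)
        us-rest p p' with ∈-++⁻ xs p'
        ... | inj₁ h with usX p (xX (there h))
        ... | refl = uniq-head ux h
        us-rest p p' | inj₂ h with ∈-++⁻ vr h
        ... | inj₂ h' = usY p (yr-Y h')
        ... | inj₁ h' with vr⊆ h'
        ... | inj₁ refl = usY p Yb
        ... | inj₂ h'' = proj₂ (proj₂ u-parts) p h''
        ue∈ : ue ∈ us
        ue∈ = end∈-tail wu (λ { refl → X∩Y Xue (yY (here refl)) })
        b∈ : b ∈ vr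
        b∈ = end∈-tail wvr (λ { refl → X∩Y Xve Yb })
        open ≤-Reasoning
        weight : α + β ≤ total w (us ++ xs ++ vr ++ yr)
        weight = begin
          α + β ≤⟨ +-mono-≤ α≤ (≤-trans β≤ (≤-reflexive (total-↭ w py))) ⟩
          (w ue + total w xs) + (w b + total w yr)
            ≤⟨ +-mono-≤ (+-monoˡ-≤ _ (∈⇒≤total w ue∈)) (+-monoˡ-≤ _ (∈⇒≤total w b∈)) ⟩
          (total w us + total w xs) + (total w vr + total w yr)
            ≡⟨ +-assoc (total w us) _ _ ⟩
          total w us + (total w xs + (total w vr + total w yr))
            ≡⟨ cong (λ m → total w us + (total w xs + m)) (total-++ w vr yr) ⟨
          total w us + (total w xs + total w (vr ++ yr))
            ≡⟨ cong (total w us +_) (total-++ w xs _) ⟨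
          total w us + total w (xs ++ vr ++ yr) ≡⟨ total-++ w us _ ⟨
          total w (us ++ xs ++ vr ++ yr) ∎

    cycle-apart : ∀ {α β p q a₀ b₀ ts} → (∀ {v} → X v → Y v → ⊥) →
      X p → Y q → X a₀ → a₀ ≢ p → Y b₀ → b₀ ≢ q → Walk R p ts q → Unique (p ∷ ts) →
      None X ts → Only Y ts q → (∀ {v} → v ∈ ts → In v) →
      ReachesAll R w X p α → ReachesAll R w Y q β →
      ∃₂ λ x zs → Walk R x zs x × Unique zs × α + β ≤ total w zs
    cycle-apart X∩Y Xp Yq Xa₀ a₀≢p Yb₀ b₀≢q wt ut tsX tsY tsIn tX tY
      with link X∩Y Xp Yq Xa₀ a₀≢p Yb₀ b₀≢q wt ut tsX tsY tsIn
    ... | links a b ue ve us vs Xa a≢p Yb b≢q wu wv ends u usX vsX usY vsY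
      with tX Xa a≢p | tY Yb b≢q
    ... | xs , wx , ux , xX , α≤ | ys , wy , uy , yY , β≤ with ends
    ... | inj₁ (refl , refl) = assemble X∩Y Yb b≢q wu wv u usX vsX usY vsY wx ux
          (λ { (here refl) → Xp ; (there h) → xX h }) α≤ wy uy (λ { (here refl) → Yq ; (there h) → yY h }) β≤
    ... | inj₂ (refl , refl) with rev R-sym wx
    ... | xr , wxr , px = assemble X∩Y Yb b≢q wu wv u usX vsX usY vsY wxr (uniq-↭ px ux)
          (λ h → case ∈-resp-↭ (↭-sym px) h of λ { (here refl) → Xp ; (there h') → xX h' })
          (≤-trans α≤ (≤-reflexive (total-↭ w px)))
          wy uy (λ { (here refl) → Yq ; (there h) → yY h }) β≤

    -- The common element `p` serves as one link, so a single path from `Y` to `X` that avoids `p`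
    -- is enough. Both `α` and `β` include the weight of `p`, while the cycle passes it once.
    cycle-sharing : ∀ {α β p a₀ b₀} → (∀ {v} → X v → Y v → v ≡ p) →
      X p → Y p → X a₀ → a₀ ≢ p → Y b₀ → b₀ ≢ p →
      ReachesAll R w X p α → ReachesAll R w Y p β →
      ∃₂ λ x zs → Walk R x zs x × Unique zs × α + β ≤ w p + total w zs
    cycle-sharing {α} {β} {p} {a₀} {b₀} X∩Y Xp Yp Xa₀ a₀≢p Yb₀ b₀≢p tX tY
      with conn p (Y⊆In Yb₀) (X⊆In Xa₀) b₀≢p a₀≢p
    ... | ss₀ , w₀ , p∉₀ with simplify _≟_ w₀
    ... | ss₁ , w₁ , u₁ , sub with first-hit X? w₁ Xa₀
    ... | a , ss₂ , w₂ , Xa , only , rest , refl with last-hit Y? w₂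
    ... | inj₁ none = ⊥-elim (none (here refl) Yb₀)
    ... | inj₂ (b , as , vs , wab , Yb , wv , refl , vsY) = go (tX Xa a≢p) (tY Yb b≢p)
      where
      p∉ : p ∉ b₀ ∷ as ++ vs
      p∉ (here eq) = b₀≢p (sym eq)
      p∉ (there h) = p∉₀ (there (sub (∈-++⁺ˡ h)))
      a≢p : a ≢ p
      a≢p refl = p∉ (end∈ w₂)
      b≢p : b ≢ p
      b≢p refl = p∉ (∈-++⁺ˡ {xs = b₀ ∷ as} (end∈ wab))
      uvs : Unique (b ∷ vs)
      uvs = uniq-∷ (λ h → vsY h Yb) (proj₁ (proj₂ (uniq-++⁻ as (proj₁ (uniq-++⁻ (as ++ vs) (uniq-tail u₁))))))
      go : _ → _ → ∃₂ λ x zs → Walk R x zs x × Unique zs × α + β ≤ w p + total w zs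
      go (xs , wx , ux , xX , α≤) (ys , wy , uy , yY , β≤) with rev R-sym wv | rev R-sym wy
      ... | vr , wvr , pv | yr , wyr , py =
        p , xs ++ vr ++ yr , wx ⊕ wvr ⊕ wyr ,
        uniq-++ (uniq-tail ux) (uniq-++ (uniq-tail uvr) (uniq-tail uyr) vr-yr) xs-rest , weight
        where
        uvr : Unique (a ∷ vr)
        uvr = uniq-↭ pv uvs
        uyr : Unique (b ∷ yr)
        uyr = uniq-↭ py uy
        b∈ : b ∈ vr
        b∈ = end∈-tail wvr (λ { refl → b≢p (X∩Y Xa Yb) })
        yr-Y : ∀ {v} → v ∈ yr → Y v
        yr-Y h with ∈-resp-↭ (↭-sym py) (there h)
        ... | here refl = Yp
        ... | there h' = yY h'
        vr-yr : Disjoint vr yr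
        vr-yr h h' with ∈-resp-↭ (↭-sym pv) (there h)
        ... | here refl = uniq-head uyr h'
        ... | there q = vsY q (yr-Y h')
        xs-rest : Disjoint xs (vr ++ yr)
        xs-rest h h' with ∈-++⁻ vr h'
        ... | inj₂ q with X∩Y (xX h) (yr-Y q)
        ... | refl = uniq-head ux h
        xs-rest h h' | inj₁ q with ∈-resp-↭ (↭-sym pv) (there q)
        ... | here refl = b≢p (X∩Y (xX h) Yb)
        ... | there q' with only (there (∈-++⁺ʳ as q')) (xX h)
        ... | refl = uniq-head uvr q
        open ≤-Reasoning
        weight : α + β ≤ w p + total w (xs ++ vr ++ yr)
        weight = begin
          α + β ≤⟨ +-mono-≤ α≤ (≤-trans β≤ (≤-reflexive (total-↭ w py))) ⟩
          (w p + total w xs) + (w b + total w yr) ≤⟨ +-monoʳ-≤ (w p + total w xs) (+-monoˡ-≤ (total w yr) (∈⇒≤total w b∈)) ⟩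
          (w p + total w xs) + (total w vr + total w yr) ≡⟨ cong ((w p + total w xs) +_) (total-++ w vr yr) ⟨
          (w p + total w xs) + total w (vr ++ yr) ≡⟨ +-assoc (w p) _ _ ⟩
          w p + (total w xs + total w (vr ++ yr)) ≡⟨ cong (w p +_) (total-++ w xs _) ⟨
          w p + total w (xs ++ vr ++ yr) ∎

-- Traversing a block

module _ {A : Set} {P : A → Set} (P? : ∀ v → Dec (P v)) where

  first-split : ∀ {x} xs → x ∈ xs → P x →
    ∃₂ λ as s → ∃ λ bs → xs ≡ as ++ s ∷ bs × P s × None P as
  first-split (x ∷ xs) x∈ Px with P? x
  ... | yes p = [] , x , xs , refl , p , λ ()
  first-split (x ∷ xs) (here refl) Px | no ¬p = ⊥-elim (¬p Px)
  first-split (x ∷ xs) (there x∈) Px | no ¬p with first-split xs x∈ Px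
  ... | as , s , bs , refl , Ps , none =
    x ∷ as , s , bs , refl , Ps , λ { (here refl) → ¬p ; (there q) → none q }

  last-split : ∀ {x} xs → x ∈ xs → P x →
    ∃₂ λ as s → ∃ λ bs → xs ≡ as ++ s ∷ bs × P s × None P bs
  last-split xs x∈ Px with go xs
    where
    go : ∀ xs → None P xs ⊎
      (∃₂ λ as s → ∃ λ bs → xs ≡ as ++ s ∷ bs × P s × None P bs)
    go [] = inj₁ λ ()
    go (x ∷ xs) with go xs | P? x
    ... | inj₂ (as , s , bs , refl , Ps , none) | _ = inj₂ (x ∷ as , s , bs , refl , Ps , none)
    ... | inj₁ none | yes p = inj₂ ([] , x , xs , refl , p , none)
    ... | inj₁ none | no ¬p = inj₁ λ { (here refl) → ¬p ; (there q) → none q }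
  ... | inj₁ none = ⊥-elim (none x∈ Px)
  ... | inj₂ r = r

  adjacent-or-sparse : ∀ xs →
    (∃₂ λ as i → ∃₂ λ j bs → xs ≡ as ++ i ∷ j ∷ bs × P i × P j) ⊎ 2 * length (filter P? xs) ≤ suc (length xs)
  adjacent-or-sparse [] = inj₂ z≤n
  adjacent-or-sparse (x ∷ []) with P? x
  ... | yes _ = inj₂ ≤-refl
  ... | no _ = inj₂ z≤n
  adjacent-or-sparse (x ∷ y ∷ xs) with P? x | adjacent-or-sparse xs | adjacent-or-sparse (y ∷ xs)
  ... | no _ | _ | inj₁ (as , i , j , bs , eq , pi , pj) = inj₁ (x ∷ as , i , j , bs , cong (x ∷_) eq , pi , pj)
  ... | no _ | _ | inj₂ le = inj₂ (≤-trans le (n≤1+n _))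
  ... | yes px | inj₁ (as , i , j , bs , refl , pi , pj) | _ = inj₁ (x ∷ y ∷ as , i , j , bs , refl , pi , pj)
  ... | yes px | inj₂ le | _ with P? y
  ...   | yes py = inj₁ ([] , x , y , xs , refl , px , py)
  ...   | no _ = inj₂ (≤-trans (≤-reflexive (cong suc (+-suc _ _))) (s≤s (s≤s le)))

-- A block is a path from x to its last neighbour z on the path; ns lists neighbours of x.
module Block {A : Set} (_≟_ : (x y : A) → Dec (x ≡ y)) (Γ : A → A → Set) (Γ-sym : ∀ {a b} → Γ a b → Γ b a)
  {x z : A} {bs : List A} (w : Walk Γ x bs z) (u : Unique (x ∷ bs))
  (ns : List A) (ns-uniq : Unique ns) (ns-adj : ∀ {v} → v ∈ ns → Γ x v) (ns-bs : ∀ {v} → v ∈ ns → v ∈ bs)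
  (z∈ns : z ∈ ns) where

  open import Data.List.Membership.DecPropositional _≟_ using (_∈?_)

  record Traversal (a : A) : Set where
    constructor traversal
    field
      ys       : List A
      walk     : Walk Γ a ys z
      distinct : Unique (a ∷ ys)
      inside   : a ∷ ys ⊆ x ∷ bs
      covers   : suc (length ns) ≤ length (a ∷ ys)

  -- Meant for a path that is entered at `h` through the hyperedge owned by the pair of `h` and `o`:
  -- since `h` is not visited again, this hyperedge can recur only if the very first step leads to
  -- `o`.
  HeadAvoids : A → List A → Set
  HeadAvoids o ys = ∀ {h t} → ys ≡ h ∷ t → h ≢ o

  private
    x∷ns : Unique (x ∷ ns)
    x∷ns = uniq-∷ (uniq-head u ∘ ns-bs) ns-uniq

    head-walk : ∀ {a y pr rest o} → Walk Γ a pr y → y ≢ a → o ∉ pr → HeadAvoids o (pr ++ rest)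
    head-walk [] y≢a _ = ⊥-elim (y≢a refl)
    head-walk (_ ∷ _) _ o∉ refl refl = o∉ (here refl)

    head-snoc : ∀ {o i rest} xs → o ∉ xs ++ [ i ] → HeadAvoids o ((xs ++ [ i ]) ++ rest)
    head-snoc [] o∉ refl refl = o∉ (here refl)
    head-snoc (_ ∷ _) o∉ refl refl = o∉ (here refl)

  whole : Traversal x
  whole = traversal bs w u (λ p → p)
    (uniq-⊆-length x∷ns (λ { (here eq) → here eq ; (there p) → there (ns-bs p) }))

  -- From `a` go back along the path to `x`, jump to the first neighbour `s` of `x` beyond `a`, and
  -- go on to `z`. The skipped part between `a` and `s` contains no neighbour. The first step goes
  -- backwards, so it misses everything beyond `a`.
  from-split : ∀ as {a} cs → x ∷ bs ≡ x ∷ as ++ a ∷ cs → z ∈ cs →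
    Σ (Traversal a) λ t → ∀ {o} → o ∈ cs → HeadAvoids o (Traversal.ys t)
  from-split as {a} cs refl z∈cs with cut as w
  ... | w₁ , w₂ with rev Γ-sym w₁ | first-split (_∈? ns) cs z∈cs z∈ns
  ... | pr , wr , perm | c₁ , s , c₂ , refl , s∈ns , none =
    traversal (pr ++ s ∷ c₂) (wr ⊕ (ns-adj s∈ns ∷ proj₂ (cut c₁ w₂)))
      (uniq-++ upr (proj₁ (proj₂ (uniq-++⁻ c₁ (uniq-tail (proj₁ (proj₂ (uniq-++⁻ (x ∷ as) u))))))) pr-sc)
      inside
      (uniq-⊆-length x∷ns covered) ,
    avoid
    where
    parts = uniq-++⁻ (x ∷ as) u
    ua = uniq-++⁻ c₁ (uniq-tail (proj₁ (proj₂ parts)))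
    pre⊆ : ∀ {v} → v ∈ a ∷ pr → v ∈ x ∷ as ⊎ v ≡ a
    pre⊆ p with ∈-++⁻ (x ∷ as) (∈-resp-↭ (↭-sym perm) p)
    ... | inj₁ q = inj₁ q
    ... | inj₂ (here eq) = inj₂ eq
    upr : Unique (a ∷ pr)
    upr = uniq-↭ perm (uniq-++ (proj₁ parts) ([] ∷ []) λ { p (here refl) → proj₂ (proj₂ parts) p (here refl) })
    pr-sc : Disjoint (a ∷ pr) (s ∷ c₂)
    pr-sc p q with pre⊆ p
    ... | inj₁ h = proj₂ (proj₂ parts) h (there (∈-++⁺ʳ c₁ q))
    ... | inj₂ refl = uniq-head (proj₁ (proj₂ parts)) (∈-++⁺ʳ c₁ q)
    inside : a ∷ pr ++ s ∷ c₂ ⊆ x ∷ as ++ a ∷ c₁ ++ s ∷ c₂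
    inside p with ∈-++⁻ (a ∷ pr) p
    ... | inj₂ q = ∈-++⁺ʳ (x ∷ as) (there (∈-++⁺ʳ c₁ q))
    ... | inj₁ q with pre⊆ q
    ... | inj₁ h = ∈-++⁺ˡ h
    ... | inj₂ refl = ∈-++⁺ʳ (x ∷ as) (here refl)
    prefix : x ∷ as ++ [ a ] ⊆ a ∷ pr ++ s ∷ c₂
    prefix p = ∈-++⁺ˡ (∈-resp-↭ perm p)
    covered : x ∷ ns ⊆ a ∷ pr ++ s ∷ c₂
    covered (here refl) = prefix (here refl)
    covered (there p) with ∈-++⁻ as (ns-bs p)
    ... | inj₁ q = prefix (there (∈-++⁺ˡ q))
    ... | inj₂ (here refl) = prefix (there (∈-++⁺ʳ as (here refl)))
    ... | inj₂ (there q) with ∈-++⁻ c₁ q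
    ... | inj₁ h = ⊥-elim (none h p)
    ... | inj₂ h = ∈-++⁺ʳ (a ∷ pr) h
    a≢x : a ≢ x
    a≢x refl = proj₂ (proj₂ parts) (here refl) (here refl)
    avoid : ∀ {o} → o ∈ c₁ ++ s ∷ c₂ → HeadAvoids o (pr ++ s ∷ c₂)
    avoid o∈ = head-walk wr (a≢x ∘ sym) λ p → case pre⊆ (there p) of λ
      { (inj₁ h) → proj₂ (proj₂ parts) h (there o∈) ; (inj₂ refl) → uniq-head upr p }

  from-vertex : ∀ {a} → a ∈ x ∷ bs → a ≢ z → Traversal a
  from-vertex (here refl) a≢z = whole
  from-vertex {a} (there a∈) a≢z with ∈-∃++ a∈
  ... | as , cs , refl = proj₁ (from-split as cs refl (end∈-tail (proj₂ (cut as w)) (a≢z ∘ sym)))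

  -- A hyperedge owned by the pair of `a` and `b` can be left through either of them; `ends` records
  -- the choice.
  record PairTraversal (a b : A) : Set where
    constructor pair-traversal
    field
      h o   : A
      ends  : (h ≡ a × o ≡ b) ⊎ (h ≡ b × o ≡ a)
      trav  : Traversal h
      avoid : HeadAvoids o (Traversal.ys trav)

  module _ (3≤ns : 3 ≤ length ns) where

    -- Starting at the second vertex, x is inserted between two consecutive neighbours if there are any;
    -- otherwise the neighbours are so spread out that x can be skipped.
    from-second : ∀ {y rest} → bs ≡ y ∷ rest → PairTraversal x y
    from-second {y} {rest} refl = go w u (adjacent-or-sparse (_∈? ns) rest)
      where
      go : Walk Γ x (y ∷ rest) z → Unique (x ∷ y ∷ rest) → _ → PairTraversal x y
      go (r ∷ w') (ux ∷ u') (inj₁ (r₁ , i , j , r₂ , refl , i∈ , j∈)) =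
        pair-traversal y x (inj₂ (refl , refl))
          (traversal ((r₁ ++ [ i ]) ++ x ∷ j ∷ r₂)
            (proj₁ c ⊕ (Γ-sym (ns-adj i∈) ∷ ns-adj j∈ ∷ proj₂ (cut [] (proj₂ c))))
            (uniq-↭ perm u)
            (λ p → ∈-resp-↭ (↭-sym perm) p)
            (≤-trans (Traversal.covers whole) (≤-reflexive (↭-length perm))))
          (head-snoc r₁ (λ p → uniq-head u (there (subset p))))
        where
        c = cut r₁ w'
        perm : x ∷ y ∷ r₁ ++ i ∷ j ∷ r₂ ↭ y ∷ (r₁ ++ [ i ]) ++ x ∷ j ∷ r₂
        perm = Perm.trans
          (Perm.↭-reflexive (cong (λ l → x ∷ y ∷ l) (sym (List.++-assoc r₁ [ i ] (j ∷ r₂)))))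
          (↭-sym (shift x (y ∷ r₁ ++ [ i ]) (j ∷ r₂)))
        subset : r₁ ++ [ i ] ⊆ r₁ ++ i ∷ j ∷ r₂
        subset p with ∈-++⁻ r₁ p
        ... | inj₁ q = ∈-++⁺ˡ q
        ... | inj₂ (here refl) = ∈-++⁺ʳ r₁ (here refl)
      go (r ∷ w') (ux ∷ u') (inj₂ sparse) =
        pair-traversal y x (inj₂ (refl , refl)) (traversal rest w' u' there (s≤s ns≤rest))
          (λ { refl refl → uniq-head u (there (here refl)) })
        where
        fs = filter (_∈? ns) rest
        ns≤ : length ns ≤ suc (length fs)
        ns≤ = uniq-⊆-length {ys = y ∷ fs} ns-uniq (λ p → case ns-bs p of λ
          { (here eq) → here eq ; (there q) → there (∈-filter⁺ (_∈? ns) q p) })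
        -- As p ≥ 3 forces f ≥ 2, one has p ≤ f + 1 ≤ 2f - 1 ≤ l.
        arith : ∀ p f l → 3 ≤ p → p ≤ suc f → 2 * f ≤ suc l → p ≤ l
        arith (suc (suc (suc p))) (suc (suc f)) l _ (s≤s (s≤s (s≤s p≤f))) (s≤s le) =
          ≤-trans (s≤s (≤-trans (s≤s (s≤s (≤-trans p≤f (≤-reflexive (sym (+-identityʳ f)))))) (m≤n+m _ f))) le
        arith (suc (suc (suc p))) (suc zero) l _ (s≤s (s≤s ())) le
        arith (suc (suc zero)) _ l (s≤s (s≤s ())) _ _
        arith (suc zero) _ l (s≤s ()) _ _
        ns≤rest : length ns ≤ length rest
        ns≤rest = arith (length ns) (length fs) (length rest) 3≤ns ns≤ sparse

    from-first : ∀ {b} cs → bs ≡ cs → b ∈ cs → PairTraversal x b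
    from-first {b} (y ∷ rest) eq b∈ with y ≟ b
    ... | yes refl = from-second eq
    ... | no y≢b = pair-traversal x b (inj₁ (refl , refl)) whole
                     (λ eq' → subst (_≢ b) (List.∷-injectiveˡ (trans (sym eq) eq')) y≢b)

    from-ordered : ∀ as {a b} cs → x ∷ bs ≡ as ++ a ∷ cs → b ∈ cs → PairTraversal a b
    from-ordered [] cs refl b∈ = from-first cs refl b∈
    from-ordered (_ ∷ as) {a} {b} (c ∷ cs) refl b∈ with cut as w
    ... | _ , (_ ∷ w₂) with from-split as (c ∷ cs) refl (end∈ w₂)
    ... | t , avoid = pair-traversal a b (inj₁ (refl , refl)) t (avoid b∈)

    from-pair : ∀ {a b} → a ∈ x ∷ bs → b ∈ x ∷ bs → a ≢ b → PairTraversal a b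
    from-pair {a} {b} a∈ b∈ a≢b with ∈-∃++ a∈
    ... | as , cs , eq with ∈-++⁻ as (subst (b ∈_) eq b∈)
    ... | inj₂ (here refl) = ⊥-elim (a≢b refl)
    ... | inj₂ (there b∈cs) = from-ordered as cs eq b∈cs
    ... | inj₁ b∈as with ∈-∃++ b∈as
    ... | as₁ , as₂ , refl
      with from-ordered as₁ (as₂ ++ a ∷ cs) (trans eq (List.++-assoc as₁ (b ∷ as₂) (a ∷ cs))) (∈-++⁺ʳ as₂ (here refl))
    ... | pair-traversal h o (inj₁ e) t av = pair-traversal h o (inj₂ e) t av
    ... | pair-traversal h o (inj₂ e) t av = pair-traversal h o (inj₁ e) t av

-- Long cycles in graphs

private
  indicator : {P : Set} → Dec P → ℕ
  indicator (yes _) = 1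
  indicator (no _) = 0

  indicator≤1 : {P : Set} (d : Dec P) → indicator d ≤ 1
  indicator≤1 (yes _) = ≤-refl
  indicator≤1 (no _) = z≤n

module Crossing {A : Set} {P Q : A → Set} (P? : ∀ v → Dec (P v)) (Q? : ∀ v → Dec (Q v)) where

  -- With `P` the neighbours of the first vertex and `Q` those of the last one, such a step would
  -- close the path to a cycle through all of its vertices.
  NoStep : List A → Set
  NoStep xs = ∀ as a b bs → xs ≡ as ++ a ∷ b ∷ bs → Q a → P b → ⊥

  step-or-none : ∀ xs → (∃₂ λ as a → ∃₂ λ b bs → xs ≡ as ++ a ∷ b ∷ bs × Q a × P b) ⊎ NoStep xs
  step-or-none [] = inj₂ λ { [] _ _ _ () ; (_ ∷ _) _ _ _ () }
  step-or-none (x ∷ []) = inj₂ λ { [] _ _ _ () ; (_ ∷ []) _ _ _ () ; (_ ∷ _ ∷ _) _ _ _ () }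
  step-or-none (x ∷ y ∷ xs) with step-or-none (y ∷ xs) | Q? x | P? y
  ... | inj₁ (as , a , b , bs , eq , q , p) | _ | _ = inj₁ (x ∷ as , a , b , bs , cong (x ∷_) eq , q , p)
  ... | inj₂ none | yes q | yes p = inj₁ ([] , x , y , xs , refl , q , p)
  ... | inj₂ none | no ¬q | _ = inj₂ λ
    { [] _ _ _ refl q _ → ¬q q ; (_ ∷ as) a b bs eq → none as a b bs (List.∷-injectiveʳ eq) }
  ... | inj₂ none | yes _ | no ¬p = inj₂ λ
    { [] _ _ _ refl _ p → ¬p p ; (_ ∷ as) a b bs eq → none as a b bs (List.∷-injectiveʳ eq) }

  last-Q : A → List A → ℕ
  last-Q x [] = indicator (Q? x)
  last-Q x (y ∷ xs) = last-Q y xs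

  weight : A → ℕ
  weight v = indicator (P? v) + indicator (Q? v)

  -- P and the shift of Q by one position are disjoint subsets of the positions after the first.
  no-step-bound : ∀ x xs → NoStep (x ∷ xs) →
    suc (total weight (x ∷ xs)) ≤ length (x ∷ xs) + (indicator (P? x) + last-Q x xs)
  no-step-bound x [] none = ≤-reflexive (cong suc (+-identityʳ _))
  no-step-bound x (y ∷ xs) none = begin
    suc (ix + jx + t) ≡⟨ +-suc (ix + jx) t ⟨
    ix + jx + suc t ≤⟨ +-monoʳ-≤ (ix + jx) (no-step-bound y xs (λ as a b bs eq → none (x ∷ as) a b bs (cong (x ∷_) eq))) ⟩
    ix + jx + (l + (iy + q)) ≡⟨ solve 5 (λ a b c d e → a :+ b :+ (c :+ (d :+ e)) := (b :+ d) :+ (c :+ (a :+ e))) refl ix jx l iy q ⟩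
    (jx + iy) + (l + (ix + q)) ≤⟨ +-monoˡ-≤ (l + (ix + q)) (small (Q? x) (P? y) (none [] x y xs refl)) ⟩
    suc l + (ix + q) ∎
    where
    open ≤-Reasoning
    open import Data.Nat.Solver using (module +-*-Solver)
    open +-*-Solver
    ix = indicator (P? x)
    jx = indicator (Q? x)
    iy = indicator (P? y)
    t = total weight (y ∷ xs)
    l = length (y ∷ xs)
    q = last-Q y xs
    small : (d : Dec (Q x)) (d' : Dec (P y)) → (Q x → P y → ⊥) → indicator d + indicator d' ≤ 1
    small (yes a) (yes b) f = ⊥-elim (f a b)
    small (yes a) (no b) f = ≤-refl
    small (no a) d f = indicator≤1 d

  last-Q≤1 : ∀ x xs → last-Q x xs ≤ 1
  last-Q≤1 x [] = indicator≤1 (Q? x)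
  last-Q≤1 x (y ∷ xs) = last-Q≤1 y xs

  last-Q-end : ∀ {R x xs y} → Walk R x xs y → ¬ Q y → last-Q x xs ≡ 0
  last-Q-end {x = x} [] ¬q with Q? x
  ... | yes q = ⊥-elim (¬q q)
  ... | no _ = refl
  last-Q-end (_ ∷ w) ¬q = last-Q-end w ¬q

  bound-start : ∀ x xs → NoStep (x ∷ xs) → ¬ P x → total weight (x ∷ xs) ≤ length (x ∷ xs)
  bound-start x xs none ¬p with P? x | no-step-bound x xs none
  ... | yes p | _ = ⊥-elim (¬p p)
  ... | no _ | le = s≤s⁻¹ (≤-trans le (≤-trans (+-monoʳ-≤ (length (x ∷ xs)) (last-Q≤1 x xs)) (≤-reflexive (+-comm _ 1))))

  bound-end : ∀ {R} x xs {y} → Walk R x xs y → NoStep (x ∷ xs) → ¬ Q y → total weight (x ∷ xs) ≤ length (x ∷ xs)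
  bound-end x xs w none ¬q with no-step-bound x xs none
  ... | le rewrite last-Q-end w ¬q = s≤s⁻¹ (≤-trans le (≤-trans
    (+-monoʳ-≤ (length (x ∷ xs)) (≤-trans (≤-reflexive (+-identityʳ _)) (indicator≤1 (P? x)))) (≤-reflexive (+-comm _ 1))))

members-total : {A : Set} {P : A → Set} (P? : ∀ v → Dec (P v)) {ns xs : List A} → Unique ns →
  (∀ {v} → v ∈ ns → P v × v ∈ xs) → length ns ≤ total (λ v → indicator (P? v)) xs
members-total P? {ns} {xs} u sub =
  ≤-trans (uniq-⊆-length u (λ p → ∈-filter⁺ P? (proj₂ (sub p)) (proj₁ (sub p)))) (≤-reflexive (count xs))
  where
  count : ∀ xs → length (filter P? xs) ≡ total (λ v → indicator (P? v)) xs
  count [] = refl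
  count (x ∷ xs) with P? x
  ... | yes _ = cong suc (count xs)
  ... | no _ = count xs

total-+ : {A : Set} (f g : A → ℕ) (xs : List A) → total (λ v → f v + g v) xs ≡ total f xs + total g xs
total-+ f g [] = refl
total-+ f g (x ∷ xs) rewrite total-+ f g xs =
  solve 4 (λ a b c d → a :+ b :+ (c :+ d) := a :+ c :+ (b :+ d)) refl (f x) (g x) (total f xs) (total g xs)
  where
  open import Data.Nat.Solver using (module +-*-Solver)
  open +-*-Solver

LongCycle : {A : Set} → (A → A → Set) → ℕ → Set
LongCycle F k = ∃₂ λ x xs → Walk F x xs x × Unique xs × k ≤ length xs

module PathToCycle {A : Set} (_≟_ : (x y : A) → Dec (x ≡ y)) (F : A → A → Set)
  (F-sym : ∀ {a b} → F a b → F b a) (F-irr : ∀ {a} → ¬ F a a) (In : A → Set)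
  (conn : ∀ {x y} z → In x → In y → x ≢ z → y ≢ z → ∃ λ xs → Walk F x xs y × z ∉ x ∷ xs) where

  open import Data.List.Membership.DecPropositional _≟_ using (_∈?_)

  private
    -- Follow the path from `x` to `a`, jump to `y`, return along the path to `b`, and jump to `x`:
    -- only `mid` is lost.
    crossing-cycle : ∀ {x xs y as a mid b bs} → Walk F x xs y → Unique (x ∷ xs) →
      x ∷ xs ≡ as ++ a ∷ mid ++ b ∷ bs → F y a → F x b → LongCycle F (length (as ++ [ a ]) + length (b ∷ bs))
    crossing-cycle {x} {as = as} {a} {mid} {b} {bs} w u eq ya xb with split-at as w eq
    ... | ps , w₁ , eq₁ , w₂ with rev F-sym (proj₂ (cut mid w₂))
    ... | r , wr , perm =
      x , (ps ++ _ ∷ r) ++ [ x ] , (w₁ ⊕ (F-sym ya ∷ wr)) ⊕ (F-sym xb ∷ []) ,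
      uniq-↭ cyc (uniq-++ (proj₁ parts) (proj₁ (proj₂ (uniq-++⁻ mid (proj₁ (proj₂ parts)))))
        (λ p q → proj₂ (proj₂ parts) p (∈-++⁺ʳ mid q))) ,
      ≤-reflexive (trans (sym (List.length-++ (as ++ [ a ]))) (↭-length cyc))
      where
      parts = uniq-++⁻ (as ++ [ a ])
        (subst Unique (trans eq (sym (List.++-assoc as [ a ] (mid ++ b ∷ bs)))) u)
      open Perm.PermutationReasoning
      cyc : (as ++ [ a ]) ++ b ∷ bs ↭ (ps ++ _ ∷ r) ++ [ x ]
      cyc = begin
        (as ++ [ a ]) ++ b ∷ bs ≡⟨ cong (_++ b ∷ bs) eq₁ ⟨
        x ∷ ps ++ b ∷ bs ↭⟨ ++⁺ˡ (x ∷ ps) perm ⟩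
        x ∷ ps ++ _ ∷ r ↭⟨ ∷↭∷ʳ x (ps ++ _ ∷ r) ⟩
        (ps ++ _ ∷ r) ++ [ x ] ∎

    reaches : ∀ {x z bs} (w : Walk F x bs z) (u : Unique (x ∷ bs)) ns → Unique ns → (∀ {v} → v ∈ ns → F x v) →
      ns ⊆ bs → z ∈ ns → ∀ {a} → a ∈ x ∷ bs → a ≢ z →
      ∃ λ us → Walk F z us a × Unique (z ∷ us) × us ⊆ x ∷ bs ×
        suc (length ns) ≤ total (λ _ → 1) (z ∷ us)
    reaches {z = z} w u ns un adj sub z∈ a∈ a≢z with Block.from-vertex _≟_ F F-sym w u ns un adj sub z∈ a∈ a≢z
    ... | Block.traversal ys wy uy ins cov with rev F-sym wy
    ... | us , wr , perm = us , wr , uniq-↭ perm uy , (λ p → ins (∈-resp-↭ (↭-sym perm) (there p))) ,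
      ≤-trans cov (≤-reflexive (trans (↭-length perm) (sym (total-ones (z ∷ us)))))

  module _ {x xs y ns ms k} (w : Walk F x xs y) (u : Unique (x ∷ xs)) (In-xs : ∀ {v} → v ∈ x ∷ xs → In v)
    (un : Unique ns) (um : Unique ms)
    (ns-ok : ∀ {v} → v ∈ ns → F x v × v ∈ x ∷ xs) (ms-ok : ∀ {v} → v ∈ ms → F y v × v ∈ x ∷ xs)
    (k≤xs : k ≤ length (x ∷ xs)) (k≤ : k ≤ length ns + length ms) where

    open Crossing (_∈? ns) (_∈? ms)

    private
      x∉ns : x ∉ ns
      x∉ns p = F-irr (proj₁ (ns-ok p))

      y∉ms : y ∉ ms
      y∉ms p = F-irr (proj₁ (ms-ok p))

      -- All neighbours of both ends lie outside `mid`. The segment up to `a` starts at `x`, which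
      -- is not in `ns`, and the segment from `b` ends at `y`, which is not in `ms`. So neither
      -- segment has more neighbours, counted for both ends, than vertices, and the cycle through
      -- the two segments is long enough.
      crossing : NoStep (x ∷ xs) → ∀ as {a} mid {b} bs → x ∷ xs ≡ as ++ a ∷ mid ++ b ∷ bs → a ∈ ms → b ∈ ns →
        (∀ {v} → v ∈ mid → v ∉ ns) → (∀ {v} → v ∈ mid → v ∉ ms) → LongCycle F k
      crossing none as {a} mid {b} bs eq a∈ b∈ mid-ns mid-ms
        with crossing-cycle {as = as} {mid = mid} w u eq (proj₁ (ms-ok a∈)) (proj₁ (ns-ok b∈))
      ... | c , zs , wc , uc , le = c , zs , wc , uc , ≤-trans k≤ (≤-trans count le)
        where
        eq' : x ∷ xs ≡ (as ++ [ a ]) ++ (mid ++ b ∷ bs)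
        eq' = trans eq (sym (List.++-assoc as [ a ] _))
        zero-mid : ∀ l → (∀ {v} → v ∈ l → v ∉ ns) → (∀ {v} → v ∈ l → v ∉ ms) → total weight l ≡ 0
        zero-mid [] f g = refl
        zero-mid (v ∷ l) f g with v ∈? ns | v ∈? ms
        ... | yes p | _ = ⊥-elim (f (here refl) p)
        ... | no _ | yes p = ⊥-elim (g (here refl) p)
        ... | no _ | no _ = zero-mid l (f ∘ there) (g ∘ there)
        initial : ∀ l → x ∷ xs ≡ l ++ (mid ++ b ∷ bs) → total weight l ≤ length l
        initial [] e = z≤n
        initial (h ∷ l) e with List.∷-injectiveˡ e
        ... | refl = bound-start x l (λ as' a' b' bs' e' → none as' a' b' (bs' ++ mid ++ b ∷ bs)
          (trans e (trans (cong (_++ (mid ++ b ∷ bs)) e') (List.++-assoc as' (a' ∷ b' ∷ bs') (mid ++ b ∷ bs))))) x∉ns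
        final : total weight (b ∷ bs) ≤ length (b ∷ bs)
        final = bound-end b bs (proj₂ (cut mid (proj₂ (proj₂ (proj₂ (split-at as w eq))))))
          (λ as' a' b' bs' e' → none (as ++ a ∷ mid ++ as') a' b' bs'
            (trans eq (trans (cong (λ l → as ++ a ∷ mid ++ l) e')
              (sym (trans (List.++-assoc as (a ∷ mid ++ as') _) (cong (λ l → as ++ a ∷ l) (List.++-assoc mid as' (a' ∷ b' ∷ bs'))))))))
          y∉ms
        open ≤-Reasoning
        count : length ns + length ms ≤ length (as ++ [ a ]) + length (b ∷ bs)
        count = begin
          length ns + length ms
            ≤⟨ +-mono-≤ (members-total (_∈? ns) un (λ p → p , proj₂ (ns-ok p)))
                        (members-total (_∈? ms) um (λ p → p , proj₂ (ms-ok p))) ⟩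
          total (λ v → indicator (v ∈? ns)) (x ∷ xs) + total (λ v → indicator (v ∈? ms)) (x ∷ xs)
            ≡⟨ total-+ (λ v → indicator (v ∈? ns)) (λ v → indicator (v ∈? ms)) (x ∷ xs) ⟨
          total weight (x ∷ xs) ≡⟨ cong (total weight) eq' ⟩
          total weight ((as ++ [ a ]) ++ mid ++ b ∷ bs) ≡⟨ total-++ weight (as ++ [ a ]) _ ⟩
          total weight (as ++ [ a ]) + total weight (mid ++ b ∷ bs)
            ≡⟨ cong (total weight (as ++ [ a ]) +_)
                 (trans (total-++ weight mid _) (cong (_+ total weight (b ∷ bs)) (zero-mid mid mid-ns mid-ms))) ⟩
          total weight (as ++ [ a ]) + total weight (b ∷ bs) ≤⟨ +-mono-≤ (initial (as ++ [ a ]) eq') final ⟩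
          length (as ++ [ a ]) + length (b ∷ bs) ∎

      -- Choosing the last element of `ms` before `z`, and then the first element of `ns` after it,
      -- makes the part between them free of both lists.
      cross-search : NoStep (x ∷ xs) → ∀ c {z} rest → x ∷ xs ≡ c ++ z ∷ rest → z ∈ ns →
        ∀ {m} → m ∈ c → m ∈ ms → LongCycle F k
      cross-search none c {z} rest eq z∈ m∈c m∈ with last-split (_∈? ms) c m∈c m∈
      ... | d , a , mid , refl , a∈ , mid-ms with first-split (_∈? ns) (mid ++ [ z ]) (∈-++⁺ʳ mid (here refl)) z∈
      ... | m₁ , b , m₂ , eq₁ , b∈ , m₁-ns = crossing none d m₁ (m₂ ++ rest) eq' a∈ b∈ m₁-ns m₁-ms
        where
        eq' : x ∷ xs ≡ d ++ a ∷ m₁ ++ b ∷ m₂ ++ rest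
        eq' = trans eq (trans (List.++-assoc d (a ∷ mid) (z ∷ rest)) (cong (λ l → d ++ a ∷ l)
          (trans (sym (List.++-assoc mid [ z ] rest)) (trans (cong (_++ rest) eq₁) (List.++-assoc m₁ (b ∷ m₂) rest)))))
        m₁-ms : ∀ {v} → v ∈ m₁ → v ∉ ms
        m₁-ms {v} p with ∈-++⁻ mid (subst (v ∈_) (sym eq₁) (∈-++⁺ˡ p))
        ... | inj₁ h = mid-ms h
        ... | inj₂ (here refl) = ⊥-elim (m₁-ns p z∈)

      module NonCrossing (c : List A) {z q : A} (bs : List A) {ts} (X⊆ : ∃ λ es → x ∷ xs ≡ (c ++ [ z ]) ++ es)
        (Y⊆ : ∃ λ es → x ∷ xs ≡ es ++ q ∷ bs) (wt : Walk F z ts q)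
        (z∈ : z ∈ ns) (q∈ : q ∈ ms) (ns⊆ : ns ⊆ c ++ [ z ]) (ms⊆ : ms ⊆ q ∷ bs) where

        left : ∃ λ ps → Walk F x ps z × x ∷ ps ≡ c ++ [ z ]
        left with split-at c {bs = proj₁ X⊆} w (trans (proj₂ X⊆) (List.++-assoc c [ z ] _))
        ... | ps , wp , eqp , _ = ps , wp , eqp
        ps = proj₁ left
        X : A → Set
        X v = v ∈ x ∷ ps
        right : ∃ λ r → Walk F y r q × q ∷ bs ↭ y ∷ r
        right with split-at (proj₁ Y⊆) w (proj₂ Y⊆)
        ... | _ , _ , _ , wq = rev F-sym wq
        r = proj₁ right
        Y : A → Set
        Y v = v ∈ y ∷ r
        X-c : ∀ {v} → X v → v ∈ c ++ [ z ]
        X-c {v} = subst (v ∈_) (proj₂ (proj₂ left))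
        Y-bs : ∀ {v} → Y v → v ∈ q ∷ bs
        Y-bs = ∈-resp-↭ (↭-sym (proj₂ (proj₂ right)))
        X-In : ∀ {v} → X v → In v
        X-In {v} p = In-xs (subst (v ∈_) (sym (proj₂ X⊆)) (∈-++⁺ˡ (X-c p)))
        Y-In : ∀ {v} → Y v → In v
        Y-In {v} p = In-xs (subst (v ∈_) (sym (proj₂ Y⊆)) (∈-++⁺ʳ (proj₁ Y⊆) (Y-bs p)))
        x≢z : x ≢ z
        x≢z refl = x∉ns z∈
        y≢q : y ≢ q
        y≢q refl = y∉ms q∈
        Xz : X z
        Xz = end∈ (proj₁ (proj₂ left))
        Yq : Y q
        Yq = end∈ (proj₁ (proj₂ right))
        reach-X : ReachesAll F (λ _ → 1) X z (suc (length ns))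
        reach-X = reaches (proj₁ (proj₂ left)) (subst Unique (sym (proj₂ (proj₂ left)))
                    (proj₁ (uniq-++⁻ (c ++ [ z ]) (subst Unique (proj₂ X⊆) u)))) ns un
          (proj₁ ∘ ns-ok)
          (λ {v} p → case subst (v ∈_) (sym (proj₂ (proj₂ left))) (ns⊆ p) of λ
            { (here refl) → ⊥-elim (x∉ns p) ; (there h) → h }) z∈
        reach-Y : ReachesAll F (λ _ → 1) Y q (suc (length ms))
        reach-Y = reaches (proj₁ (proj₂ right)) (uniq-↭ (proj₂ (proj₂ right))
                    (proj₁ (proj₂ (uniq-++⁻ (proj₁ Y⊆) (subst Unique (proj₂ Y⊆) u))))) ms um
          (proj₁ ∘ ms-ok)
          (λ p → case ∈-resp-↭ (proj₂ (proj₂ right)) (ms⊆ p) of λ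
            { (here refl) → ⊥-elim (y∉ms p) ; (there h) → h }) q∈

      -- Here the neighbours of `x` lie up to `z` and those of `y` from `z` on. The two end pieces,
      -- cut at the last neighbour of `x` and the first neighbour `q` of `y`, are blocks with one
      -- vertex more than `ns` and `ms` respectively to be covered. Linking them loses at most one
      -- vertex, when `q` is `z`.
      non-crossing : ∀ c {z} rest → x ∷ xs ≡ c ++ z ∷ rest → z ∈ ns → (∀ {v} → v ∈ rest → v ∉ ns) →
        (∀ {v} → v ∈ c → v ∉ ms) → ∀ {m} → m ∈ ms → LongCycle F k
      non-crossing c {z} rest eq z∈ rest-ns c-ms {m} m∈ = go (first-split (_∈? ms) (z ∷ rest) (ms⊆₀ m∈) m∈)
        where
        ms⊆₀ : ms ⊆ z ∷ rest
        ms⊆₀ {v} p with ∈-++⁻ c (subst (v ∈_) eq (proj₂ (ms-ok p)))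
        ... | inj₁ h = ⊥-elim (c-ms h p)
        ... | inj₂ h = h
        ns⊆ : ns ⊆ c ++ [ z ]
        ns⊆ {v} p with ∈-++⁻ c (subst (v ∈_) eq (proj₂ (ns-ok p)))
        ... | inj₁ h = ∈-++⁺ˡ h
        ... | inj₂ (here refl) = ∈-++⁺ʳ c (here refl)
        ... | inj₂ (there h) = ⊥-elim (rest-ns h p)
        X⊆ : ∃ λ es → x ∷ xs ≡ (c ++ [ z ]) ++ es
        X⊆ = rest , trans eq (sym (List.++-assoc c [ z ] rest))
        uX = uniq-++⁻ (c ++ [ z ]) (subst Unique (proj₂ X⊆) u)
        finish : ∀ {l} → suc (length ns) + suc (length ms) ≤ suc l → k ≤ l
        finish le = ≤-trans k≤ (≤-trans (n≤1+n _) (≤-trans (≤-reflexive (sym (+-suc _ _))) (s≤s⁻¹ le)))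
        go : _ → LongCycle F k
        go ([] , q , bs , refl , q∈ , none) =
          let c' , zs , wc , uc , le = Linking.cycle-sharing _≟_ F (λ _ _ → F-sym) In conn X Y
                (_∈? x ∷ ps) (_∈? y ∷ r) X-In Y-In (λ _ → 1)
                (λ p p' → shared (X-c p) (Y-bs p')) Xz Yq (here refl) x≢z (here refl) y≢q reach-X reach-Y
          in c' , zs , wc , uc , ≤-trans (finish le) (≤-reflexive (total-ones zs))
          where
          open NonCrossing c bs X⊆ (c , eq) [] z∈ q∈ ns⊆ ms⊆₀
          shared : ∀ {v} → v ∈ c ++ [ z ] → v ∈ z ∷ rest → v ≡ z
          shared p (here e) = e
          shared p (there h) = ⊥-elim (proj₂ (proj₂ uX) p h)
        go (_ ∷ d , q , bs , refl , q∈ , none) =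
          let c' , zs , wc , uc , le = Linking.cycle-apart _≟_ F (λ _ _ → F-sym) In conn X Y
                (_∈? x ∷ ps) (_∈? y ∷ r) X-In Y-In (λ _ → 1)
                (λ p p' → proj₂ (proj₂ uX) (X-c p) (∈-++⁺ʳ d (Y-bs p'))) Xz Yq (here refl) x≢z (here refl) y≢q
                wt ut
                (λ p p' → proj₂ (proj₂ uX) (X-c p') (d⊆ p))
                (λ p p' → case ∈-++⁻ d p of λ
                  { (inj₁ h) → ⊥-elim (proj₂ (proj₂ (uniq-++⁻ d (proj₁ (proj₂ uX)))) h (Y-bs p'))
                  ; (inj₂ (here e)) → e })
                (λ {v} p → In-xs (subst (v ∈_) (sym (proj₂ X⊆)) (∈-++⁺ʳ (c ++ [ z ]) (d⊆ p))))
                reach-X reach-Y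
          in c' , zs , wc , uc , ≤-trans (finish (≤-trans le (n≤1+n _))) (≤-reflexive (total-ones zs))
          where
          wt : Walk F z (d ++ [ q ]) q
          wt = proj₁ (cut d (proj₂ (proj₂ (proj₂ (split-at c w eq)))))
          d⊆ : d ++ [ q ] ⊆ d ++ q ∷ bs
          d⊆ p with ∈-++⁻ d p
          ... | inj₁ h = ∈-++⁺ˡ h
          ... | inj₂ (here refl) = ∈-++⁺ʳ d (here refl)
          ut : Unique (z ∷ d ++ [ q ])
          ut = proj₁ (uniq-++⁻ (z ∷ d ++ [ q ]) (subst Unique (cong (z ∷_) (sym (List.++-assoc d [ q ] bs)))
            (proj₁ (proj₂ (uniq-++⁻ c (subst Unique eq u))))))
          ms⊆ : ms ⊆ q ∷ bs
          ms⊆ p with ms⊆₀ p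
          ... | here refl = ⊥-elim (none (here refl) p)
          ... | there h with ∈-++⁻ d h
          ... | inj₁ h' = ⊥-elim (none (there h') p)
          ... | inj₂ h' = h'
          open NonCrossing c bs X⊆ (c ++ z ∷ d , trans eq (sym (List.++-assoc c (z ∷ d) (q ∷ bs)))) wt z∈ q∈ ns⊆ ms⊆

    -- The lemma of Pósa and Kopylov on a path in a 2-connected graph whose ends have at least `k`
    -- neighbours on it, counted together. The cases depend on whether some neighbour of `y`
    -- precedes a neighbour of `x`, and whether this happens at consecutive vertices.
    long-cycle : ∀ {n m} → n ∈ ns → m ∈ ms → LongCycle F k
    long-cycle n∈ m∈ with step-or-none (x ∷ xs) | last-split (_∈? ns) (x ∷ xs) (proj₂ (ns-ok n∈)) n∈
    ... | inj₁ (as , a , b , bs , eq , a∈ , b∈) | _ =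
      let c , zs , wc , uc , le = crossing-cycle {as = as} {mid = []} w u eq (proj₁ (ms-ok a∈)) (proj₁ (ns-ok b∈))
      in c , zs , wc , uc , ≤-trans k≤xs (≤-trans (≤-reflexive len) le)
      where
      len : length (x ∷ xs) ≡ length (as ++ [ a ]) + length (b ∷ bs)
      len = trans (cong length (trans eq (sym (List.++-assoc as [ a ] (b ∷ bs))))) (List.length-++ (as ++ [ a ]))
    ... | inj₂ none | c , z , rest , eq , z∈ , rest-ns with Any.any? (_∈? ms) c
    ... | yes h = let m , m∈c , m∈ms = find h in cross-search none c rest eq z∈ m∈c m∈ms
    ... | no ¬h = non-crossing c rest eq z∈ rest-ns (λ p p' → ¬h (lose p p')) m∈

-- Saturated graphs

AddEdge : {A : Set} → (A → A → Set) → A → A → A → A → Set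
AddEdge F u v a b = F a b ⊎ (a ≡ u × b ≡ v) ⊎ (a ≡ v × b ≡ u)

module _ {A : Set} {F : A → A → Set} (F-sym : ∀ {a b} → F a b → F b a) where

  addEdge-sym : ∀ {u v a b} → AddEdge F u v a b → AddEdge F u v b a
  addEdge-sym (inj₁ f) = inj₁ (F-sym f)
  addEdge-sym (inj₂ (inj₁ (p , q))) = inj₂ (inj₂ (q , p))
  addEdge-sym (inj₂ (inj₂ (p , q))) = inj₂ (inj₁ (q , p))

  private
    Ends : (u v a b : A) → Set
    Ends u v a b = (a ≡ u × b ≡ v) ⊎ (a ≡ v × b ≡ u)

    find-new : ∀ {u v x xs y} → Walk (AddEdge F u v) x xs y → Walk F x xs y ⊎
      (∃₂ λ as b → ∃₂ λ c bs → xs ≡ as ++ c ∷ bs × Walk (AddEdge F u v) x as b × Ends u v b c ×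
        Walk (AddEdge F u v) c bs y)
    find-new [] = inj₁ []
    find-new (inj₂ e ∷ w) = inj₂ ([] , _ , _ , _ , refl , [] , e , w)
    find-new (inj₁ f ∷ w) with find-new w
    ... | inj₁ w' = inj₁ (f ∷ w')
    ... | inj₂ (as , b , c , bs , refl , w₁ , e , w₂) = inj₂ (_ ∷ as , b , c , bs , refl , inj₁ f ∷ w₁ , e , w₂)

    -- A second use of the new edge would make `c` and `b`, the two ends of the path, consecutive on
    -- it. With at least three vertices on the path this contradicts distinctness.
    old-edges : ∀ {u v c ys b} → Walk (AddEdge F u v) c ys b → Unique (c ∷ ys) → Ends u v b c → 2 ≤ length ys →
      Walk F c ys b
    old-edges {u} {v} {c} {z ∷ z' ∷ ys} {b} (r ∷ w) un e _ = first r ∷ walk-map later w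
      where
      b∈ : b ∈ z' ∷ ys
      b∈ = end∈-tail w λ { refl → tail-case w }
        where
        tail-case : Walk (AddEdge F u v) z (z' ∷ ys) z → ⊥
        tail-case (_ ∷ w') = uniq-head (uniq-tail un) (end∈ w')
      b≢z : b ≢ z
      b≢z refl = uniq-head (uniq-tail un) b∈
      b≢c : b ≢ c
      b≢c refl = uniq-head un (there b∈)
      first : AddEdge F u v c z → F c z
      first (inj₁ f) = f
      first (inj₂ (inj₁ (refl , refl))) = case e of λ
        { (inj₁ (refl , refl)) → ⊥-elim (b≢c refl)
        ; (inj₂ (refl , refl)) → ⊥-elim (b≢z refl) }
      first (inj₂ (inj₂ (refl , refl))) = case e of λ
        { (inj₁ (refl , refl)) → ⊥-elim (b≢z refl)
        ; (inj₂ (refl , refl)) → ⊥-elim (b≢c refl) }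
      later : ∀ {a a'} → a ∈ z ∷ z' ∷ ys → a' ∈ z ∷ z' ∷ ys → AddEdge F u v a a' → F a a'
      later p p' (inj₁ f) = f
      later p p' (inj₂ (inj₁ (refl , refl))) = case e of λ
        { (inj₁ (refl , refl)) → ⊥-elim (uniq-head un p')
        ; (inj₂ (refl , refl)) → ⊥-elim (uniq-head un p) }
      later p p' (inj₂ (inj₂ (refl , refl))) = case e of λ
        { (inj₁ (refl , refl)) → ⊥-elim (uniq-head un p)
        ; (inj₂ (refl , refl)) → ⊥-elim (uniq-head un p') }
    old-edges {ys = _ ∷ []} w un e (s≤s ())

  LongPath : A → A → ℕ → Set
  LongPath u v k = ∃ λ xs → Walk F u xs v × Unique (u ∷ xs) × k ≤ length (u ∷ xs)

  new-cycle⇒path : ∀ {u v k} → 3 ≤ k → LongCycle (AddEdge F u v) k → ¬ LongCycle F k → LongPath u v k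
  new-cycle⇒path {u} {v} {k} 3≤k (x , xs , w , un , le) none with find-new w
  ... | inj₁ w' = ⊥-elim (none (x , xs , w' , un , le))
  ... | inj₂ (as , b , c , bs , refl , w₁ , e , w₂) = go e
    where
    perm : as ++ c ∷ bs ↭ c ∷ bs ++ as
    perm = ++-comm as (c ∷ bs)
    un' : Unique (c ∷ bs ++ as)
    un' = uniq-↭ perm un
    len : k ≤ length (c ∷ bs ++ as)
    len = ≤-trans le (≤-reflexive (↭-length perm))
    path : Walk F c (bs ++ as) b
    path = old-edges (w₂ ⊕ w₁) un' e (s≤s⁻¹ (≤-trans 3≤k len))
    go : Ends u v b c → LongPath u v k
    go (inj₂ (refl , refl)) = bs ++ as , path , un' , len
    go (inj₁ (refl , refl)) with rev F-sym path
    ... | ys , w' , perm' = ys , w' , uniq-↭ perm' un' , ≤-trans len (≤-reflexive (↭-length perm'))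

record Saturated {A : Set} (_≟_ : (x y : A) → Dec (x ≡ y)) (Γ : A → A → Set) (Vs : List A)
    (ps : List (A × A)) (k : ℕ) : Set₁ where
  constructor saturated
  field
    F      : A → A → Set
    F-sym  : ∀ {a b} → F a b → F b a
    F-in   : ∀ {a b} → F a b → a ∈ Vs × b ∈ Vs × a ≢ b
    Γ⊆F    : ∀ {a b} → Γ a b → F a b
    no-long : ¬ LongCycle F k
    full   : ∀ {u v} → (u , v) ∈ ps → u ≢ v → F u v ⊎ LongPath {F = F} F-sym u v k

-- Pairs are tried one after the other. A pair whose edge would create a long cycle is rejected, and
-- the path found at that moment survives all later additions, so each pair is tried once.
saturate : {A : Set} (_≟_ : (x y : A) → Dec (x ≡ y)) (Γ : A → A → Set) (Vs : List A) (k : ℕ) → 3 ≤ k →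
  (∀ {a b} → Γ a b → Γ b a) → (∀ {a b} → Γ a b → a ∈ Vs × b ∈ Vs × a ≢ b) → ¬ LongCycle Γ k →
  ∀ ps → (∀ {u v} → (u , v) ∈ ps → u ∈ Vs × v ∈ Vs) → (Saturated _≟_ Γ Vs ps k → ⊥) → ⊥
saturate _≟_ Γ Vs k 3≤k Γ-sym Γ-in none [] ps-in κ =
  κ (saturated Γ Γ-sym Γ-in (λ g → g) none (λ ()))
saturate {A} _≟_ Γ Vs k 3≤k Γ-sym Γ-in none ((u , v) ∷ ps) ps-in κ with u ≟ v
... | yes refl = saturate _≟_ Γ Vs k 3≤k Γ-sym Γ-in none ps (ps-in ∘ there) λ
  { (saturated F F-sym F-in Γ⊆F nl full) → κ (saturated F F-sym F-in Γ⊆F nl λ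
    { (here refl) u≢v → ⊥-elim (u≢v refl) ; (there p) → full p }) }
... | no u≢v = em (LongCycle (AddEdge Γ u v) k) λ
  { (no nl₀) → saturate _≟_ (AddEdge Γ u v) Vs k 3≤k (addEdge-sym Γ-sym) add-in nl₀ ps (ps-in ∘ there) λ
    { (saturated F F-sym F-in Γ⊆F nl full) → κ (saturated F F-sym F-in (Γ⊆F ∘ inj₁) nl λ
      { (here refl) _ → inj₁ (Γ⊆F (inj₂ (inj₁ (refl , refl)))) ; (there p) → full p }) }
  ; (yes lc) → saturate _≟_ Γ Vs k 3≤k Γ-sym Γ-in none ps (ps-in ∘ there) λ
    { (saturated F F-sym F-in Γ⊆F nl full) → κ (saturated F F-sym F-in Γ⊆F nl λ
      { (here refl) _ → inj₂ (case new-cycle⇒path Γ-sym 3≤k lc none of λ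
          { (xs , w , un , le) → xs , walk-map (λ _ _ → Γ⊆F) w , un , le })
      ; (there p) → full p }) } }
  where
  add-in : ∀ {a b} → AddEdge Γ u v a b → a ∈ Vs × b ∈ Vs × a ≢ b
  add-in (inj₁ g) = Γ-in g
  add-in (inj₂ (inj₁ (refl , refl))) = proj₁ (ps-in (here refl)) , proj₂ (ps-in (here refl)) , u≢v
  add-in (inj₂ (inj₂ (refl , refl))) = proj₂ (ps-in (here refl)) , proj₁ (ps-in (here refl)) , u≢v ∘ sym

clique-walk : {A : Set} {F : A → A → Set} {x : A} (xs : List A) → Unique (x ∷ xs) →
  (∀ {a b} → a ∈ x ∷ xs → b ∈ x ∷ xs → a ≢ b → F a b) → ∃ λ y → Walk F x xs y
clique-walk [] u f = _ , []
clique-walk (y ∷ xs) u f with clique-walk xs (uniq-tail u) (λ p q → f (there p) (there q))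
... | z , w = z , f (here refl) (there (here refl)) (λ { refl → uniq-head u (here refl) }) ∷ w

walk-in : {A : Set} {F : A → A → Set} {Vs : List A} → (∀ {a b} → F a b → b ∈ Vs) →
  ∀ {x xs y} → x ∈ Vs → Walk F x xs y → ∀ {v} → v ∈ x ∷ xs → v ∈ Vs
walk-in f x∈ w (here refl) = x∈
walk-in f x∈ (r ∷ w) (there p) = walk-in f (f r) w p

-- Kopylov's argument: in the saturated graph the dense part W is a clique, and a maximal clique
-- K ⊇ W has fewer than k vertices, so that a longest path from K to the rest closes up.
module Kopylov {n : ℕ} (k t : ℕ) (3≤k : 3 ≤ k) (1≤t : 1 ≤ t) (k≤2t+2 : k ≤ suc t + suc t)
  (Γ : Fin n → Fin n → Set) (Γ-sym : ∀ {a b} → Γ a b → Γ b a) (Vs Ws : List (Fin n))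
  (Γ-in : ∀ {a b} → Γ a b → a ∈ Vs × b ∈ Vs × a ≢ b)
  (Vs-uniq : Unique Vs) (Ws-uniq : Unique Ws) (Ws⊆Vs : ∀ {v} → v ∈ Ws → v ∈ Vs)
  (k≤Vs : k ≤ length Vs) (k<Ws+t : suc k ≤ length Ws + t) (2≤Ws : 2 ≤ length Ws)
  (V-deg : ∀ {v} → v ∈ Vs → ∃ λ ns → Unique ns × t ≤ length ns × (∀ {u} → u ∈ ns → Γ v u))
  (W-deg : ∀ {v} → v ∈ Ws → ∃ λ ns → Unique ns × suc t ≤ length ns × (∀ {u} → u ∈ ns → Γ v u × u ∈ Ws))
  (conn : ∀ {x y} z → x ∈ Vs → y ∈ Vs → x ≢ z → y ≢ z → ∃ λ xs → Walk Γ x xs y × z ∉ x ∷ xs)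
  (no-long : ¬ LongCycle Γ k) where

  open import Data.List.Membership.DecPropositional (Fin._≟_ {n}) using (_∈?_)

  module _ (S : Saturated Fin._≟_ Γ Vs (cartesianProduct Vs Vs) k) where

    open Saturated S renaming (no-long to no-long-F)

    private
      path-in : ∀ {x xs y} → x ∈ Vs → Walk F x xs y → ∀ {v} → v ∈ x ∷ xs → v ∈ Vs
      path-in = walk-in (proj₁ ∘ proj₂ ∘ F-in)

      F-conn : ∀ {x y} z → x ∈ Vs → y ∈ Vs → x ≢ z → y ≢ z → ∃ λ xs → Walk F x xs y × z ∉ x ∷ xs
      F-conn z p q p' q' with conn z p q p' q'
      ... | xs , w , z∉ = xs , walk-map (λ _ _ → Γ⊆F) w , z∉

    -- The path is longest among those joining nonadjacent vertices of `As` and `Bs`. Suppose `x`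
    -- had a neighbour in `As` off the path: if adjacent to `y` it would close a long cycle, and
    -- otherwise it would start a longer path of the same kind. The same holds at `y`.
    record Longest (As Bs : List (Fin n)) : Set where
      constructor longest
      field
        {x y} : Fin n
        xs    : List (Fin n)
        x∈    : x ∈ As
        y∈    : y ∈ Bs
        x≢y   : x ≢ y
        walk  : Walk F x xs y
        uniq  : Unique (x ∷ xs)
        long  : k ≤ length (x ∷ xs)
        A-on  : ∀ {v} → v ∈ As → F x v → v ∈ x ∷ xs
        B-on  : ∀ {v} → v ∈ Bs → F y v → v ∈ x ∷ xs

    longest-path : ∀ As Bs → As ⊆ Vs → Bs ⊆ Vs →
      (∃₂ λ x y → x ∈ As × y ∈ Bs × x ≢ y × ¬ F x y) → ¬ ¬ Longest As Bs
    longest-path As Bs A⊆ B⊆ (x₀ , y₀ , x₀∈ , y₀∈ , x₀≢y₀ , ¬F₀)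
      with full (∈-cartesianProduct⁺ (A⊆ x₀∈) (B⊆ y₀∈)) x₀≢y₀
    ... | inj₁ f = ⊥-elim (¬F₀ f)
    ... | inj₂ (xs₀ , w₀ , u₀ , k≤₀) = ¬¬-max Path (length Vs) bounded (length xs₀ , path₀) >>= build
      where
      Path : ℕ → Set
      Path l = ∃₂ λ x y → ∃ λ xs → x ∈ As × y ∈ Bs × x ≢ y × ¬ F x y × Walk F x xs y × Unique (x ∷ xs) × length xs ≡ l
      path₀ : Path (length xs₀)
      path₀ = x₀ , y₀ , xs₀ , x₀∈ , y₀∈ , x₀≢y₀ , ¬F₀ , w₀ , u₀ , refl
      bounded : ∀ m → Path m → m ≤ length Vs
      bounded m (x , y , xs , x∈ , y∈ , x≢y , ¬F , w , u , refl) =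
        ≤-trans (n≤1+n _) (uniq-⊆-length u (path-in (A⊆ x∈) w))
      build : _ → ¬ ¬ Longest As Bs
      build (m , (x , y , xs , x∈ , y∈ , x≢y , ¬Fxy , w , u , refl) , mx) =
        return (longest xs x∈ y∈ x≢y w u long
          (λ v∈ f → decide (λ v∉ → extend-front v∈ f v∉)) (λ v∈ f → decide (λ v∉ → extend-back v∈ f v∉)))
        where
        long : k ≤ length (x ∷ xs)
        long = ≤-trans k≤₀ (s≤s (mx _ path₀))
        decide : ∀ {v} → (v ∉ x ∷ xs → ⊥) → v ∈ x ∷ xs
        decide {v} f with v ∈? (x ∷ xs)
        ... | yes p = p
        ... | no np = ⊥-elim (f np)
        closes : ∀ {v} → v ∉ x ∷ xs → F v x → F y v → ⊥
        closes {v} v∉ f g = no-long-F (v , (x ∷ xs) ++ [ v ] , (f ∷ w) ⊕ (g ∷ []) ,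
          uniq-↭ (∷↭∷ʳ v (x ∷ xs)) (uniq-∷ v∉ u) ,
          ≤-trans long (≤-trans (n≤1+n _) (≤-reflexive (↭-length (∷↭∷ʳ v (x ∷ xs))))))
        extend-front : ∀ {v} → v ∈ As → F x v → v ∉ x ∷ xs → ⊥
        extend-front {v} v∈ f v∉ = em (F v y) λ
          { (yes g) → closes v∉ (F-sym f) (F-sym g)
          ; (no ¬g) → <-irrefl refl (mx _ (v , y , x ∷ xs , v∈ , y∈ , (λ { refl → v∉ (end∈ w) }) , ¬g , F-sym f ∷ w ,
              uniq-∷ v∉ u , refl)) }
        extend-back : ∀ {v} → v ∈ Bs → F y v → v ∉ x ∷ xs → ⊥
        extend-back {v} v∈ f v∉ = em (F x v) λ
          { (yes g) → closes v∉ (F-sym g) f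
          ; (no ¬g) → <-irrefl refl (≤-trans (≤-reflexive (↭-length (∷↭∷ʳ v xs))) (mx _ (x , v , xs ++ [ v ] , x∈ , v∈ ,
              (λ { refl → v∉ (here refl) }) , ¬g , w ⊕ (f ∷ []) , uniq-↭ (∷↭∷ʳ v (x ∷ xs)) (uniq-∷ v∉ u) , refl))) }

    close-up : ∀ {As Bs} (L : Longest As Bs) (ns ms : List (Fin n)) → As ⊆ Vs → Unique ns → Unique ms →
      1 ≤ length ns → 1 ≤ length ms → k ≤ length ns + length ms →
      (∀ {v} → v ∈ ns → F (Longest.x L) v × v ∈ Longest.x L ∷ Longest.xs L) →
      (∀ {v} → v ∈ ms → F (Longest.y L) v × v ∈ Longest.x L ∷ Longest.xs L) → ⊥
    close-up (longest xs x∈ y∈ x≢y w u long A-on B-on) (_ ∷ _) (_ ∷ _) A⊆ un um _ _ le ns-ok ms-ok =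
      no-long-F (PathToCycle.long-cycle Fin._≟_ F F-sym (λ f → proj₂ (proj₂ (F-in f)) refl) (_∈ Vs) F-conn
        w u (path-in (A⊆ x∈) w) un um ns-ok ms-ok long le (here refl) (here refl))

    -- The ends of a longest path between nonadjacent vertices of `Ws` each have t + 1 neighbours in
    -- `Ws`, all of them on the path, and 2t + 2 ≥ k.
    W-clique : (∃₂ λ x y → x ∈ Ws × y ∈ Ws × x ≢ y × ¬ F x y) → ⊥
    W-clique pair = longest-path Ws Ws Ws⊆Vs Ws⊆Vs pair λ L →
      let open Longest L
          ns , un , ln , ns-ok = W-deg x∈
          ms , um , lm , ms-ok = W-deg y∈
      in close-up L ns ms Ws⊆Vs un um (≤-trans (s≤s z≤n) ln) (≤-trans (s≤s z≤n) lm)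
           (≤-trans k≤2t+2 (+-mono-≤ ln lm))
           (λ p → Γ⊆F (proj₁ (ns-ok p)) , A-on (proj₂ (ns-ok p)) (Γ⊆F (proj₁ (ns-ok p))))
           (λ p → Γ⊆F (proj₁ (ms-ok p)) , B-on (proj₂ (ms-ok p)) (Γ⊆F (proj₁ (ms-ok p))))

    Clique : ℕ → Set
    Clique l = ∃ λ K → Unique K × K ⊆ Vs × Ws ⊆ K ×
      (∀ {a b} → a ∈ K → b ∈ K → a ≢ b → F a b) × length K ≡ l

    small-clique : ∀ {l} → Clique l → l < k
    small-clique {l} (K , uK , K⊆ , W⊆ , cl , refl) with suc (length K) ≤? k
    ... | yes lt = lt
    ... | no ≰ = ⊥-elim (no-long-F (cycle K uK cl (s≤s⁻¹ (≰⇒> ≰))))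
      where
      cycle : ∀ K → Unique K → (∀ {a b} → a ∈ K → b ∈ K → a ≢ b → F a b) → k ≤ length K → LongCycle F k
      cycle (x ∷ xs) u cl le with clique-walk xs u cl
      ... | y , w = x , xs ++ [ x ] , w ⊕ (cl (end∈ w) (here refl) y≢x ∷ []) , uniq-↭ (∷↭∷ʳ x xs) u ,
          ≤-trans le (≤-reflexive (↭-length (∷↭∷ʳ x xs)))
        where
        nonempty : ∀ xs → Unique (x ∷ xs) → Walk F x xs x → 3 ≤ length (x ∷ xs) → ⊥
        nonempty [] _ _ (s≤s ())
        nonempty (_ ∷ _) u (_ ∷ w') _ = uniq-head u (end∈ w')
        y≢x : y ≢ x
        y≢x refl = nonempty xs u w (≤-trans 3≤k le)
      cycle [] u cl le with ≤-trans 3≤k le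
      ... | ()

    outside : ∀ (K : List (Fin n)) → length K < length Vs → ∃ λ y → y ∈ Vs × y ∉ K
    outside K lt with Any.any? (λ y → ¬? (y ∈? K)) Vs
    ... | yes h = find h
    ... | no none = ⊥-elim (<⇒≱ lt (uniq-⊆-length Vs-uniq λ {v} p → case v ∈? K of λ
          { (yes q) → q ; (no q) → ⊥-elim (none (lose p q)) }))

    -- A vertex outside `K` exists since `K` has fewer than `k` vertices, and by maximality it
    -- misses some vertex of `K`. On a longest path from `K` to its complement, `x` sees the rest of
    -- `K` and `y` sees `t` vertices, together at least `k`.
    max-clique : (∀ a b → Dec (F a b)) → ∃ (λ m → Clique m × (∀ m' → Clique m' → m' ≤ m)) → ⊥
    max-clique F? (m , (K , uK , K⊆ , W⊆ , cl , refl) , mx) with outside K (≤-trans (small-clique (K , uK , K⊆ , W⊆ , cl , refl)) k≤Vs)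
    ... | y₀ , y₀∈ , y₀∉ with All.all? (λ x → F? x y₀) K
    ... | yes all = <-irrefl refl (mx _ (y₀ ∷ K , uniq-∷ y₀∉ uK , (λ { (here refl) → y₀∈ ; (there p) → K⊆ p }) ,
            there ∘ W⊆ , cl' , refl))
      where
      cl' : ∀ {a b} → a ∈ y₀ ∷ K → b ∈ y₀ ∷ K → a ≢ b → F a b
      cl' (here refl) (here refl) ne = ⊥-elim (ne refl)
      cl' (here refl) (there q) ne = F-sym (All.lookup all q)
      cl' (there p) (here refl) ne = All.lookup all p
      cl' (there p) (there q) ne = cl p q ne
    ... | no ¬all with find (¬All⇒Any¬ (λ x → F? x y₀) K ¬all)
    ... | x₀ , x₀∈ , ¬F₀ = longest-path K Bs K⊆ (proj₁ ∘ B⇒) (x₀ , y₀ , x₀∈ , B⇐ y₀∈ y₀∉ , (λ { refl → y₀∉ x₀∈ }) , ¬F₀) finish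
      where
      Bs = filter (λ v → ¬? (v ∈? K)) Vs
      B⇒ : ∀ {v} → v ∈ Bs → v ∈ Vs × v ∉ K
      B⇒ = ∈-filter⁻ (λ v → ¬? (v ∈? K))
      B⇐ : ∀ {v} → v ∈ Vs → v ∉ K → v ∈ Bs
      B⇐ = ∈-filter⁺ (λ v → ¬? (v ∈? K))
      finish : Longest K Bs → ⊥
      finish L with ∈-∃++ (Longest.x∈ L)
      ... | as , bs , eqK = close-up L (as ++ bs) ms K⊆ un um 1≤ns (≤-trans 1≤t lm) count ns-ok ms-ok'
        where
        open Longest L
        perm : K ↭ x ∷ as ++ bs
        perm = Perm.trans (Perm.↭-reflexive eqK) (shift x as bs)
        un₀ : Unique (x ∷ as ++ bs)
        un₀ = uniq-↭ perm uK
        un = uniq-tail un₀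
        deg = V-deg (proj₁ (B⇒ y∈))
        ms = proj₁ deg
        um = proj₁ (proj₂ deg)
        lm = proj₁ (proj₂ (proj₂ deg))
        ms-ok = proj₂ (proj₂ (proj₂ deg))
        ns-ok : ∀ {v} → v ∈ as ++ bs → F x v × v ∈ x ∷ xs
        ns-ok {v} p = f , A-on v∈ f
          where
          v∈ = ∈-resp-↭ (↭-sym perm) (there p)
          f = cl x∈ v∈ (λ { refl → uniq-head un₀ p })
        -- A neighbour of `y` outside `K` is on the path by `B-on`; one inside `K` is `x` itself or
        -- adjacent to `x`, hence on the path by `A-on`.
        ms-ok' : ∀ {v} → v ∈ ms → F y v × v ∈ x ∷ xs
        ms-ok' {v} p with v ∈? K
        ... | no v∉ = Γ⊆F (ms-ok p) , B-on (B⇐ (proj₁ (proj₂ (Γ-in (ms-ok p)))) v∉) (Γ⊆F (ms-ok p))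
        ... | yes v∈ with ∈-resp-↭ perm v∈
        ... | here refl = Γ⊆F (ms-ok p) , here refl
        ... | there q = Γ⊆F (ms-ok p) , proj₂ (ns-ok q)
        len : length Ws ≤ suc (length (as ++ bs))
        len = ≤-trans (uniq-⊆-length Ws-uniq W⊆) (≤-reflexive (↭-length perm))
        count : k ≤ length (as ++ bs) + length ms
        count = s≤s⁻¹ (≤-trans k<Ws+t (+-mono-≤ len lm))
        1≤ns : 1 ≤ length (as ++ bs)
        1≤ns = s≤s⁻¹ (≤-trans 2≤Ws len)

    contradiction-from-saturation : ⊥
    contradiction-from-saturation = ¬¬-∀Fin (λ a → ¬¬-∀Fin (λ b → em (F a b))) λ F? →
      ¬¬-max Clique (length Vs) (λ { m (K , uK , K⊆ , _ , _ , refl) → uniq-⊆-length uK K⊆ })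
        (length Ws , Ws , Ws-uniq , Ws⊆Vs , (λ p → p) ,
          (λ {a} {b} p q ne → case F? a b of λ { (yes f) → f ; (no ¬f) → ⊥-elim (W-clique (a , b , p , q , ne , ¬f)) }) , refl)
        (max-clique F?)

  contradiction : ⊥
  contradiction = saturate Fin._≟_ Γ Vs k 3≤k Γ-sym Γ-in no-long (cartesianProduct Vs Vs)
    (∈-cartesianProduct⁻ Vs Vs) contradiction-from-saturation

-- Incidence graphs of hypergraphs

module Incidence {n m : ℕ} (E : Fin m → Subset n) where

  Node : Set
  Node = Fin n ⊎ Fin m

  _≟ⁿ_ : (x y : Node) → Dec (x ≡ y)
  _≟ⁿ_ = ≡-dec Fin._≟_ Fin._≟_

  Adj : Node → Node → Set
  Adj (inj₁ v) (inj₂ e) = v ∈ₛ E e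
  Adj (inj₂ e) (inj₁ v) = v ∈ₛ E e
  Adj _ _ = ⊥

  Adj-sym : ∀ x y → Adj x y → Adj y x
  Adj-sym (inj₁ _) (inj₂ _) p = p
  Adj-sym (inj₂ _) (inj₁ _) p = p

  Adj-rev : ∀ {x xs y} → Walk Adj x xs y → ∃ λ ys → Walk Adj y ys x × x ∷ xs ↭ y ∷ ys
  Adj-rev = rev (λ {x} {y} → Adj-sym x y)

  vertices : Node → ℕ
  vertices (inj₁ _) = 1
  vertices (inj₂ _) = 0

  AdjCycle : ℕ → Set
  AdjCycle k = ∃₂ λ x zs → Walk Adj x zs x × Unique zs × k ≤ total vertices zs

  Connectivity : Set
  Connectivity = ∀ {x y : Node} z → x ≢ z → y ≢ z → ∃ λ xs → Walk Adj x xs y × z ∉ x ∷ xs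

  -- O u v e: the edge e is reserved for the pair {u, v}.
  record Owners (O : Fin n → Fin n → Fin m → Set) : Set where
    field
      O-sym : ∀ {u v e} → O u v e → O v u e
      O-inc : ∀ {u v e} → O u v e → u ∈ₛ E e
      O-irr : ∀ {v e} → ¬ O v v e
      O-inj : ∀ {u v u' v' e} → O u v e → O u' v' e → (u ≡ u' × v ≡ v') ⊎ (u ≡ v' × v ≡ u')

  module Owned (O : Fin n → Fin n → Fin m → Set) (owners : Owners O) where

    open Owners owners public

    Γ : Fin n → Fin n → Set
    Γ u v = ∃ λ e → O u v e

    Γ-sym : ∀ {u v} → Γ u v → Γ v u
    Γ-sym (e , o) = e , O-sym o

    Γ-irr : ∀ {v} → ¬ Γ v v
    Γ-irr (e , o) = O-irr o

    -- `on-E` separates the hyperedge of the first step from the others: as `u` does not recur, no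
    -- other step can use a hyperedge owned by a pair containing `u`.
    record Expansion (u : Fin n) (us : List (Fin n)) (v : Fin n) : Set where
      constructor expansion
      field
        es     : List Node
        walk   : Walk Adj (inj₁ u) es (inj₁ v)
        uniq   : Unique (inj₁ u ∷ es)
        on-V   : ∀ {w} → inj₁ w ∈ es → w ∈ us
        on-E   : ∀ {e} → inj₂ e ∈ es →
                 (∃₂ λ b t → us ≡ b ∷ t × O u b e) ⊎ (∃₂ λ a b → a ∈ us × b ∈ us × O a b e)
        weight : total vertices es ≡ length us

      pair : ∀ {e} → inj₂ e ∈ es → ∃₂ λ a b → a ∈ u ∷ us × b ∈ us × O a b e
      pair p with on-E p
      ... | inj₁ (b , t , refl , o) = u , b , here refl , here refl , o
      ... | inj₂ (a , b , a∈ , b∈ , o) = a , b , there a∈ , b∈ , o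

    expand : ∀ {u us v} → Walk Γ u us v → Unique (u ∷ us) → Expansion u us v
    expand [] un = expansion [] [] ([] ∷ []) (λ ()) (λ ()) refl
    expand {u} {c ∷ us} ((e , o) ∷ w) un with expand w (uniq-tail un)
    ... | X@(expansion es we ue oV oE wt) = expansion (inj₂ e ∷ inj₁ c ∷ es) (O-inc o ∷ O-inc (O-sym o) ∷ we)
        (uniq-∷ u∉ (uniq-∷ e∉ ue))
        (λ { (there (here refl)) → here refl ; (there (there p)) → there (oV p) })
        (λ { (here refl) → inj₁ (c , us , refl , o)
           ; (there (there p)) → case Expansion.pair X p of λ { (a , b , a∈ , b∈ , o') → inj₂ (a , b , a∈ , there b∈ , o') } })
        (cong suc wt)
      where
      u∉ : inj₁ u ∉ inj₂ e ∷ inj₁ c ∷ es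
      u∉ (there (here refl)) = uniq-head un (here refl)
      u∉ (there (there p)) = uniq-head un (there (oV p))
      e∉ : inj₂ e ∉ inj₁ c ∷ es
      e∉ (there p) with Expansion.pair X p
      ... | a , b , a∈ , b∈ , o' with O-inj o o'
      ... | inj₁ (refl , _) = uniq-head un a∈
      ... | inj₂ (refl , _) = uniq-head un (there b∈)

    -- Traversals use owners of pairs inside the block. Counting all those owners as elements keeps
    -- a link that is disjoint from this set from competing for a hyperedge with any traversal.
    BlockNodes : List (Fin n) → Node → Set
    BlockNodes bs (inj₁ v) = v ∈ bs
    BlockNodes bs (inj₂ e) = ∃₂ λ u v → u ∈ bs × v ∈ bs × O u v e

    module _ {x z bs} (w : Walk Γ x bs z) (u : Unique (x ∷ bs)) {ns} (un : Unique ns)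
      (adj : ∀ {v} → v ∈ ns → Γ x v) (sub : ∀ {v} → v ∈ ns → v ∈ bs) (z∈ : z ∈ ns) (3≤ns : 3 ≤ length ns) where

      private
        module B = Block Fin._≟_ Γ Γ-sym w u ns un adj sub z∈

        X : Node → Set
        X = BlockNodes (x ∷ bs)

        expanded : ∀ {a} (t : B.Traversal a) → Expansion a (B.Traversal.ys t) z
        expanded t = expand (B.Traversal.walk t) (B.Traversal.distinct t)

        inside-X : ∀ {a} (t : B.Traversal a) → ∀ {v} → v ∈ inj₁ a ∷ Expansion.es (expanded t) → X v
        inside-X t (here refl) = B.Traversal.inside t (here refl)
        inside-X t {inj₁ v} (there p) = B.Traversal.inside t (there (Expansion.on-V (expanded t) p))
        inside-X t {inj₂ e} (there p) with Expansion.pair (expanded t) p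
        ... | a , b , a∈ , b∈ , o = a , b , B.Traversal.inside t a∈ , B.Traversal.inside t (there b∈) , o

        turn : ∀ {a us} → Walk Adj a us (inj₁ z) → Unique (a ∷ us) → (∀ {v} → v ∈ a ∷ us → X v) →
          suc (length ns) ≤ total vertices (a ∷ us) →
          ∃ λ vs → Walk Adj (inj₁ z) vs a × Unique (inj₁ z ∷ vs) × (∀ {v} → v ∈ vs → X v) ×
            suc (length ns) ≤ total vertices (inj₁ z ∷ vs)
        turn w' u' ins cov with Adj-rev w'
        ... | vs , wr , perm = vs , wr , uniq-↭ perm u' , (λ p → ins (∈-resp-↭ (↭-sym perm) (there p))) ,
          ≤-trans cov (≤-reflexive (total-↭ vertices perm))

        covers : ∀ {a} (t : B.Traversal a) →
          suc (length ns) ≤ suc (total vertices (Expansion.es (expanded t)))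
        covers t = ≤-trans (B.Traversal.covers t)
          (≤-reflexive (cong suc (sym (Expansion.weight (expanded t)))))

      -- From a hyperedge one steps to a suitable member of its own pair. The traversal from there
      -- could meet the hyperedge again only in its first step, which `avoid` excludes.
      block-reaches : ∀ {a} → X a → a ≢ inj₁ z →
        ∃ λ vs → Walk Adj (inj₁ z) vs a × Unique (inj₁ z ∷ vs) × (∀ {v} → v ∈ vs → X v) ×
          suc (length ns) ≤ total vertices (inj₁ z ∷ vs)
      block-reaches {inj₁ a} a∈ a≢z = turn (Expansion.walk ex) (Expansion.uniq ex) (inside-X t) (covers t)
        where
        t = B.from-vertex a∈ (λ { refl → a≢z refl })
        ex = expanded t
      block-reaches {inj₂ e} (a , b , a∈ , b∈ , o) _
        with B.from-pair 3≤ns a∈ b∈ (λ { refl → O-irr o })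
      ... | B.pair-traversal h k ends t avoid =
        turn (O-inc ohk ∷ Expansion.walk ex) (uniq-∷ e∉ (Expansion.uniq ex))
          (λ { (here refl) → a , b , a∈ , b∈ , o ; (there p) → inside-X t p }) (covers t)
        where
        ex = expanded t
        ohk : O h k e
        ohk = case ends of λ { (inj₁ (refl , refl)) → o ; (inj₂ (refl , refl)) → O-sym o }
        e∉ : inj₂ e ∉ inj₁ h ∷ Expansion.es ex
        e∉ (there p) with Expansion.on-E ex p
        ... | inj₁ (c , _ , eq , o') with O-inj o' ohk
        ... | inj₁ (_ , c≡k) = avoid eq c≡k
        ... | inj₂ (refl , _) = O-irr ohk
        e∉ (there p) | inj₂ (c , d , c∈ , d∈ , o') with O-inj o' ohk
        ... | inj₁ (refl , _) = uniq-head (B.Traversal.distinct t) c∈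
        ... | inj₂ (_ , refl) = uniq-head (B.Traversal.distinct t) d∈

    -- A path ending (at q) in a long block: all of ns lies on it.
    record Arm (q : Fin n) (s : ℕ) : Set where
      constructor arm
      field
        {x}  : Fin n
        xs   : List (Fin n)
        walk : Walk Γ x xs q
        uniq : Unique (x ∷ xs)
        ns   : List (Fin n)
        ns-uniq : Unique ns
        ns-adj  : ∀ {v} → v ∈ ns → Γ x v
        ns-xs   : ns ⊆ xs
        s≤ns    : s ≤ length ns

      nodes : List (Fin n)
      nodes = x ∷ xs

    record SplitArm {q s} (a : Arm q s) : Set where
      constructor split-arm
      open Arm a
      field
        {z}      : Fin n
        bs tl    : List (Fin n)
        block    : Walk Γ x bs z
        tail     : Walk Γ z tl q
        joined   : xs ≡ bs ++ tl
        z∈       : z ∈ ns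
        ns-bs    : ns ⊆ bs

    open import Data.List.Membership.DecPropositional (Fin._≟_ {n}) using (_∈?_)

    split : ∀ {q s} (a : Arm q (suc s)) → SplitArm a
    split (arm xs w u (n₀ ∷ ns) un adj ns-xs (s≤s le)) with last-split (_∈? n₀ ∷ ns) xs (ns-xs (here refl)) (here refl)
    ... | as , z , tl , refl , z∈ , none with cut as w
    ... | w₁ , w₂ = split-arm (as ++ [ z ]) tl w₁ w₂ (sym (List.++-assoc as [ z ] tl)) z∈
      λ p → case ∈-++⁻ as (ns-xs p) of λ
        { (inj₁ h) → ∈-++⁺ˡ h ; (inj₂ (here refl)) → ∈-++⁺ʳ as (here refl) ; (inj₂ (there h)) → ⊥-elim (none h p) }

-- Joining two arms to a cycle

module TwoArms {n m : ℕ} (E : Fin m → Subset n) (connected : Incidence.Connectivity E)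
  (O : Fin n → Fin n → Fin m → Set) (owners : Incidence.Owners E O) {q₁ q₂ s₁ s₂ k}
  (3≤s₁ : 3 ≤ suc s₁) (3≤s₂ : 3 ≤ suc s₂)
  (A : Incidence.Owned.Arm E O owners q₁ (suc s₁)) (B : Incidence.Owned.Arm E O owners q₂ (suc s₂))
  (apart : ∀ {v} → v ∈ Incidence.Owned.Arm.nodes A → v ∈ Incidence.Owned.Arm.nodes B → v ≡ q₁ × v ≡ q₂)
  (rs : List (Fin n ⊎ Fin m)) (road : Walk (Incidence.Adj E) (inj₁ q₁) rs (inj₁ q₂)) (rs-uniq : Unique (inj₁ q₁ ∷ rs))
  (rs-E : ∀ {u v e} → inj₂ e ∈ rs → ¬ O u v e)
  (rs-A : ∀ {v} → inj₁ v ∈ rs → v ∈ Incidence.Owned.Arm.nodes A → v ≡ q₁)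
  (rs-B : ∀ {v} → inj₁ v ∈ rs → v ∈ Incidence.Owned.Arm.nodes B → v ≡ q₂)
  (k≤apart : k ≤ suc (suc s₁) + suc (suc s₂)) (k≤shared : q₁ ≡ q₂ → suc k ≤ suc (suc s₁) + suc (suc s₂)) where

  open Incidence E
  open Owned O owners
  open import Data.List.Membership.DecPropositional (Fin._≟_ {n}) using (_∈?_)

  private
    module A = Arm A
    module B = Arm B
    module SA = SplitArm (split A)
    module SB = SplitArm (split B)

    X Y : Node → Set
    X = BlockNodes (A.x ∷ SA.bs)
    Y = BlockNodes (B.x ∷ SB.bs)

    uA : Unique ((A.x ∷ SA.bs) ++ SA.tl)
    uA = subst (λ l → Unique (A.x ∷ l)) SA.joined A.uniq
    uB : Unique ((B.x ∷ SB.bs) ++ SB.tl)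
    uB = subst (λ l → Unique (B.x ∷ l)) SB.joined B.uniq

    A-disjoint : Disjoint (A.x ∷ SA.bs) SA.tl
    A-disjoint = proj₂ (proj₂ (uniq-++⁻ (A.x ∷ SA.bs) uA))
    B-disjoint : Disjoint (B.x ∷ SB.bs) SB.tl
    B-disjoint = proj₂ (proj₂ (uniq-++⁻ (B.x ∷ SB.bs) uB))

    A-block : A.x ∷ SA.bs ⊆ A.nodes
    A-block {v} p = subst (λ l → v ∈ A.x ∷ l) (sym SA.joined) (∈-++⁺ˡ p)
    A-tail : SA.tl ⊆ A.nodes
    A-tail {v} p = subst (λ l → v ∈ A.x ∷ l) (sym SA.joined) (∈-++⁺ʳ (A.x ∷ SA.bs) p)
    B-block : B.x ∷ SB.bs ⊆ B.nodes
    B-block {v} p = subst (λ l → v ∈ B.x ∷ l) (sym SB.joined) (∈-++⁺ˡ p)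
    B-tail : SB.tl ⊆ B.nodes
    B-tail {v} p = subst (λ l → v ∈ B.x ∷ l) (sym SB.joined) (∈-++⁺ʳ (B.x ∷ SB.bs) p)

    z-block : SA.z ∈ A.x ∷ SA.bs
    z-block = end∈ SA.block
    q-block : SB.z ∈ B.x ∷ SB.bs
    q-block = end∈ SB.block

    q₁-in-block : ∀ {v} → v ∈ A.x ∷ SA.bs → v ≡ q₁ → v ≡ SA.z
    q₁-in-block p refl with end∈ SA.tail
    ... | here eq = eq
    ... | there h = ⊥-elim (A-disjoint p h)
    q₂-in-block : ∀ {v} → v ∈ B.x ∷ SB.bs → v ≡ q₂ → v ≡ SB.z
    q₂-in-block p refl with end∈ SB.tail
    ... | here eq = eq
    ... | there h = ⊥-elim (B-disjoint p h)

    -- A hyperedge owns a single pair, so both of its vertices would lie on both arms. The arms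
    -- share at most one vertex, whereas an owned pair has two.
    no-common-edge : ∀ {a b a' b' e} → a ∈ A.nodes → b ∈ A.nodes → O a b e →
      a' ∈ B.nodes → b' ∈ B.nodes → O a' b' e → ⊥
    no-common-edge a∈ b∈ o a'∈ b'∈ o' with O-inj o o'
    ... | inj₁ (refl , refl) with apart a∈ a'∈ | apart b∈ b'∈
    ... | refl , _ | refl , _ = O-irr o
    no-common-edge a∈ b∈ o a'∈ b'∈ o' | inj₂ (refl , refl) with apart a∈ b'∈ | apart b∈ a'∈
    ... | refl , _ | refl , _ = O-irr o

    x≢z : A.x ≢ SA.z
    x≢z eq = Γ-irr (subst (Γ A.x) (sym eq) (A.ns-adj SA.z∈))
    y≢q : B.x ≢ SB.z
    y≢q eq = Γ-irr (subst (Γ B.x) (sym eq) (B.ns-adj SB.z∈))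

    reach-X : ∀ {a} → X a → a ≢ inj₁ SA.z → _
    reach-X = block-reaches SA.block (proj₁ (uniq-++⁻ (A.x ∷ SA.bs) uA)) A.ns-uniq A.ns-adj SA.ns-bs SA.z∈
      (≤-trans 3≤s₁ A.s≤ns)
    reach-Y : ∀ {a} → Y a → a ≢ inj₁ SB.z → _
    reach-Y = block-reaches SB.block (proj₁ (uniq-++⁻ (B.x ∷ SB.bs) uB)) B.ns-uniq B.ns-adj SB.ns-bs SB.z∈
      (≤-trans 3≤s₂ B.s≤ns)

    arms≤ : suc (suc s₁) + suc (suc s₂) ≤ suc (length A.ns) + suc (length B.ns)
    arms≤ = +-mono-≤ (s≤s A.s≤ns) (s≤s B.s≤ns)

    back : ∃ λ ys → Walk Γ q₂ ys SB.z × SB.z ∷ SB.tl ↭ q₂ ∷ ys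
    back = rev Γ-sym SB.tail
    back⊆ : q₂ ∷ proj₁ back ⊆ SB.z ∷ SB.tl
    back⊆ = ∈-resp-↭ (↭-sym (proj₂ (proj₂ back)))
    uback : Unique (q₂ ∷ proj₁ back)
    uback = uniq-↭ (proj₂ (proj₂ back)) (uniq-∷ (λ p → B-disjoint q-block p)
      (proj₁ (proj₂ (uniq-++⁻ (B.x ∷ SB.bs) uB))))
    back-B : q₂ ∷ proj₁ back ⊆ B.nodes
    back-B p with back⊆ p
    ... | here refl = B-block q-block
    ... | there h = B-tail h

    module E₁ = Expansion (expand SA.tail (uniq-∷ (λ p → A-disjoint z-block p)
      (proj₁ (proj₂ (uniq-++⁻ (A.x ∷ SA.bs) uA)))))
    module E₂ = Expansion (expand (proj₁ (proj₂ back)) uback)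

    ts : List Node
    ts = E₁.es ++ rs ++ E₂.es

    E₁-A : ∀ {e} → inj₂ e ∈ E₁.es → ∃₂ λ a b → a ∈ A.nodes × b ∈ SA.tl × O a b e
    E₁-A p with E₁.pair p
    ... | a , b , here refl , b∈ , o = a , b , A-block z-block , b∈ , o
    ... | a , b , there a∈ , b∈ , o = a , b , A-tail a∈ , b∈ , o

    rs-E₂ : Disjoint rs E₂.es
    rs-E₂ {inj₁ v} p q with rs-B p (back-B (there (E₂.on-V q)))
    ... | refl = uniq-head uback (E₂.on-V q)
    rs-E₂ {inj₂ e} p q with E₂.pair q
    ... | _ , _ , _ , _ , o = rs-E p o

    E₁-rest : Disjoint (inj₁ SA.z ∷ E₁.es) (rs ++ E₂.es)
    E₁-rest {inj₁ v} p q with v∈A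
      where
      v∈A : v ∈ A.nodes
      v∈A = case p of λ { (here refl) → A-block z-block ; (there h) → A-tail (E₁.on-V h) }
    ... | v∈A with ∈-++⁻ rs q
    ... | inj₁ h with rs-A h v∈A
    ... | refl = uniq-head rs-uniq h
    E₁-rest {inj₁ v} p q | v∈A | inj₂ h with proj₂ (apart v∈A (back-B (there (E₂.on-V h))))
    ... | refl = uniq-head uback (E₂.on-V h)
    E₁-rest {inj₂ e} (there p) q with ∈-++⁻ rs q | E₁-A p
    ... | inj₁ h | _ , _ , _ , _ , o = rs-E h o
    ... | inj₂ h | a , b , a∈ , b∈ , o with E₂.pair h
    ... | a' , b' , a'∈ , b'∈ , o' = no-common-edge a∈ (A-tail b∈) o (back-B a'∈) (back-B (there b'∈)) o'

    uts : Unique (inj₁ SA.z ∷ ts)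
    uts = uniq-++ E₁.uniq (uniq-++ (uniq-tail rs-uniq) (uniq-tail E₂.uniq) rs-E₂) E₁-rest

    ts-X : None X ts
    ts-X {inj₁ v} p v∈X with ∈-++⁻ E₁.es p
    ... | inj₁ h = A-disjoint v∈X (E₁.on-V h)
    ... | inj₂ h with ∈-++⁻ rs h
    ... | inj₁ h' with rs-A h' (A-block v∈X)
    ... | refl = uniq-head rs-uniq h'
    ts-X {inj₁ v} p v∈X | inj₂ h | inj₂ h' with proj₂ (apart (A-block v∈X) (back-B (there (E₂.on-V h'))))
    ... | refl = uniq-head uback (E₂.on-V h')
    ts-X {inj₂ e} p (u , v , u∈ , v∈ , o) with ∈-++⁻ E₁.es p
    ... | inj₁ h with E₁-A h
    ... | a , b , a∈ , b∈ , o' with O-inj o' o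
    ... | inj₁ (_ , refl) = A-disjoint v∈ b∈
    ... | inj₂ (_ , refl) = A-disjoint u∈ b∈
    ts-X {inj₂ e} p (u , v , u∈ , v∈ , o) | inj₂ h with ∈-++⁻ rs h
    ... | inj₁ h' = rs-E h' o
    ... | inj₂ h' with E₂.pair h'
    ... | a' , b' , a'∈ , b'∈ , o' = no-common-edge (A-block u∈) (A-block v∈) o (back-B a'∈) (back-B (there b'∈)) o'

    ts-Y : Only Y ts (inj₁ SB.z)
    ts-Y {inj₁ v} p v∈Y with ∈-++⁻ E₁.es p
    ... | inj₁ h = cong inj₁ (q₂-in-block v∈Y (proj₂ (apart (A-tail (E₁.on-V h)) (B-block v∈Y))))
    ... | inj₂ h with ∈-++⁻ rs h
    ... | inj₁ h' = cong inj₁ (q₂-in-block v∈Y (rs-B h' (B-block v∈Y)))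
    ... | inj₂ h' with back⊆ (there (E₂.on-V h'))
    ... | here eq = cong inj₁ eq
    ... | there h'' = ⊥-elim (B-disjoint v∈Y h'')
    ts-Y {inj₂ e} p (u , v , u∈ , v∈ , o) with ∈-++⁻ E₁.es p
    ... | inj₁ h with E₁-A h
    ... | a , b , a∈ , b∈ , o' = ⊥-elim (no-common-edge a∈ (A-tail b∈) o' (B-block u∈) (B-block v∈) o)
    ts-Y {inj₂ e} p (u , v , u∈ , v∈ , o) | inj₂ h with ∈-++⁻ rs h
    ... | inj₁ h' = ⊥-elim (rs-E h' o)
    ... | inj₂ h' with E₂.pair h'
    ... | a , b , a∈ , b∈ , o' with both-q
      where
      tail-block : ∀ {w} → w ∈ q₂ ∷ proj₁ back → w ∈ B.x ∷ SB.bs → w ≡ SB.z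
      tail-block w∈ w∈' with back⊆ w∈
      ... | here eq = eq
      ... | there t = ⊥-elim (B-disjoint w∈' t)
      both-q : a ≡ SB.z × b ≡ SB.z
      both-q with O-inj o' o
      ... | inj₁ (refl , refl) = tail-block a∈ u∈ , tail-block (there b∈) v∈
      ... | inj₂ (refl , refl) = tail-block a∈ v∈ , tail-block (there b∈) u∈
    ... | refl , refl = ⊥-elim (O-irr o')

  -- The tails of the arms together with the road form the path from one block to the other that
  -- `cycle-apart` starts from. If the blocks end at the same vertex, then the arms end at the same
  -- vertex, and `k≤shared` pays for counting it twice. Membership of hyperedges in the blocks is
  -- decided classically.
  cycle : ¬ ¬ AdjCycle k
  cycle = ¬¬-∀Fin (λ e → em (X (inj₂ e))) >>= λ X? → ¬¬-∀Fin (λ e → em (Y (inj₂ e))) >>= λ Y? →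
    return (build X? Y?)
    where
    build : (∀ e → Dec (X (inj₂ e))) → (∀ e → Dec (Y (inj₂ e))) → AdjCycle k
    build X?' Y?' = go (SA.z Fin.≟ SB.z)
      where
      X? : ∀ v → Dec (X v)
      X? (inj₁ v) = v ∈? (A.x ∷ SA.bs)
      X? (inj₂ e) = X?' e
      Y? : ∀ v → Dec (Y v)
      Y? (inj₁ v) = v ∈? (B.x ∷ SB.bs)
      Y? (inj₂ e) = Y?' e
      X∩Y : ∀ {v} → X v → Y v → v ≡ inj₁ SA.z × v ≡ inj₁ SB.z × q₁ ≡ q₂
      X∩Y {inj₁ v} p q with apart (A-block p) (B-block q)
      ... | e₁ , e₂ = cong inj₁ (q₁-in-block p e₁) , cong inj₁ (q₂-in-block q e₂) , trans (sym e₁) e₂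
      X∩Y {inj₂ e} (u , v , u∈ , v∈ , o) (u' , v' , u'∈ , v'∈ , o') =
        ⊥-elim (no-common-edge (A-block u∈) (A-block v∈) o (B-block u'∈) (B-block v'∈) o')
      go : Dec (SA.z ≡ SB.z) → AdjCycle k
      go (no z≢q) =
        let c , zs , w , u , le = Linking.cycle-apart _≟ⁿ_ Adj Adj-sym (λ _ → ⊤) (λ z _ _ → connected z)
                X Y X? Y? (λ _ → tt) (λ _ → tt) vertices
              (λ p q → case X∩Y p q of λ { (e₁ , e₂ , _) → z≢q (inj₁-injective (trans (sym e₁) e₂)) })
              z-block q-block (here refl) (x≢z ∘ inj₁-injective) (here refl) (y≢q ∘ inj₁-injective)
              (E₁.walk ⊕ road ⊕ E₂.walk) uts ts-X ts-Y (λ _ → tt) reach-X reach-Y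
        in c , zs , w , u , ≤-trans k≤apart (≤-trans arms≤ le)
      go (yes eq) =
        let c , zs , w , u , le = Linking.cycle-sharing _≟ⁿ_ Adj Adj-sym (λ _ → ⊤) (λ z _ _ → connected z)
                X Y X? Y? (λ _ → tt) (λ _ → tt) vertices
              (λ p q → proj₁ (X∩Y p q)) z-block Yz (here refl) (x≢z ∘ inj₁-injective) (here refl)
              (λ e → y≢q (trans (inj₁-injective e) eq))
              reach-X (subst (λ p → ReachesAll Adj vertices Y (inj₁ p) (suc (length B.ns))) (sym eq) reach-Y)
        in c , zs , w , u , s≤s⁻¹ (≤-trans (k≤shared (proj₂ (proj₂ (X∩Y {inj₁ SA.z} z-block Yz)))) (≤-trans arms≤ le))
        where
        Yz : Y (inj₁ SA.z)
        Yz = subst (_∈ B.x ∷ SB.bs) (sym eq) q-block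

-- From cycles of the incidence graph to Berge cycles

lookup-injective : {A B : Set} (f : A → B) (L : List A) → Unique (map f L) → ∀ i j → f (lookup L i) ≡ f (lookup L j) → i ≡ j
lookup-injective f (x ∷ L) u zero zero eq = refl
lookup-injective f (x ∷ L) u zero (suc j) eq = ⊥-elim (uniq-head u (subst (_∈ map f L) (sym eq) (∈-map⁺ f (∈-lookup {xs = L} j))))
lookup-injective f (x ∷ L) u (suc i) zero eq = ⊥-elim (uniq-head u (subst (_∈ map f L) eq (∈-map⁺ f (∈-lookup {xs = L} i))))
lookup-injective f (x ∷ L) u (suc i) (suc j) eq = cong suc (lookup-injective f L (uniq-tail u) i j eq)

module _ {n m : ℕ} (E : Fin m → Subset n) where

  open Incidence E

  private
    data Chain : Fin n → List (Fin n × Fin m) → Fin n → Set where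
      []   : ∀ {a} → Chain a [] a
      step : ∀ {a c b e L} → a ∈ₛ E e → c ∈ₛ E e → Chain c L b → Chain a ((a , e) ∷ L) b

    decode : ∀ {a zs b} → Walk Adj (inj₁ a) zs (inj₁ b) → ∃ λ L → Chain a L b ×
      ∃ λ ts → zs ↭ map inj₁ ts ++ map inj₂ (map proj₂ L) × map proj₁ L ++ [ b ] ≡ a ∷ ts
    decode [] = [] , [] , [] , Perm.refl , refl
    decode (_∷_ {z = inj₁ _} () _)
    decode (_∷_ {z = inj₂ _} p (_∷_ {z = inj₂ _} () _))
    decode {a} (_∷_ {z = inj₂ e} p (_∷_ {z = inj₁ c} q w)) with decode w
    ... | L , ch , ts , perm , eq = (a , e) ∷ L , step p q ch , c ∷ ts ,
      Perm.trans (swap (inj₂ e) (inj₁ c) perm)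
        (prep (inj₁ c) (↭-sym (shift (inj₂ e) (map inj₁ ts) (map inj₂ (map proj₂ L))))) ,
      cong (a ∷_) eq

    here-edge : ∀ {a L b} → Chain a L b → ∀ i → proj₁ (lookup L i) ∈ₛ E (proj₂ (lookup L i))
    here-edge (step p q ch) zero = p
    here-edge (step p q ch) (suc i) = here-edge ch i

    chain-head : ∀ {a x L b} → Chain a (x ∷ L) b → a ≡ proj₁ x
    chain-head (step _ _ _) = refl

    next-edge : ∀ {a L b} → Chain a L b → ∀ i j → toℕ j ≡ suc (toℕ i) → proj₁ (lookup L j) ∈ₛ E (proj₂ (lookup L i))
    next-edge (step p q (step _ _ _)) zero (suc zero) eq = q
    next-edge (step p q ch) (suc i) (suc j) eq = next-edge ch i j (suc-injective eq)

    last-edge : ∀ {a L b} → Chain a L b → ∀ i → suc (toℕ i) ≡ length L → b ∈ₛ E (proj₂ (lookup L i))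
    last-edge (step p q []) zero eq = q
    last-edge (step p q ch) (suc i) eq = last-edge ch i (suc-injective eq)

  BergeIn : ℕ → Set
  BergeIn ℓ = Σ (Fin ℓ → Fin n) λ v → Σ (Fin ℓ → Fin m) λ f →
    Injective _≡_ _≡_ v × Injective _≡_ _≡_ f × (∀ i → (v i ∈ₛ E (f i)) × (v (next i) ∈ₛ E (f i)))

  vertexCycle⇒berge : ∀ {k a zs} → 1 ≤ k → Walk Adj (inj₁ a) zs (inj₁ a) → Unique zs → k ≤ total vertices zs →
    ∃ λ ℓ → k ≤ ℓ × BergeIn ℓ
  vertexCycle⇒berge {k} {a} {zs} 1≤k w u le with decode w
  ... | L , ch , ts , perm , eq = go L ch eq perm
    where
    tot : ∀ ts (es : List (Fin m)) → total vertices (map inj₁ ts ++ map inj₂ es) ≡ length ts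
    tot [] [] = refl
    tot [] (_ ∷ es) = tot [] es
    tot (_ ∷ ts) es = cong suc (tot ts es)
    go : ∀ L → Chain a L a → map proj₁ L ++ [ a ] ≡ a ∷ ts → zs ↭ map inj₁ ts ++ map inj₂ (map proj₂ L) →
      ∃ λ ℓ → k ≤ ℓ × BergeIn ℓ
    go L ch eq perm = finish L ch k≤L u-V u-E
      where
      parts = uniq-++⁻ (map inj₁ ts) (uniq-↭ perm u)
      -- The closed walk lists its start last, so `ts` is the vertex list of `L` rotated by one
      -- place.
      ts↭ : ts ↭ map proj₁ L
      ts↭ = drop-∷ (Perm.trans (Perm.↭-reflexive (sym eq)) (↭-sym (∷↭∷ʳ a (map proj₁ L))))
      u-V : Unique (map proj₁ L)
      u-V = uniq-↭ ts↭ (Uniq.map⁻ (proj₁ parts))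
      u-E : Unique (map proj₂ L)
      u-E = Uniq.map⁻ (proj₁ (proj₂ parts))
      k≤L : k ≤ length L
      k≤L = ≤-trans le (≤-reflexive (trans (total-↭ vertices perm) (trans (tot ts (map proj₂ L))
        (trans (↭-length ts↭) (List.length-map proj₁ L)))))
      finish : ∀ L → Chain a L a → k ≤ length L → Unique (map proj₁ L) → Unique (map proj₂ L) → ∃ λ ℓ → k ≤ ℓ × BergeIn ℓ
      finish [] ch le _ _ = ⊥-elim (<⇒≱ 1≤k le)
      finish L@(x ∷ L') ch le uV uE = suc (length L') , le , proj₁ ∘ lookup L , proj₂ ∘ lookup L ,
        lookup-injective proj₁ L uV _ _ , lookup-injective proj₂ L uE _ _ ,
        λ i → here-edge ch i , incident i
        where
        incident : ∀ i → proj₁ (lookup L (next i)) ∈ₛ E (proj₂ (lookup L i))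
        incident i with suc (toℕ i) <? suc (length L')
        ... | yes lt = next-edge ch i (next i)
          (trans (Fin.toℕ-fromℕ< (m%n<n (suc (toℕ i)) (suc (length L')))) (m<n⇒m%n≡m lt))
        ... | no ≮ = subst (λ v → v ∈ₛ E (proj₂ (lookup L i)))
          (trans (chain-head ch) (cong (λ j → proj₁ (lookup L j)) (sym next≡0)))
          (last-edge ch i last)
          where
          last : suc (toℕ i) ≡ suc (length L')
          last = ≤-antisym (Fin.toℕ<n i) (s≤s⁻¹ (≰⇒> ≮))
          next≡0 : next i ≡ zero
          next≡0 = Fin.toℕ-injective (trans (Fin.toℕ-fromℕ< (m%n<n (suc (toℕ i)) (suc (length L'))))
            (trans (cong (_% suc (length L')) last) (n%n≡0 (suc (length L')))))

  adjCycle⇒berge : ∀ {k} → 1 ≤ k → AdjCycle k → ∃ λ ℓ → k ≤ ℓ × BergeIn ℓ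
  adjCycle⇒berge 1≤k (inj₂ e , [] , w , u , le) = ⊥-elim (<⇒≱ 1≤k le)
  adjCycle⇒berge 1≤k (inj₂ e , inj₂ _ ∷ zs , () ∷ _ , u , le)
  -- A cycle based at a hyperedge is rotated by one node, so that it is based at a vertex.
  adjCycle⇒berge 1≤k (inj₂ e , inj₁ v ∷ zs , p ∷ w , u , le) =
    vertexCycle⇒berge 1≤k (w ⊕ (p ∷ [])) (uniq-↭ (∷↭∷ʳ (inj₁ v) zs) u)
      (≤-trans le (≤-reflexive (total-↭ vertices (∷↭∷ʳ (inj₁ v) zs))))
  adjCycle⇒berge 1≤k (inj₁ a , zs , w , u , le) = vertexCycle⇒berge 1≤k w u le

-- Dense parts of the owner graph that are not 2-connected

last-step : {A : Set} {R : A → A → Set} → ∀ {x z zs y} → Walk R x (z ∷ zs) y →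
  ∃₂ λ ps c → z ∷ zs ≡ ps ++ [ y ] × Walk R x ps c × R c y
last-step (r ∷ []) = [] , _ , refl , [] , r
last-step {z = z} (r ∷ w@(_ ∷ _)) with last-step w
... | ps , c , eq , w' , r' = z ∷ ps , c , cong (z ∷_) eq , r ∷ w' , r'

pick : {A : Set} (_≟_ : (x y : A) → Dec (x ≡ y)) {ns : List A} → Unique ns → 3 ≤ length ns → ∀ b c →
  ∃ λ u → u ∈ ns × u ≢ b × u ≢ c
pick _≟_ {ns} un le b c with Any.any? (λ u → ¬? (u ∈? (b ∷ c ∷ []))) ns
  where open import Data.List.Membership.DecPropositional _≟_ using (_∈?_)
... | yes h = let u , u∈ , u∉ = find h in u , u∈ , (λ eq → u∉ (here eq)) , (λ eq → u∉ (there (here eq)))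
... | no none = ⊥-elim (<⇒≱ le (uniq-⊆-length un (λ {v} p → case v ∈? (b ∷ c ∷ []) of λ
      { (yes q) → q ; (no q) → ⊥-elim (none (lose p q)) })))
  where open import Data.List.Membership.DecPropositional _≟_ using (_∈?_)

module Dense {n m : ℕ} (E : Fin m → Subset n) (connected : Incidence.Connectivity E)
  (O : Fin n → Fin n → Fin m → Set) (owners : Incidence.Owners E O) (t' : ℕ) (3≤t : 3 ≤ suc t')
  (Vs : List (Fin n)) (O-in : ∀ {u v e} → O u v e → u ∈ Vs)
  (V-deg : ∀ {v} → v ∈ Vs → ∃ λ ns → Unique ns × suc t' ≤ length ns × (∀ {u} → u ∈ ns → ∃ λ e → O v u e)) where

  open Incidence E
  open Owned O owners
  open import Data.List.Membership.DecPropositional (Fin._≟_ {n}) using (_∈?_)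

  Avoiding : Fin n → Fin n → Fin n → Set
  Avoiding z s v = ∃ λ us → Walk Γ s us v × z ∉ s ∷ us

  avoiding-trans : ∀ {z a b c} → Avoiding z a b → Avoiding z b c → Avoiding z a c
  avoiding-trans (us , w , z∉) (vs , w' , z∉') = us ++ vs , w ⊕ w' ,
    λ p → case ∈-++⁻ (_ ∷ us) p of λ { (inj₁ h) → z∉ h ; (inj₂ h) → z∉' (there h) }

  avoiding-sym : ∀ {z a b} → Avoiding z a b → Avoiding z b a
  avoiding-sym (us , w , z∉) with rev Γ-sym w
  ... | vs , w' , perm = vs , w' , z∉ ∘ ∈-resp-↭ (↭-sym perm)

  SideArm : ℕ → Fin n → Fin n → Set
  SideArm d z s = Σ (Arm z (suc d)) λ A → ∀ {v} → v ∈ Arm.nodes A → v ≢ z → Avoiding z s v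

  -- Take a longest path from `z` whose other end lies in `Ts` and on the side of `s`. A neighbour
  -- of that end in `Ts` off the path differs from `z`, hence lies on the same side and would
  -- prolong the path.
  side-arm : ∀ {d z s zs} Ts →
    (∀ {v} → v ∈ Ts → ∃ λ ns → Unique ns × suc d ≤ length ns × (∀ {u} → u ∈ ns → Γ v u × u ∈ Ts)) →
    s ∈ Ts → s ≢ z → Walk Γ z zs s →
    ¬ ¬ SideArm d z s
  side-arm {d} {z} {s} {zs} Ts deg s∈ s≢z w₀ = ¬¬-max Path n bounded (length (proj₁ s₀) , path₀) >>= build
    where
    Path : ℕ → Set
    Path l = ∃₂ λ x xs → Walk Γ z xs x × Unique (z ∷ xs) × x ∈ Ts × Avoiding z s x × length xs ≡ l
    bounded : ∀ l → Path l → l ≤ n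
    bounded l (x , xs , w , u , _ , _ , refl) = ≤-trans (n≤1+n _) (uniq-length u)
    s₀ = simplify Fin._≟_ w₀
    path₀ : Path (length (proj₁ s₀))
    path₀ = s , proj₁ s₀ , proj₁ (proj₂ s₀) , proj₁ (proj₂ (proj₂ s₀)) , s∈ ,
      ([] , [] , λ { (here eq) → s≢z (sym eq) }) , refl
    build : _ → ¬ ¬ SideArm d z s
    build (l , (x , xs , w , u , x∈ , av , refl) , mx) with deg x∈ | rev Γ-sym w
    ... | ns , un , ln , ns-ok | xr , wr , perm = return {SideArm d z s}
      (arm xr wr (uniq-↭ perm u) ns un (proj₁ ∘ ns-ok)
        (λ {v} p → case ∈-resp-↭ perm (on-path p) of λ
          { (here refl) → ⊥-elim (Γ-irr (proj₁ (ns-ok p))) ; (there h) → h }) ln ,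
       (λ p v≢z → avoids (∈-resp-↭ (↭-sym perm) p) v≢z))
      where
      on-path : ns ⊆ z ∷ xs
      on-path {v} p with v ∈? (z ∷ xs)
      ... | yes h = h
      ... | no v∉ = ⊥-elim (<-irrefl refl (≤-trans (≤-reflexive (↭-length (∷↭∷ʳ v xs)))
            (mx _ (v , xs ++ [ v ] , w ⊕ (proj₁ (ns-ok p) ∷ []) , uniq-↭ (∷↭∷ʳ v (z ∷ xs)) (uniq-∷ v∉ u) , proj₂ (ns-ok p) ,
              avoiding-trans av ([ v ] , proj₁ (ns-ok p) ∷ [] ,
                λ { (here refl) → proj₂ (proj₂ av) (end∈ (proj₁ (proj₂ av))) ; (there (here refl)) → v∉ (here refl) }) , refl))))
      avoids : ∀ {v} → v ∈ z ∷ xs → v ≢ z → Avoiding z s v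
      avoids (here refl) v≢z = ⊥-elim (v≢z refl)
      avoids (there p) v≢z with ∈-∃++ p
      ... | as , bs , refl = avoiding-trans av (avoiding-sym (bs , proj₂ (cut as w) , λ h → uniq-head u (∈-++⁺ʳ as h)))

  -- The arms from the two sides meet only in `z`. With t = `suc t'`, their blocks offer t + 2 and t
  -- + 1 vertices, and sharing `z` costs one: 2t + 2 remain. The surplus degree in `Ws` pays for the
  -- shared vertex.
  cut-vertex⇒cycle : ∀ {z w y} Ws →
    (∀ {v} → v ∈ Ws → ∃ λ ns → Unique ns × suc (suc t') ≤ length ns × (∀ {u} → u ∈ ns → Γ v u × u ∈ Ws)) →
    w ∈ Ws → y ∈ Vs → w ≢ z → y ≢ z → (∃ λ us → Walk Γ z us w) → (∃ λ us → Walk Γ z us y) →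
    ¬ Avoiding z w y → ¬ ¬ AdjCycle (suc (suc t') + suc (suc t'))
  cut-vertex⇒cycle {z} Ws W-deg w∈ y∈ w≢z y≢z (_ , wz) (_ , yz) sep =
    side-arm Ws W-deg w∈ w≢z wz >>= λ { (A , A-side) →
    side-arm Vs V-deg' y∈ y≢z yz >>= λ { (B , B-side) →
    TwoArms.cycle E connected O owners {s₁ = suc t'} {s₂ = t'} (≤-trans 3≤t (n≤1+n _)) 3≤t A B
      (λ {v} p q → case v Fin.≟ z of λ
        { (yes eq) → eq , eq
        ; (no ne) → ⊥-elim (sep (avoiding-trans (A-side p ne) (avoiding-sym (B-side q ne)))) })
      [] [] ([] ∷ []) (λ ()) (λ ()) (λ ()) (n≤1+n _) (λ _ → ≤-refl) } }
    where
    V-deg' : ∀ {v} → v ∈ Vs → ∃ λ ns → Unique ns × suc t' ≤ length ns × (∀ {u} → u ∈ ns → Γ v u × u ∈ Vs)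
    V-deg' v∈ with V-deg v∈
    ... | ns , un , ln , ok = ns , un , ln , λ p → ok p , O-in (O-sym (proj₂ (ok p)))

  Restricted : (Fin m → Set) → Fin n → Fin n → Fin m → Set
  Restricted P u v e = O u v e × P e

  restricted : ∀ P → Owners (Restricted P)
  restricted P = record
    { O-sym = λ { (o , p) → O-sym o , p } ; O-inc = O-inc ∘ proj₁ ; O-irr = O-irr ∘ proj₁
    ; O-inj = λ { (o , _) (o' , _) → O-inj o o' } }

  module EndOf (C : Fin n → Set) (C-closed : ∀ {a b} → Γ a b → C a → C b) (C⊆ : ∀ {a} → C a → a ∈ Vs)
    (f : Fin m) {q₀ : Fin n} (q₀∈ : q₀ ∈ₛ E f) (Cq₀ : C q₀) where

    module Rf = Owned (Restricted (_≢ f)) (restricted (_≢ f))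

    -- The road between the components will use `f`, so the arm must do without it. Without `f` its
    -- two owners lose a neighbour each, so the arm should start at a vertex that does not own `f`
    -- in order to keep its full degree.
    Good : Set
    Good = ∃ λ q → q ∈ₛ E f × C q × Σ (Rf.Arm q (suc t')) λ A → ∀ {v} → v ∈ Rf.Arm.nodes A → C v

    private
      Γ-weaken : ∀ {a b} → Rf.Γ a b → Γ a b
      Γ-weaken (e , o , _) = e , o

      keep : ∀ {a b v} → O a b f → v ≢ b → Γ a v → Rf.Γ a v
      keep o v≢b (e , o') = e , o' , λ { refl → case O-inj o' o of λ
        { (inj₁ (_ , eq)) → v≢b eq ; (inj₂ (refl , refl)) → O-irr o } }

      C-walk : ∀ {a as b} → C a → Walk Rf.Γ a as b → ∀ {v} → v ∈ a ∷ as → C v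
      C-walk Ca w (here refl) = Ca
      C-walk Ca (r ∷ w) (there p) = C-walk (C-closed (Γ-weaken r) Ca) w p

      module From (q : Fin n) (q∈ : q ∈ₛ E f) (Cq : C q) where

        Path : ℕ → Set
        Path l = ∃₂ λ x xs → Walk Rf.Γ q xs x × Unique (q ∷ xs) × length xs ≡ l

        bounded : ∀ l → Path l → l ≤ n
        bounded l (x , xs , w , u , refl) = ≤-trans (n≤1+n _) (uniq-length u)

        module _ {x xs} (w : Walk Rf.Γ q xs x) (u : Unique (q ∷ xs)) (mx : ∀ l → Path l → l ≤ length xs) where

          on-path : ∀ {v} → Rf.Γ x v → v ∈ q ∷ xs
          on-path {v} r with v ∈? (q ∷ xs)
          ... | yes h = h
          ... | no v∉ = ⊥-elim (<-irrefl refl (≤-trans (≤-reflexive (↭-length (∷↭∷ʳ v xs)))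
                (mx _ (v , xs ++ [ v ] , w ⊕ (r ∷ []) , uniq-↭ (∷↭∷ʳ v (q ∷ xs)) (uniq-∷ v∉ u) , refl))))

          good-end : (∀ {o} → ¬ O x o f) → Good
          good-end ¬Of with V-deg (C⊆ (C-walk Cq w (end∈ w))) | rev Rf.Γ-sym w
          ... | ns , un , ln , ok | xr , wr , perm = q , q∈ , Cq ,
            Rf.arm xr wr (uniq-↭ perm u) ns un adj
              (λ p → case ∈-resp-↭ perm (on-path (adj p)) of λ
                { (here refl) → ⊥-elim (Γ-irr (ok p)) ; (there h) → h }) ln ,
            (λ p → C-walk Cq w (∈-resp-↭ (↭-sym perm) p))
            where
            adj : ∀ {v} → v ∈ ns → Rf.Γ _ v
            adj p with ok p
            ... | e , o = e , o , λ { refl → ¬Of o }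

      -- If the path from q to x ends at the other owner x of f, rotate it at a further neighbour of x.
      rotate : ∀ {q x xs} (q∈ : q ∈ₛ E f) (Cq : C q) → O q x f → (w : Walk Rf.Γ q xs x) → Unique (q ∷ xs) →
        (∀ l → From.Path q q∈ Cq l → l ≤ length xs) → Good
      rotate q∈ Cq Oqx [] u mx = ⊥-elim (O-irr Oqx)
      rotate {q} {x} {z ∷ zs} q∈ Cq Oqx w u mx with last-step w
      ... | ps , c , eq , wc , rc with V-deg (C⊆ (C-walk Cq w (end∈ w)))
      ... | ns , un , ln , ok with pick Fin._≟_ un (≤-trans 3≤t ln) q c
      ... | v , v∈ns , v≢q , v≢c with From.on-path q q∈ Cq w u mx (keep (O-sym Oqx) v≢q (ok v∈ns))
      ... | here v≡q = ⊥-elim (v≢q v≡q)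
      ... | there v∈ with ∈-++⁻ ps (subst (v ∈_) eq v∈)
      ... | inj₂ (here refl) = ⊥-elim (Γ-irr (ok v∈ns))
      ... | inj₁ v∈ps with ∈-∃++ v∈ps
      ... | as , [] , refl = ⊥-elim (v≢c (end-unique (proj₂ (cut as wc))))
        where
        end-unique : ∀ {v c} → Walk Rf.Γ v [] c → v ≡ c
        end-unique [] = refl
      ... | as , d ∷ cs , refl with cut as wc
      ... | w₁ , (_ ∷ w₂) with rev Rf.Γ-sym w₂
      ... | cr , wr , perm = From.good-end q q∈ Cq new (uniq-↭ (prep q perm') u)
              (λ l P → ≤-trans (mx l P) (≤-reflexive (↭-length perm')))
              (λ {o} Od → case O-inj Od Oqx of λ
                { (inj₁ (refl , _)) → uniq-head u' (∈-++⁺ˡ (∈-++⁺ʳ as (there (here refl))))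
                ; (inj₂ (refl , _)) → proj₂ (proj₂ (uniq-++⁻ (as ++ v ∷ d ∷ cs) (uniq-tail u')))
                    (∈-++⁺ʳ as (there (here refl))) (here refl) })
        where
        u' : Unique (q ∷ (as ++ v ∷ d ∷ cs) ++ [ x ])
        u' = subst (λ l → Unique (q ∷ l)) eq u
        new : Walk Rf.Γ q ((as ++ [ v ]) ++ x ∷ c ∷ cr) d
        new = w₁ ⊕ (Rf.Γ-sym (keep (O-sym Oqx) v≢q (ok v∈ns)) ∷ Rf.Γ-sym rc ∷ wr)
        perm' : z ∷ zs ↭ (as ++ [ v ]) ++ x ∷ c ∷ cr
        perm' = Perm.trans (Perm.↭-reflexive eq) (Perm.trans (Perm.↭-reflexive
          (trans (List.++-assoc as (v ∷ d ∷ cs) [ x ]) (sym (List.++-assoc as [ v ] (d ∷ cs ++ [ x ])))))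
          (++⁺ˡ (as ++ [ v ]) (Perm.trans (↭-sym (∷↭∷ʳ x (d ∷ cs))) (prep x perm))))

    good : ¬ ¬ Good
    good = em (∃₂ λ a b → O a b f × C a) >>= λ
      { (no none) → ¬¬-max (From.Path q₀ q₀∈ Cq₀) n (From.bounded q₀ q₀∈ Cq₀) (0 , q₀ , [] , [] , [] ∷ [] , refl) >>= λ
          { (l , (x , xs , w , u , refl) , mx) →
              return (From.good-end q₀ q₀∈ Cq₀ w u mx (λ o → none (_ , _ , o , C-walk Cq₀ w (end∈ w)))) }
      ; (yes (a , b , o , Ca)) →
          ¬¬-max (From.Path a (O-inc o) Ca) n (From.bounded a (O-inc o) Ca) (0 , a , [] , [] , [] ∷ [] , refl) >>= λ
          { (l , (x , xs , w , u , refl) , mx) → em (∃ λ o' → O x o' f) >>= λ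
            { (no none) → return (From.good-end a (O-inc o) Ca w u mx (λ o' → none (_ , o')))
            ; (yes (o' , Oxo')) → return (finish o Ca w u mx Oxo') } } }
      where
      stuck : ∀ {a b xs} (o : O a b f) (Ca : C a) (w : Walk Rf.Γ a xs a) → Unique (a ∷ xs) →
        (∀ l → From.Path a (O-inc o) Ca l → l ≤ length xs) → Good
      stuck o Ca (_ ∷ w) u mx = ⊥-elim (uniq-head u (end∈ w))
      -- A path without edges is not longest: `a` keeps a neighbour other than `b` when `f` is
      -- dropped.
      stuck {a} {b} o Ca [] u mx with V-deg (C⊆ Ca)
      ... | ns , un , ln , ok with pick Fin._≟_ un (≤-trans 3≤t ln) b b
      ... | v , v∈ , v≢b , _ with From.on-path a (O-inc o) Ca [] u mx (keep o v≢b (ok v∈))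
      ... | here refl = ⊥-elim (Γ-irr (ok v∈))
      finish : ∀ {a b x xs o'} (o : O a b f) (Ca : C a) (w : Walk Rf.Γ a xs x) → Unique (a ∷ xs) →
        (∀ l → From.Path a (O-inc o) Ca l → l ≤ length xs) → O x o' f → Good
      finish o Ca w u mx Oxo' with O-inj Oxo' o
      ... | inj₁ (refl , refl) = stuck o Ca w u mx
      ... | inj₂ (refl , refl) = rotate (O-inc o) Ca o w u mx

  -- `Q` is the component of `u` and `T` the rest of `Vs`. A path from `u` to `v` in the incidence
  -- graph is cut down to the part from the last hyperedge `f` meeting `Q` to the first one `g` from
  -- there on meeting `T`, where `f` and `g` may coincide. Nothing else on this road touches the
  -- component behind its end, so arms that avoid `f` in `Q` and `g` in `T` are compatible with it.
  two-components⇒cycle : ∀ {u v} → u ∈ Vs → v ∈ Vs → ¬ (∃ λ us → Walk Γ u us v) →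
    ¬ ¬ AdjCycle (suc (suc t') + suc (suc t'))
  two-components⇒cycle {u} {v} u∈ v∈ ¬uv = ¬¬-∀Fin (λ a → em (Q a)) >>= λ Q? →
    ¬¬-∀Fin (λ e → em (touches Q (inj₂ e))) >>= λ QE? → ¬¬-∀Fin (λ a → em (T a)) >>= λ T? →
    ¬¬-∀Fin (λ e → em (touches T (inj₂ e))) >>= λ TE? →
    build (λ { (inj₁ a) → Q? a ; (inj₂ e) → QE? e }) (λ { (inj₁ a) → T? a ; (inj₂ e) → TE? e })
    where
    Q T : Fin n → Set
    Q a = ∃ λ us → Walk Γ u us a
    T a = a ∈ Vs × ¬ Q a

    touches : (Fin n → Set) → Node → Set
    touches P (inj₁ a) = P a
    touches P (inj₂ e) = ∃ λ a → a ∈ₛ E e × P a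

    Q-closed : ∀ {a b} → Γ a b → Q a → Q b
    Q-closed r (us , w) = _ , w ⊕ (r ∷ [])
    T-closed : ∀ {a b} → Γ a b → T a → T b
    T-closed r (a∈ , ¬Qa) = O-in (O-sym (proj₂ r)) , λ Qb → ¬Qa (Q-closed (Γ-sym r) Qb)
    Q⊆ : ∀ {a} → Q a → a ∈ Vs
    Q⊆ (us , w) = walk-in (λ r → O-in (O-sym (proj₂ r))) u∈ w (end∈ w)

    AdjCycle₂ : Set
    AdjCycle₂ = AdjCycle (suc (suc t') + suc (suc t'))

    module Road {f g : Fin m} {ss : List Node} (w : Walk Adj (inj₂ f) ss (inj₂ g)) (uss : Unique (inj₂ f ∷ ss))
      (no-Q : ∀ {x} → x ∈ ss → ¬ touches Q x) (only-T : ∀ {x} → x ∈ inj₂ f ∷ ss → touches T x → x ≡ inj₂ g)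
      (fQ : touches Q (inj₂ f)) (gT : touches T (inj₂ g)) where

      module Q-end = EndOf Q Q-closed Q⊆ f (proj₁ (proj₂ fQ)) (proj₂ (proj₂ fQ))
      module T-end = EndOf T T-closed proj₁ g (proj₁ (proj₂ gT)) (proj₂ (proj₂ gT))

      Off-road : Fin m → Set
      Off-road e = inj₂ e ∉ inj₂ f ∷ ss

      module R = Owned (Restricted Off-road) (restricted Off-road)

      Q-off : ∀ {a b} → Q a → Q-end.Rf.Γ a b → R.Γ a b
      Q-off Qa (e , o , e≢f) = e , o , λ { (here refl) → e≢f refl ; (there p) → no-Q p (_ , O-inc o , Qa) }

      T-off : ∀ {a b} → T a → T-end.Rf.Γ a b → R.Γ a b
      T-off Ta (e , o , e≢g) = e , o , λ p → e≢g (inj₂-injective (only-T p (_ , O-inc o , Ta)))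

      Q-arm : ∀ {q s} (A : Q-end.Rf.Arm q s) → (∀ {v} → v ∈ Q-end.Rf.Arm.nodes A → Q v) → R.Arm q s
      Q-arm (Owned.arm xs w u ns un adj sub le) C =
        R.arm xs (walk-map (λ p _ → Q-off (C p)) w) u ns un (λ p → Q-off (C (here refl)) (adj p)) sub le

      T-arm : ∀ {q s} (A : T-end.Rf.Arm q s) → (∀ {v} → v ∈ T-end.Rf.Arm.nodes A → T v) → R.Arm q s
      T-arm (Owned.arm xs w u ns un adj sub le) C =
        R.arm xs (walk-map (λ p _ → T-off (C p)) w) u ns un (λ p → T-off (C (here refl)) (adj p)) sub le

      clash : ∀ {a} → Q a → T a → ⊥
      clash Qa (_ , ¬Qa) = ¬Qa Qa

      cycle : ¬ ¬ AdjCycle₂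
      cycle = Q-end.good >>= λ { (q₁ , q₁∈ , Qq₁ , A , QA) → T-end.good >>= λ { (q₂ , q₂∈ , Tq₂ , B , TB) →
        TwoArms.cycle E connected (Restricted Off-road) (restricted Off-road) {s₁ = t'} {s₂ = t'} 3≤t 3≤t (Q-arm A QA) (T-arm B TB)
          (λ p q → ⊥-elim (clash (QA p) (TB q)))
          (inj₂ f ∷ ss ++ [ inj₁ q₂ ]) (q₁∈ ∷ (w ⊕ (q₂∈ ∷ [])))
          (uniq-∷ (λ { (there p) → case ∈-++⁻ ss p of λ
                { (inj₁ h) → no-Q h Qq₁ ; (inj₂ (here refl)) → clash Qq₁ Tq₂ } })
            (uniq-++ uss ([] ∷ []) (λ { p (here refl) → case only-T p Tq₂ of λ () })))
          (λ { p (o , off) → case ∈-++⁻ (inj₂ f ∷ ss) p of λ { (inj₁ h) → off h ; (inj₂ (here ())) } })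
          (λ p v∈A → case ∈-++⁻ (inj₂ f ∷ ss) p of λ
            { (inj₁ (there h)) → ⊥-elim (no-Q h (QA v∈A)) ; (inj₂ (here refl)) → ⊥-elim (clash (QA v∈A) Tq₂) })
          (λ p v∈B → case ∈-++⁻ (inj₂ f ∷ ss) p of λ
            { (inj₁ h) → case only-T h (TB v∈B) of λ () ; (inj₂ (here refl)) → refl })
          ≤-refl (λ { refl → ⊥-elim (clash Qq₁ Tq₂) }) } }

    build : (∀ x → Dec (touches Q x)) → (∀ x → Dec (touches T x)) → ¬ ¬ AdjCycle₂
    build TQ? TT? with V-deg u∈
    ... | ns , un , ln , ok with pick Fin._≟_ un (≤-trans 3≤t ln) u u
    -- Any path from `u` to `v` will do; `connected` asks for a node to avoid, and a neighbour `c`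
    -- of `u` differs from both.
    ... | c , c∈ , c≢u , _ with connected {inj₁ u} {inj₁ v} (inj₁ c) (c≢u ∘ sym ∘ inj₁-injective)
                                  (λ { refl → ¬uv (_ , ok c∈ ∷ []) })
    ... | xs₀ , w₀ , _ with simplify _≟ⁿ_ w₀
    ... | xs , w , uxs , _ with last-hit TQ? w
    ... | inj₁ none = ⊥-elim (none (here refl) ([] , []))
    ... | inj₂ (inj₁ a , as , .[] , w₁ , Qa , [] , refl , none) = ⊥-elim (¬uv Qa)
    ... | inj₂ (inj₁ a , as , .(_ ∷ _) , w₁ , Qa , _∷_ {z = inj₂ e} p w₂ , refl , none) =
      ⊥-elim (none (here refl) (a , p , Qa))
    ... | inj₂ (inj₂ f , as , bs , w₁ , fQ , w₂ , refl , none) with first-hit TT? w₂ (v∈ , ¬uv)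
    ... | inj₁ b , z ∷ zs , w₃ , Tb , only , rest , refl = ⊥-elim (enters (last-step w₃))
      where
      enters : _ → ⊥
      enters (ps , inj₂ g , eq , w' , p)
        with only (subst (inj₂ g ∈_) (cong (inj₂ f ∷_) (sym eq)) (∈-++⁺ˡ (end∈ w'))) (b , p , Tb)
      ... | ()
    ... | inj₂ g , ss , w₃ , gT , only , rest , refl =
      Road.cycle w₃ (uniq-∷ f∉ (proj₁ (uniq-++⁻ ss (proj₁ (proj₂ (uniq-++⁻ as (uniq-tail uxs)))))))
        (none ∘ ∈-++⁺ˡ) only fQ gT
      where
      f∉ : inj₂ f ∉ ss
      f∉ p = none (∈-++⁺ˡ p) fQ

-- Red and blue hyperedges

record Matching {n m : ℕ} (E : Fin m → Subset n) (μ : List (Fin m × Fin n × Fin n)) : Set where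
  constructor matching
  field
    edges-uniq : Unique (map proj₁ μ)
    pairs-uniq : Unique (map proj₂ μ)
    inc        : ∀ {e a b} → (e , a , b) ∈ μ → a ∈ₛ E e × b ∈ₛ E e × a <ᶠ b

same-key : {A B : Set} {x : A} {y y' : B} {l : List (A × B)} → Unique (map proj₁ l) → (x , y) ∈ l → (x , y') ∈ l → y ≡ y'
same-key u (here refl) (here refl) = refl
same-key u (here refl) (there q) = ⊥-elim (uniq-head u (∈-map⁺ proj₁ q))
same-key u (there p) (here refl) = ⊥-elim (uniq-head u (∈-map⁺ proj₁ p))
same-key u (there p) (there q) = same-key (uniq-tail u) p q

same-value : {A B : Set} {x x' : A} {y : B} {l : List (A × B)} → Unique (map proj₂ l) → (x , y) ∈ l → (x' , y) ∈ l → x ≡ x'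
same-value u (here refl) (here refl) = refl
same-value u (here refl) (there q) = ⊥-elim (uniq-head u (∈-map⁺ proj₂ q))
same-value u (there p) (here refl) = ⊥-elim (uniq-head u (∈-map⁺ proj₂ p))
same-value u (there p) (there q) = same-value (uniq-tail u) p q

matching-↭ : ∀ {n m} {E : Fin m → Subset n} {μ ν} → μ ↭ ν → Matching E μ → Matching E ν
matching-↭ p (matching u v inc) = matching (uniq-↭ (↭-map⁺ proj₁ p) u) (uniq-↭ (↭-map⁺ proj₂ p) v)
  (inc ∘ ∈-resp-↭ (↭-sym p))

module Alternating {n m : ℕ} (E : Fin m → Subset n) where

  Alt : List (Fin m × Fin n × Fin n) → Fin m → Fin m → Set
  Alt μ g h = ∃₂ λ a b → a ∈ₛ E g × b ∈ₛ E g × a <ᶠ b × (h , a , b) ∈ μ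

  -- Exchange along an alternating path: each hyperedge takes over the pair of its successor, until
  -- `h` is free. No new pair gets matched, so a pair unmatched before is still available for `h`.
  shift-matching : ∀ {μ g gs h} → Matching E μ → g ∉ map proj₁ μ → Walk (Alt μ) g gs h → Unique (g ∷ gs) →
    ∃ λ ν → Matching E ν × length ν ≡ length μ × h ∉ map proj₁ ν × map proj₂ ν ⊆ map proj₂ μ
  shift-matching M g∉ [] u = _ , M , refl , g∉ , λ q → q
  shift-matching {μ} {g} {g₁ ∷ gs} M g∉ ((a , b , a∈ , b∈ , a<b , mem) ∷ w) u with ∈-∃++ mem
  ... | as , bs , refl with shift-matching M₁ g₁∉ (walk-map⁺ step w) (uniq-tail u)
    where
    μ₀ = as ++ bs
    M' = matching-↭ (shift (g₁ , a , b) as bs) M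
    M₁ : Matching E ((g , a , b) ∷ μ₀)
    M₁ = matching
      (uniq-∷ (λ p → g∉ (∈-resp-↭ (↭-map⁺ proj₁ (↭-sym (shift (g₁ , a , b) as bs))) (there p)))
        (uniq-tail (Matching.edges-uniq M')))
      (Matching.pairs-uniq M')
      (λ { (here refl) → a∈ , b∈ , a<b ; (there p) → Matching.inc M' (there p) })
    g₁∉ : g₁ ∉ map proj₁ ((g , a , b) ∷ μ₀)
    g₁∉ (here refl) = uniq-head u (here refl)
    g₁∉ (there p) = uniq-head (Matching.edges-uniq M') p
    step : ∀ {x y} → x ∈ g₁ ∷ gs → y ∈ gs → Alt (as ++ (g₁ , a , b) ∷ bs) x y → Alt ((g , a , b) ∷ μ₀) x y
    step _ y∈ (c , d , c∈ , d∈ , c<d , mem') with ∈-resp-↭ (shift (g₁ , a , b) as bs) mem'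
    ... | here refl = ⊥-elim (uniq-head (uniq-tail u) y∈)
    ... | there p = c , d , c∈ , d∈ , c<d , there p
  ... | ν , N , len , h∉ , sub = ν , N ,
    trans len (sym (↭-length (shift (g₁ , a , b) as bs))) , h∉ ,
    λ q → ∈-resp-↭ (↭-map⁺ proj₂ (↭-sym (shift (g₁ , a , b) as bs))) (sub q)

-- `blue-own` provides a blue owner, not just some owner. Thus neighbours of a vertex across pairs
-- of red hyperedges differ from its neighbours inside blue hyperedges, and their numbers may be
-- added.
record RedBlue {n m : ℕ} (E : Fin m → Subset n) : Set₁ where
  field
    Blue       : Fin m → Set
    Blue?      : ∀ j → Dec (Blue j)
    Own        : Fin n → Fin n → Fin m → Set
    owners     : Incidence.Owners E Own
    own-unique : ∀ {u v e e'} → Own u v e → Own u v e' → e ≡ e'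
    red-own    : ∀ {j} → ¬ Blue j → ∃₂ λ u v → Own u v j
    blue-own   : ∀ {j u v} → Blue j → u ∈ₛ E j → v ∈ₛ E j → u ≢ v → ∃ λ j' → Blue j' × Own u v j'

red-blue : ∀ {n m} (E : Fin m → Subset n) → (RedBlue E → ⊥) → ⊥
red-blue {n} {m} E κ = ¬¬-max Size m bounded (0 , [] , matching [] [] (λ ()) , refl) λ { (l , (μ , M , refl) , mx) →
  ¬¬-∀Fin (λ j → em (Blue μ j)) λ Blue? → κ (build μ M mx Blue?) }
  where
  open Alternating E
  Size : ℕ → Set
  Size l = ∃ λ μ → Matching E μ × length μ ≡ l
  bounded : ∀ l → Size l → l ≤ m
  bounded l (μ , M , refl) = ≤-trans (≤-reflexive (sym (List.length-map proj₁ μ)))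
    (uniq-length (Matching.edges-uniq M))
  Blue : List (Fin m × Fin n × Fin n) → Fin m → Set
  Blue μ h = ∃₂ λ g gs → g ∉ map proj₁ μ × Walk (Alt μ) g gs h
  module _ (μ : List (Fin m × Fin n × Fin n)) (M : Matching E μ) (mx : ∀ l → Size l → l ≤ length μ) where
    open Matching M
    open import Data.List.Membership.DecPropositional (×-≡-dec (Fin._≟_ {n}) (Fin._≟_ {n})) using (_∈?_)
    open import Data.List.Membership.DecPropositional (Fin._≟_ {m}) using () renaming (_∈?_ to _∈ᵉ?_)
    Own : Fin n → Fin n → Fin m → Set
    Own u v e = (e , u , v) ∈ μ ⊎ (e , v , u) ∈ μ
    owners : Incidence.Owners E Own
    owners = record
      { O-sym = λ { (inj₁ p) → inj₂ p ; (inj₂ p) → inj₁ p }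
      ; O-inc = λ { (inj₁ p) → proj₁ (inc p) ; (inj₂ p) → proj₁ (proj₂ (inc p)) }
      ; O-irr = λ { (inj₁ p) → Fin.<-irrefl refl (proj₂ (proj₂ (inc p))) ; (inj₂ p) → Fin.<-irrefl refl (proj₂ (proj₂ (inc p))) }
      ; O-inj = λ { (inj₁ p) (inj₁ q) → case same-key edges-uniq p q of λ { refl → inj₁ (refl , refl) }
                  ; (inj₁ p) (inj₂ q) → case same-key edges-uniq p q of λ { refl → inj₂ (refl , refl) }
                  ; (inj₂ p) (inj₁ q) → case same-key edges-uniq p q of λ { refl → inj₂ (refl , refl) }
                  ; (inj₂ p) (inj₂ q) → case same-key edges-uniq p q of λ { refl → inj₁ (refl , refl) } } }
    own-unique : ∀ {u v e e'} → Own u v e → Own u v e' → e ≡ e'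
    own-unique (inj₁ p) (inj₁ q) = same-value pairs-uniq p q
    own-unique (inj₂ p) (inj₂ q) = same-value pairs-uniq p q
    own-unique (inj₁ p) (inj₂ q) = ⊥-elim (Fin.<-asym (proj₂ (proj₂ (inc p))) (proj₂ (proj₂ (inc q))))
    own-unique (inj₂ p) (inj₁ q) = ⊥-elim (Fin.<-asym (proj₂ (proj₂ (inc p))) (proj₂ (proj₂ (inc q))))
    red-own : ∀ {j} → ¬ Blue μ j → ∃₂ λ u v → Own u v j
    red-own {j} ¬b with j ∈ᵉ? map proj₁ μ
    ... | no j∉ = ⊥-elim (¬b (j , [] , j∉ , []))
    ... | yes j∈ with ∈-map⁻ proj₁ j∈
    ... | (.j , u , v) , p , refl = u , v , inj₁ p
    -- If the pair is matched, its owner is one alternating step further and so is blue too. If not,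
    -- freeing `j` by `shift-matching` and matching it with this pair would enlarge a maximum
    -- matching.
    ordered : ∀ {j a b} → Blue μ j → a ∈ₛ E j → b ∈ₛ E j → a <ᶠ b → ∃ λ j' → Blue μ j' × (j' , a , b) ∈ μ
    ordered {j} {a} {b} (g , gs , g∉ , w) a∈ b∈ a<b with (a , b) ∈? map proj₂ μ
    ... | yes q with ∈-map⁻ proj₂ q
    ... | (j' , .(a , b)) , p , refl = j' , (g , gs ++ [ j' ] , g∉ , w ⊕ ((a , b , a∈ , b∈ , a<b , p) ∷ [])) , p
    ordered {j} {a} {b} (g , gs , g∉ , w) a∈ b∈ a<b | no q∉ with simplify Fin._≟_ w
    ... | gs' , w' , u , _ with shift-matching M g∉ w' u
    ... | ν , N , len , j∉ , sub = ⊥-elim (<-irrefl refl (≤-trans (≤-reflexive (cong suc (sym len)))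
      (mx _ ((j , a , b) ∷ ν , matching (uniq-∷ j∉ (Matching.edges-uniq N)) (uniq-∷ (q∉ ∘ sub) (Matching.pairs-uniq N))
        (λ { (here refl) → a∈ , b∈ , a<b ; (there p) → Matching.inc N p }) , refl))))
    blue-own : ∀ {j u v} → Blue μ j → u ∈ₛ E j → v ∈ₛ E j → u ≢ v → ∃ λ j' → Blue μ j' × Own u v j'
    blue-own {j} {u} {v} bl u∈ v∈ u≢v with Fin.<-cmp u v
    ... | tri< lt _ _ = let j' , bl' , p = ordered bl u∈ v∈ lt in j' , bl' , inj₁ p
    ... | tri≈ _ eq _ = ⊥-elim (u≢v eq)
    ... | tri> _ _ gt = let j' , bl' , p = ordered bl v∈ u∈ gt in j' , bl' , inj₂ p
    build : (∀ j → Dec (Blue μ j)) → RedBlue E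
    build Blue? = record { Blue = Blue μ ; Blue? = Blue? ; Own = Own ; owners = owners ; own-unique = own-unique
                         ; red-own = red-own ; blue-own = blue-own }

-- Counting

nC0≡1 : ∀ n → n C 0 ≡ 1
nC0≡1 n = trans (nCk≡nC[n∸k] {0} {n} z≤n) (nCn≡1 n)

elements : ∀ {n} → Subset n → List (Fin n)
elements [] = []
elements (true ∷ S) = zero ∷ map suc (elements S)
elements (false ∷ S) = map suc (elements S)

length-elements : ∀ {n} (S : Subset n) → length (elements S) ≡ ∣ S ∣
length-elements [] = refl
length-elements (true ∷ S) = cong suc (trans (List.length-map suc (elements S)) (length-elements S))
length-elements (false ∷ S) = trans (List.length-map suc (elements S)) (length-elements S)

elements-uniq : ∀ {n} (S : Subset n) → Unique (elements S)
elements-uniq [] = []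
elements-uniq (true ∷ S) = uniq-∷ (λ p → case ∈-map⁻ suc p of λ { (_ , _ , ()) }) (Uniq.map⁺ Fin.suc-injective (elements-uniq S))
elements-uniq (false ∷ S) = Uniq.map⁺ Fin.suc-injective (elements-uniq S)

∈-elements⁺ : ∀ {n} (S : Subset n) {v} → v ∈ₛ S → v ∈ elements S
∈-elements⁺ (true ∷ S) here = here refl
∈-elements⁺ (true ∷ S) (there p) = there (∈-map⁺ suc (∈-elements⁺ S p))
∈-elements⁺ (false ∷ S) (there p) = ∈-map⁺ suc (∈-elements⁺ S p)

∈-elements⁻ : ∀ {n} (S : Subset n) {v} → v ∈ elements S → v ∈ₛ S
∈-elements⁻ (true ∷ S) (here refl) = here
∈-elements⁻ (true ∷ S) (there p) with ∈-map⁻ suc p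
... | _ , q , refl = there (∈-elements⁻ S q)
∈-elements⁻ (false ∷ S) p with ∈-map⁻ suc p
... | _ , q , refl = there (∈-elements⁻ S q)

length-filters : {A : Set} {P : A → Set} (P? : ∀ x → Dec (P x)) (xs : List A) →
  length (filter P? xs) + length (filter (λ x → ¬? (P? x)) xs) ≡ length xs
length-filters P? [] = refl
length-filters P? (x ∷ xs) with P? x
... | yes _ = cong suc (length-filters P? xs)
... | no _ = trans (+-suc _ _) (cong suc (length-filters P? xs))

filter-uniq : {A : Set} {P : A → Set} (P? : ∀ x → Dec (P x)) {xs : List A} → Unique xs → Unique (filter P? xs)
filter-uniq P? = Uniq.filter⁺ P?

images : {A B : Set} (ρ : A → B → Set) (xs : List A) → Unique xs → (∀ {x} → x ∈ xs → ∃ (ρ x)) →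
  (∀ {x x' y} → ρ x y → ρ x' y → x ≡ x') →
  ∃ λ ys → Unique ys × length ys ≡ length xs × (∀ {y} → y ∈ ys → ∃ λ x → x ∈ xs × ρ x y)
images ρ [] u tot inj = [] , [] , refl , λ ()
images ρ (x ∷ xs) u tot inj with tot (here refl) | images ρ xs (uniq-tail u) (tot ∘ there) inj
... | y , r | ys , uys , len , back = y ∷ ys , uniq-∷ y∉ uys , cong suc len ,
  λ { (here refl) → x , here refl , r ; (there p) → case back p of λ { (x' , x'∈ , r') → x' , there x'∈ , r' } }
  where
  y∉ : y ∉ ys
  y∉ p with back p
  ... | x' , x'∈ , r' with inj r r'
  ... | refl = uniq-head u x'∈

module _ {n m : ℕ} (E : Fin m → Subset n) where

  trace : Fin m → List (Fin n) → ℕ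
  trace j ts = length (filter (λ a → a ∈ₛ? E j) ts)

  -- Pascal's rule, splitting the hyperedges by whether they contain the first vertex of `ts`. The
  -- last hypothesis says that a hyperedge is determined by its trace.
  count-traces : ∀ ts k js → Unique js → (∀ {j} → j ∈ js → trace j ts ≡ k) →
    (∀ {i j} → i ∈ js → j ∈ js → (∀ {a} → a ∈ ts → (a ∈ₛ E i → a ∈ₛ E j) × (a ∈ₛ E j → a ∈ₛ E i)) → i ≡ j) →
    length js ≤ length ts C k
  count-traces [] k [] u tr inj = z≤n
  count-traces [] zero (j ∷ []) u tr inj = ≤-refl
  count-traces [] (suc k) (j ∷ js) u tr inj with tr (here refl)
  ... | ()
  count-traces [] zero (i ∷ j ∷ js) u tr inj =
    ⊥-elim (uniq-head u (here (inj (here refl) (there (here refl)) (λ ()))))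
  count-traces (a ∷ ts) k js u tr inj = go k tr
    where
    A? = λ j → a ∈ₛ? E j
    js₁ = filter A? js
    js₀ = filter (λ j → ¬? (A? j)) js
    inj₁' : ∀ {i j} → i ∈ js₁ → j ∈ js₁ → _ → i ≡ j
    inj₁' p q h = inj (proj₁ (∈-filter⁻ A? p)) (proj₁ (∈-filter⁻ A? q)) λ
      { (here refl) → (λ _ → proj₂ (∈-filter⁻ A? {xs = js} q)) , (λ _ → proj₂ (∈-filter⁻ A? {xs = js} p)) ; (there r) → h r }
    inj₀' : ∀ {i j} → i ∈ js₀ → j ∈ js₀ → _ → i ≡ j
    inj₀' p q h = inj (proj₁ (∈-filter⁻ (λ j → ¬? (A? j)) p)) (proj₁ (∈-filter⁻ (λ j → ¬? (A? j)) q)) λ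
      { (here refl) → (λ r → ⊥-elim (proj₂ (∈-filter⁻ (λ j → ¬? (A? j)) {xs = js} p) r)) ,
                      (λ r → ⊥-elim (proj₂ (∈-filter⁻ (λ j → ¬? (A? j)) {xs = js} q) r))
      ; (there r) → h r }
    with-a : ∀ {j} → a ∈ₛ E j → trace j (a ∷ ts) ≡ suc (trace j ts)
    with-a {j} p = cong length (List.filter-accept (λ b → b ∈ₛ? E j) p)
    without-a : ∀ {j} → ¬ a ∈ₛ E j → trace j (a ∷ ts) ≡ trace j ts
    without-a {j} p = cong length (List.filter-reject (λ b → b ∈ₛ? E j) p)
    rest : ∀ k → (∀ {j} → j ∈ js → trace j (a ∷ ts) ≡ k) → length js₀ ≤ length ts C k
    rest k tr = count-traces ts k js₀ (filter-uniq _ u)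
      (λ p → let q , na = ∈-filter⁻ (λ j → ¬? (A? j)) {xs = js} p in trans (sym (without-a na)) (tr q)) inj₀'
    go : ∀ k → (∀ {j} → j ∈ js → trace j (a ∷ ts) ≡ k) → length js ≤ suc (length ts) C k
    go zero tr = ≤-trans (≤-reflexive (trans (sym (length-filters A? js)) (cong (_+ length js₀) (none js₁ λ p →
        let q , pa = ∈-filter⁻ A? {xs = js} p in case trans (sym (with-a pa)) (tr q) of λ ()))))
      (≤-trans (rest zero tr) (≤-reflexive (trans (nC0≡1 (length ts)) (sym (nC0≡1 (suc (length ts)))))))
      where
      none : ∀ (l : List (Fin m)) → (∀ {j} → j ∈ l → ⊥) → length l ≡ 0
      none [] f = refl
      none (x ∷ l) f = ⊥-elim (f (here refl))
    go (suc k) tr = ≤-trans (≤-reflexive (sym (length-filters A? js)))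
      (≤-trans (+-mono-≤
        (count-traces ts k js₁ (filter-uniq _ u)
          (λ p → let q , pa = ∈-filter⁻ A? {xs = js} p in suc-injective (trans (sym (with-a pa)) (tr q))) inj₁')
        (rest (suc k) tr))
        (≤-reflexive (nCk+nC[k+1]≡[n+1]C[k+1] (length ts) k)))

C-zero : ∀ {n k} → n < k → n C k ≡ 0
C-zero = k>n⇒nCk≡0

C-positive : ∀ n k → k ≤ n → 1 ≤ n C k
C-positive n zero _ = ≤-reflexive (sym (nC0≡1 n))
C-positive (suc n) (suc k) (s≤s le) =
  ≤-trans (C-positive n k le) (≤-trans (m≤m+n _ _) (≤-reflexive (nCk+nC[k+1]≡[n+1]C[k+1] n k)))

C-suc-mono : ∀ n k → n C k ≤ suc n C k
C-suc-mono n zero = ≤-reflexive (trans (nC0≡1 n) (sym (nC0≡1 (suc n))))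
C-suc-mono n (suc k) = ≤-trans (m≤n+m _ (n C k)) (≤-reflexive (nCk+nC[k+1]≡[n+1]C[k+1] n k))

C-mono : ∀ {n n'} k → n ≤ n' → n C k ≤ n' C k
C-mono {n' = n'} k le with ≤⇒≤′ le
... | le' = go le'
  where
  go : ∀ {n n'} → n ≤′ n' → n C k ≤ n' C k
  go ≤′-refl = ≤-refl
  go (≤′-step p) = ≤-trans (go p) (C-suc-mono _ k)

C-pred : ∀ k → suc k C k ≡ suc k
C-pred k = trans (nCk≡nC[n∸k] (n≤1+n k)) (trans (cong (suc k C_) (m+n∸n≡m 1 k)) (nC1≡n (suc k)))

C-small : ∀ {y k} → 1 ≤ k → y ≤ suc k → y C k ≤ y
C-small {y} {k} 1≤k y≤ with <-cmp y k
... | tri< lt _ _ = ≤-trans (≤-reflexive (C-zero lt)) z≤n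
... | tri≈ _ refl _ = ≤-trans (≤-reflexive (nCn≡1 y)) 1≤k
... | tri> _ _ gt with ≤-antisym y≤ gt
... | refl = ≤-reflexive (C-pred k)

C-step : ∀ n k → 1 ≤ k → k ≤ suc n → suc (n C k) ≤ suc n C k
C-step n (suc k) _ (s≤s le) =
  ≤-trans (+-monoˡ-≤ _ (C-positive n k le)) (≤-reflexive (nCk+nC[k+1]≡[n+1]C[k+1] n k))

module _ {r'} (2≤r' : 2 ≤ r') where

  private
    1≤r' : 1 ≤ r'
    1≤r' = ≤-trans (s≤s z≤n) 2≤r'

  -- In this section r' = r - 1, and x and y are the numbers of red and blue neighbours of a vertex.
  mixed-loss : ∀ M x y → suc r' ≤ M → x + y ≤ M → x + y C r' ≤ M C r'
  mixed-loss M zero y _ le = C-mono r' le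
  mixed-loss (suc M) (suc x) y r<M (s≤s le) with suc r' ≤? M
  ... | yes p = ≤-trans (s≤s (mixed-loss M x y p le)) (C-step M r' 1≤r' (≤-trans (n≤1+n _) (≤-trans p (n≤1+n _))))
  -- Now M = r' + 1, so C(y, r') ≤ y for every y that can occur, while the right side is C(r' + 2,
  -- r') with the top lowered to r' + 1 by the pattern below, as the offset by `suc` shows.
  ... | no ¬p with ≤-antisym (s≤s⁻¹ r<M) (s≤s⁻¹ (≰⇒> ¬p))
  ... | refl = ≤-trans (s≤s (+-monoʳ-≤ x (C-small 1≤r' (≤-trans (m≤n+m y x) (≤-trans le (n≤1+n _))))))
        (≤-trans (s≤s le) (≤-reflexive (sym (C-pred r'))))

  C-suc-2 : ∀ s → suc s C 2 ≡ s + s C 2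
  C-suc-2 s = trans (sym (nCk+nC[k+1]≡[n+1]C[k+1] s 1)) (cong (_+ s C 2) (nC1≡n s))

  C-top : suc (suc (suc r')) C suc r' ≡ suc (suc (suc r')) C 2
  C-top = trans (nCk≡nC[n∸k] {suc r'} {suc (suc (suc r'))} (≤-trans (n≤1+n _) (n≤1+n _)))
    (cong (suc (suc (suc r')) C_) (m+n∸n≡m 2 r'))

  -- At s = r' + 3 the two sides agree by symmetry of binomials, which is where `few-vertices` hands
  -- over to `many-vertices`. Below that, Pascal's rule applies with C(s, r') ≤ s.
  C-r≤C-2 : ∀ s → s ≤ suc (suc (suc r')) → s C suc r' ≤ s C 2
  C-r≤C-2 s le with suc (suc (suc r')) ≤? s
  ... | yes ge with ≤-antisym le ge
  ... | refl = ≤-reflexive C-top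
  C-r≤C-2 s le | no ¬ge = small s (s≤s⁻¹ (≰⇒> ¬ge))
    where
    small : ∀ s → s ≤ suc (suc r') → s C suc r' ≤ s C 2
    small zero le = z≤n
    small (suc s) (s≤s le) = ≤-trans (≤-reflexive (sym (nCk+nC[k+1]≡[n+1]C[k+1] s r')))
      (≤-trans (+-mono-≤ (C-small 1≤r' le) (small s (≤-trans le (n≤1+n _)))) (≤-reflexive (sym (C-suc-2 s))))

-- Deleting vertices

module Deletion {n m : ℕ} (E : Fin m → Subset n) (RB : RedBlue E) {r'} (2≤r' : 2 ≤ r')
  (uniform : ∀ j → ∣ E j ∣ ≡ suc r') (E-inj : ∀ {i j} → E i ≡ E j → i ≡ j) where

  open RedBlue RB
  open Incidence.Owners owners
  open import Data.List.Membership.DecPropositional (Fin._≟_ {n}) using (_∈?_)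

  -- The hyperedges counted in a vertex set: a blue edge lives on its vertices, a red edge on its pair.
  Inside : List (Fin n) → Fin m → Set
  Inside Us j = (Blue j × (∀ {a} → a ∈ₛ E j → a ∈ Us)) ⊎ (¬ Blue j × ∃₂ λ u v → Own u v j × u ∈ Us × v ∈ Us)

  Bounded : List (Fin n) → ℕ → Set
  Bounded Us c = ∀ js → Unique js → (∀ {j} → j ∈ js → Inside Us j) → length js ≤ c

  HasNbrs : ℕ → Fin n → List (Fin n) → Set
  HasNbrs s v Us = ∃ λ ns → Unique ns × s ≤ length ns × (∀ {u} → u ∈ ns → (∃ λ e → Own v u e) × u ∈ Us)

  private
    ext : ∀ {i j} → (∀ {a} → (a ∈ₛ E i → a ∈ₛ E j) × (a ∈ₛ E j → a ∈ₛ E i)) → i ≡ j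
    ext h = E-inj (⊆-antisym (proj₁ h) (proj₂ h))

    trace-all : ∀ j ts → Unique ts → (∀ {a} → a ∈ₛ E j → a ∈ ts) → trace E j ts ≡ suc r'
    trace-all j ts u sub = trans (≤-antisym
      (uniq-⊆-length (filter-uniq A? u) (λ p → ∈-elements⁺ (E j) (proj₂ (∈-filter⁻ A? {xs = ts} p))))
      (uniq-⊆-length (elements-uniq (E j)) (λ p → ∈-filter⁺ A? (sub (∈-elements⁻ (E j) p)) (∈-elements⁻ (E j) p))))
      (trans (length-elements (E j)) (uniform j))
      where A? = λ a → a ∈ₛ? E j

  blue-bound : ∀ Us js → Unique Us → Unique js → (∀ {j a} → j ∈ js → a ∈ₛ E j → a ∈ Us) → length js ≤ length Us C suc r'
  blue-bound Us js uU u sub = count-traces E Us (suc r') js u (λ p → trace-all _ Us uU (sub p))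
    (λ p q h → ext (λ {a} → (λ a∈ → proj₁ (h (sub p a∈)) a∈) , (λ a∈ → proj₂ (h (sub q a∈)) a∈)))

  blue-bound-at : ∀ v Us js → Unique (v ∷ Us) → Unique js → (∀ {j} → j ∈ js → v ∈ₛ E j) →
    (∀ {j a} → j ∈ js → a ∈ₛ E j → a ≢ v → a ∈ Us) → length js ≤ length Us C r'
  blue-bound-at v Us js uU u at sub = count-traces E Us r' js u
    (λ {j} p → suc-injective (trans (sym (cong length (List.filter-accept (λ b → b ∈ₛ? E j) (at p))))
      (trace-all j (v ∷ Us) uU (sub' p))))
    (λ p q h → ext (λ {a} → (λ a∈ → case a Fin.≟ v of λ { (yes refl) → at q ; (no ne) → proj₁ (h (sub p a∈ ne)) a∈ }) ,
                             (λ a∈ → case a Fin.≟ v of λ { (yes refl) → at p ; (no ne) → proj₂ (h (sub q a∈ ne)) a∈ })))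
    where
    sub' : ∀ {j a} → j ∈ js → a ∈ₛ E j → a ∈ v ∷ Us
    sub' {a = a} p a∈ with a Fin.≟ v
    ... | yes eq = here eq
    ... | no ne = there (sub p a∈ ne)

  record Loss (Us : List (Fin n)) (v : Fin n) (Us' : List (Fin n)) (js : List (Fin m)) : Set where
    constructor loss
    field
      x y        : ℕ
      kept       : List (Fin m)
      kept-uniq  : Unique kept
      kept-in    : ∀ {j} → j ∈ kept → Inside Us' j
      split      : length js ≤ x + y C r' + length kept
      nbrs       : HasNbrs (x + y) v Us
      red-lost   : ∀ {j} → j ∈ js → ¬ Blue j → (∃ λ u → Own v u j) → v ∉ Us' → 1 ≤ x

  -- A lost red hyperedge has `v` in its pair and so yields a neighbour of its own. A lost blue one
  -- contains `v`, and its other vertices, collected in `Ny`, are neighbours of `v` with blue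
  -- owners. So `Nx` and `Ny` are disjoint, and at most C(y, r') blue hyperedges are lost.
  delete : ∀ {Us v Us'} js → (∀ {a} → a ∈ Us → a ≢ v → a ∈ Us') → (∀ j → Dec (Inside Us' j)) →
    Unique js → (∀ {j} → j ∈ js → Inside Us j) → Loss Us v Us' js
  delete {Us} {v} {Us'} js sub D u ins = loss (length reds) (length Ny) kept (filter-uniq D u)
    (λ p → proj₂ (∈-filter⁻ D {xs = js} p)) bound' nbrs' red-lost'
    where
    kept = filter D js
    lost = filter (λ j → ¬? (D j)) js
    ul : Unique lost
    ul = filter-uniq (λ j → ¬? (D j)) u
    lost⁻ : ∀ {j} → j ∈ lost → Inside Us j × ¬ Inside Us' j
    lost⁻ p = let q , ni = ∈-filter⁻ (λ j → ¬? (D j)) {xs = js} p in ins q , ni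
    blues = filter Blue? lost
    reds = filter (λ j → ¬? (Blue? j)) lost
    Red : Fin m → Fin n → Set
    Red j u = ¬ Blue j × Own v u j × u ∈ Us
    red-total : ∀ {j} → j ∈ reds → ∃ (Red j)
    red-total {j} p with ∈-filter⁻ (λ j → ¬? (Blue? j)) {xs = lost} p
    ... | q , ¬b with lost⁻ q
    ... | inj₁ (b , _) , _ = ⊥-elim (¬b b)
    ... | inj₂ (_ , a , b , o , a∈ , b∈) , ni with a Fin.≟ v | b Fin.≟ v
    ... | yes refl | _ = b , ¬b , o , b∈
    ... | no _ | yes refl = a , ¬b , O-sym o , a∈
    ... | no a≢ | no b≢ = ⊥-elim (ni (inj₂ (¬b , a , b , o , sub a∈ a≢ , sub b∈ b≢)))
    red-images = images Red reds (filter-uniq (λ j → ¬? (Blue? j)) ul) red-total (λ r r' → own-unique (proj₁ (proj₂ r)) (proj₁ (proj₂ r')))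
    Nx = proj₁ red-images
    blue⁻ : ∀ {j} → j ∈ blues → Blue j × (∀ {a} → a ∈ₛ E j → a ∈ Us) × v ∈ₛ E j
    blue⁻ {j} p with ∈-filter⁻ Blue? {xs = lost} p
    ... | q , b with lost⁻ q
    ... | inj₂ (¬b , _) , _ = ⊥-elim (¬b b)
    ... | inj₁ (_ , all) , ni with v ∈ₛ? E j
    ... | yes v∈ = b , all , v∈
    ... | no v∉ = ⊥-elim (ni (inj₁ (b , λ a∈ → sub (all a∈) (λ { refl → v∉ a∈ }))))
    Near : Fin n → Set
    Near u = u ≢ v × Any.Any (λ j → u ∈ₛ E j) blues
    Near? : ∀ u → Dec (Near u)
    Near? u = ¬? (u Fin.≟ v) ×-dec Any.any? (λ j → u ∈ₛ? E j) blues
    Ny = filter Near? (allFin n)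
    uNy : Unique Ny
    uNy = filter-uniq Near? (Uniq.allFin⁺ n)
    Ny⁻ : ∀ {u} → u ∈ Ny → Near u
    Ny⁻ p = proj₂ (∈-filter⁻ Near? {xs = allFin n} p)
    Ny-own : ∀ {u} → u ∈ Ny → (∃ λ j → Blue j × Own v u j) × u ∈ Us
    Ny-own p with Ny⁻ p
    ... | u≢v , near with find near
    ... | j , j∈ , u∈ with blue⁻ j∈
    ... | b , all , v∈ = blue-own b v∈ u∈ (u≢v ∘ sym) , all u∈
    nbrs' : HasNbrs (length reds + length Ny) v Us
    nbrs' = Nx ++ Ny , uniq-++ (proj₁ (proj₂ red-images)) uNy dis ,
      ≤-reflexive (sym (trans (List.length-++ Nx) (cong (_+ length Ny) (proj₁ (proj₂ (proj₂ red-images)))))) ,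
      λ p → case ∈-++⁻ Nx p of λ
        { (inj₁ q) → case proj₂ (proj₂ (proj₂ red-images)) q of λ { (j , _ , _ , o , u∈) → (j , o) , u∈ }
        ; (inj₂ q) → case Ny-own q of λ { ((j , _ , o) , u∈) → (j , o) , u∈ } }
      where
      dis : Disjoint Nx Ny
      dis p q with proj₂ (proj₂ (proj₂ red-images)) p | Ny-own q
      ... | j , _ , ¬b , o , _ | (j' , b , o') , _ with own-unique o o'
      ... | refl = ¬b b
    blues≤ : length blues ≤ length Ny C r'
    blues≤ = blue-bound-at v Ny blues (uniq-∷ (λ p → proj₁ (Ny⁻ p) refl) uNy) (filter-uniq Blue? ul)
      (λ p → proj₂ (proj₂ (blue⁻ p))) (λ p a∈ ne → ∈-filter⁺ Near? (∈-allFin _) (ne , lose p a∈))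
    open ≤-Reasoning
    bound' : length js ≤ length reds + length Ny C r' + length kept
    bound' = begin
      length js ≡⟨ length-filters D js ⟨
      length kept + length lost ≡⟨ +-comm (length kept) _ ⟩
      length lost + length kept ≡⟨ cong (_+ length kept) (length-filters Blue? lost) ⟨
      length blues + length reds + length kept ≤⟨ +-monoˡ-≤ (length kept) (+-monoˡ-≤ (length reds) blues≤) ⟩
      length Ny C r' + length reds + length kept ≡⟨ cong (_+ length kept) (+-comm (length Ny C r') (length reds)) ⟩
      length reds + length Ny C r' + length kept ∎
    red-lost' : ∀ {j} → j ∈ js → ¬ Blue j → (∃ λ u → Own v u j) → v ∉ Us' → 1 ≤ length reds
    red-lost' {j} j∈ ¬b (u , o) v∉ = ∈-length (∈-filter⁺ (λ j → ¬? (Blue? j)) (∈-filter⁺ (λ j → ¬? (D j)) j∈ ni) ¬b)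
      where
      ni : ¬ Inside Us' j
      ni (inj₁ (b , _)) = ¬b b
      ni (inj₂ (_ , a , b , o' , a∈ , b∈)) with O-inj o o'
      ... | inj₁ (refl , _) = v∉ a∈
      ... | inj₂ (refl , _) = v∉ b∈

  nbrs-bound : ∀ {s v Us} → HasNbrs s v Us → v ∈ Us → suc s ≤ length Us
  nbrs-bound {s} {v} {Us} (ns , un , le , ok) v∈ = ≤-trans (s≤s le)
    (uniq-⊆-length {xs = v ∷ ns} (uniq-∷ (λ p → O-irr (proj₂ (proj₁ (ok p)))) un)
      (λ { (here refl) → v∈ ; (there p) → proj₂ (ok p) }))

  inside? : ∀ Us → ¬ ¬ (∀ j → Dec (Inside Us j))
  inside? Us = ¬¬-∀Fin λ j → em (Inside Us j)

  private
    stable : ∀ {a b : ℕ} → ¬ ¬ (a ≤ b) → a ≤ b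
    stable {a} {b} = decidable-stable (a ≤? b)

    remove-⊆ : ∀ (as : List (Fin n)) {v bs} {a : Fin n} → a ∈ as ++ v ∷ bs → a ≢ v → a ∈ as ++ bs
    remove-⊆ as {v} {bs} p ne with ∈-resp-↭ (shift v as bs) p
    ... | here eq = ⊥-elim (ne eq)
    ... | there q = q

    remove-uniq : ∀ (as : List (Fin n)) {v bs} → Unique (as ++ v ∷ bs) → Unique (v ∷ as ++ bs)
    remove-uniq as {v} {bs} = uniq-↭ (shift v as bs)

    remove-length : ∀ (as : List (Fin n)) {v bs} → length (as ++ v ∷ bs) ≡ suc (length (as ++ bs))
    remove-length as {v} {bs} = ↭-length (shift v as bs)

  bounded-after : ∀ {Us v Us' L c} → (∀ {a} → a ∈ Us → a ≢ v → a ∈ Us') →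
    (∀ x y → HasNbrs (x + y) v Us → x + y C r' ≤ L) → Bounded Us' c → Bounded Us (L + c)
  bounded-after {Us} {v} {Us'} sub le B js u ins = stable (inside? Us' >>= λ D → return (use (delete js sub D u ins)))
    where
    use : Loss Us v Us' js → _
    use (loss x y kept uk kin sp nb _) = ≤-trans sp (+-mono-≤ (le x y nb) (B kept uk kin))

  weaken : ∀ {Us b c} → b ≤ c → Bounded Us b → Bounded Us c
  weaken le B js u ins = ≤-trans (B js u ins) le

  -- Without red hyperedges this is `C-r≤C-2`. Otherwise delete a vertex of a red pair: x ≥ 1 forces
  -- y ≤ r' + 1, hence C(y, r') ≤ y, and the loss is at most the number of remaining vertices, as in
  -- a graph.
  few-vertices : ∀ s Us → Unique Us → length Us ≡ s → s ≤ suc (suc (suc r')) → Bounded Us (s C 2)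
  few-vertices s Us uU len s≤ js u ins with Any.any? (λ j → ¬? (Blue? j)) js
  ... | no none = ≤-trans (≤-trans (blue-bound Us js uU u sub) (≤-reflexive (cong (_C suc r') len))) (C-r≤C-2 2≤r' s s≤)
    where
    sub : ∀ {j a} → j ∈ js → a ∈ₛ E j → a ∈ Us
    sub {j} p a∈ with ins p
    ... | inj₁ (_ , all) = all a∈
    ... | inj₂ (¬b , _) = ⊥-elim (none (lose p ¬b))
  ... | yes some with find some
  ... | j , j∈ , ¬b with ins j∈
  ... | inj₁ (b , _) = ⊥-elim (¬b b)
  ... | inj₂ (_ , v , w , o , v∈ , w∈) with ∈-∃++ v∈ | s
  ... | as , bs , refl | zero = case trans (sym (remove-length as)) len of λ ()
  ... | as , bs , refl | suc s' = stable (inside? (as ++ bs) >>= λ D → return (use (delete js (remove-⊆ as) D u ins)))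
    where
    use : Loss (as ++ v ∷ bs) v (as ++ bs) js → length js ≤ suc s' C 2
    use (loss x y kept uk kin sp nb red) = begin
      length js ≤⟨ sp ⟩
      x + y C r' + length kept ≤⟨ +-mono-≤ (+-monoʳ-≤ x (C-small (≤-trans (s≤s z≤n) 2≤r') y≤))
                                    (few-vertices s' (as ++ bs) (uniq-tail (remove-uniq as uU))
                                      (suc-injective (trans (sym (remove-length as)) len)) (≤-trans (n≤1+n s') s≤) kept uk kin) ⟩
      x + y + s' C 2 ≤⟨ +-monoˡ-≤ (s' C 2) x+y≤ ⟩
      s' + s' C 2 ≡⟨ C-suc-2 2≤r' s' ⟨
      suc s' C 2 ∎
      where
      open ≤-Reasoning
      x+y≤ : x + y ≤ s'
      x+y≤ = s≤s⁻¹ (≤-trans (nbrs-bound nb v∈) (≤-reflexive len))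
      y≤ : y ≤ suc r'
      y≤ = s≤s⁻¹ (s≤s⁻¹ (≤-trans (s≤s (≤-trans (+-monoˡ-≤ y (red j∈ ¬b (w , o) (uniq-head (remove-uniq as uU)))) x+y≤)) s≤))

  -- At r' + 3 vertices the graph bound C(s, 2) equals C(s, r' + 1). From there on, `mixed-loss`
  -- bounds the cost of each further vertex by the increment in Pascal's rule.
  many-vertices : ∀ f Us → Unique Us → length Us ≡ f + suc (suc (suc r')) → Bounded Us (length Us C suc r')
  many-vertices zero Us uU len js u ins = ≤-trans (few-vertices (length Us) Us uU refl (≤-reflexive len) js u ins)
    (≤-reflexive (trans (cong (_C 2) len) (trans (sym (C-top 2≤r')) (cong (_C suc r') (sym len)))))
  many-vertices (suc f) (v ∷ Us) uU len =
    weaken (≤-reflexive (nCk+nC[k+1]≡[n+1]C[k+1] (length Us) r'))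
      (bounded-after sub le (many-vertices f Us (uniq-tail uU) (suc-injective len)))
    where
    sub : ∀ {a} → a ∈ v ∷ Us → a ≢ v → a ∈ Us
    sub (here eq) ne = ⊥-elim (ne eq)
    sub (there p) ne = p
    le : ∀ x y → HasNbrs (x + y) v (v ∷ Us) → x + y C r' ≤ length Us C r'
    le x y nb = mixed-loss 2≤r' (length Us) x y
      (≤-trans (≤-trans (≤-trans (n≤1+n _) (n≤1+n _)) (m≤n+m _ f)) (≤-reflexive (sym (suc-injective len))))
      (s≤s⁻¹ (nbrs-bound nb (here refl)))

  crude-bound : ∀ K Us → suc r' ≤ K → Unique Us → length Us ≤ K → Bounded Us (length Us * (K C r'))
  crude-bound K [] r≤ uU le = few-vertices 0 [] [] refl z≤n
  crude-bound K (v ∷ Us) r≤ uU le = bounded-after sub loss≤ (crude-bound K Us r≤ (uniq-tail uU) (≤-trans (n≤1+n _) le))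
    where
    sub : ∀ {a} → a ∈ v ∷ Us → a ≢ v → a ∈ Us
    sub (here eq) ne = ⊥-elim (ne eq)
    sub (there p) ne = p
    loss≤ : ∀ x y → HasNbrs (x + y) v (v ∷ Us) → x + y C r' ≤ K C r'
    loss≤ x y nb = mixed-loss 2≤r' K x y r≤ (≤-trans (n≤1+n _) (≤-trans (nbrs-bound nb (here refl)) le))

  has-fewer : ∀ {s s' v Us Vs} → s' ≤ s → Us ⊆ Vs → HasNbrs s v Us → HasNbrs s' v Vs
  has-fewer le sub (ns , un , ln , ok) = ns , un , ≤-trans le ln , λ p → proj₁ (ok p) , sub (proj₂ (ok p))

  private
    few : ∀ {t x y v Us} → ¬ HasNbrs (suc t) v Us → HasNbrs (x + y) v Us → x + y ≤ t
    few {t} {x} {y} ¬h h with x + y ≤? t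
    ... | yes le = le
    ... | no ≰ = ⊥-elim (¬h (has-fewer (≰⇒> ≰) (λ p → p) h))

  module _ (t' : ℕ) (r≤t : suc r' ≤ suc t') where

    private t = suc t'

    -- Vertices with at most `t` neighbours are peeled off. Either this stops early, at more than
    -- `s₀` vertices of degree above `t`, or it reaches `s₀` vertices and the losses add up to the
    -- bound.
    high-core : ∀ {s₀ g} → s₀ ≡ g + suc (suc (suc r')) → ∀ f Us → Unique Us → length Us ≡ f + s₀ →
      ¬ ¬ ((∃ λ Ws → Unique Ws × suc s₀ ≤ length Ws × (∀ {v} → v ∈ Ws → HasNbrs (suc t) v Ws)) ⊎
           Bounded Us (f * (t C r') + s₀ C suc r'))
    high-core {s₀} {g} s₀≡ zero Us uU len = return (inj₂
      (weaken (≤-reflexive (cong (_C suc r') len)) (many-vertices g Us uU (trans len s₀≡))))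
    high-core {s₀} {g} s₀≡ (suc f) Us uU len = ¬¬-∀Fin (λ v → em (HasNbrs (suc t) v Us)) >>= step
      where
      Core = ∃ λ Ws → Unique Ws × suc s₀ ≤ length Ws × (∀ {v} → v ∈ Ws → HasNbrs (suc t) v Ws)
      step : (∀ v → Dec (HasNbrs (suc t) v Us)) → ¬ ¬ (Core ⊎ Bounded Us (suc f * (t C r') + s₀ C suc r'))
      step N? with Any.any? (λ v → ¬? (N? v)) Us
      ... | no none = return {Core ⊎ Bounded Us (suc f * (t C r') + s₀ C suc r')}
            (inj₁ (Us , uU , ≤-trans (s≤s (m≤n+m s₀ f)) (≤-reflexive (sym len)) ,
            λ {v} p → case N? v of λ { (yes h) → h ; (no h) → ⊥-elim (none (lose p h)) }))
      ... | yes some with find some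
      ... | v , v∈ , ¬h with ∈-∃++ v∈
      ... | as , bs , refl = high-core s₀≡ f (as ++ bs) (uniq-tail (remove-uniq as uU))
              (suc-injective (trans (sym (remove-length as)) len)) >>= λ
            { (inj₁ core) → return (inj₁ core)
            ; (inj₂ B) → return (inj₂ (weaken
                (≤-reflexive (sym (+-assoc (t C r') (f * (t C r')) (s₀ C suc r'))))
                (bounded-after (remove-⊆ as) (λ x y nb → mixed-loss 2≤r' t x y r≤t (few {x = x} ¬h nb)) B))) }

    -- A vertex with fewer than `t` neighbours costs at most C(t, r') - 1: `mixed-loss` has room for
    -- one more red neighbour. This saving per vertex is what wins for large n. Vertices of `Ws` are
    -- never removed, having t + 1 neighbours in `Ws`.
    low-core : ∀ {d' Ws} → t C r' ≡ suc d' → (∀ {v} → v ∈ Ws → HasNbrs (suc t) v Ws) →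
      ∀ l Us → Unique Us → length Us ≡ l → Ws ⊆ Us →
      ¬ ¬ (∃ λ Vs → Unique Vs × Ws ⊆ Vs × (∀ {v} → v ∈ Vs → HasNbrs t v Vs) ×
           (∀ c → Bounded Vs c → Bounded Us (l * d' + c)))
    low-core {d'} {Ws} d≡ W-deg l Us uU len W⊆ = ¬¬-∀Fin (λ v → em (HasNbrs t v Us)) >>= step l len
      where
      Core : ℕ → Set
      Core l = ∃ λ Vs → Unique Vs × Ws ⊆ Vs × (∀ {v} → v ∈ Vs → HasNbrs t v Vs) ×
           (∀ c → Bounded Vs c → Bounded Us (l * d' + c))
      step : ∀ l → length Us ≡ l → (∀ v → Dec (HasNbrs t v Us)) → ¬ ¬ Core l
      step l len N? with Any.any? (λ v → ¬? (N? v)) Us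
      ... | no none = return {Core l} (Us , uU , W⊆ ,
            (λ {v} p → case N? v of λ { (yes h) → h ; (no h) → ⊥-elim (none (lose p h)) }) ,
            λ c → weaken (m≤n+m c (l * d')))
      ... | yes some with find some
      ... | v , v∈ , ¬h with ∈-∃++ v∈ | l
      ... | as , bs , refl | zero = case trans (sym (remove-length as)) len of λ ()
      ... | as , bs , refl | suc l' = low-core d≡ W-deg l' (as ++ bs) (uniq-tail (remove-uniq as uU))
              (suc-injective (trans (sym (remove-length as)) len))
              (λ {w} w∈ → remove-⊆ as (W⊆ w∈) (λ { refl → ¬h (has-fewer (n≤1+n t) W⊆ (W-deg w∈)) })) >>= λ
            { (Vs , uV , W⊆V , V-deg , B) → return {Core (suc l')} (Vs , uV , W⊆V , V-deg ,
                λ c b → weaken (≤-reflexive (sym (+-assoc d' (l' * d') c)))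
                (bounded-after {L = d'} (remove-⊆ as)
                  (λ x y nb → s≤s⁻¹ (≤-trans (mixed-loss 2≤r' t (suc x) y r≤t (s≤s (few {x = x} ¬h nb))) (≤-reflexive d≡)))
                  (B c b))) }

  all-inside : ∀ {c} → Bounded (allFin n) c → m ≤ c
  all-inside B = ≤-trans (≤-reflexive (sym (length-allFin m)))
    (B (allFin m) (Uniq.allFin⁺ m) (λ {j} _ → ins j))
    where
    ins : ∀ j → Inside (allFin n) j
    ins j with Blue? j
    ... | yes b = inj₁ (b , λ {a} _ → ∈-allFin a)
    ... | no ¬b with red-own ¬b
    ... | u , v , o = inj₂ (¬b , u , v , o , ∈-allFin u , ∈-allFin v)

-- The extremal argument

module _ {n m : ℕ} (E : Fin m → Subset n) where

  open Incidence E

  -- The owner of the closing pair could already occur on the expanded path only if the cycle had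
  -- two vertices and used one pair twice; 3 ≤ k excludes that.
  owned-cycle : ∀ {O k} (owners : Owners O) → 3 ≤ k → LongCycle (Owned.Γ O owners) k → AdjCycle k
  owned-cycle owners 3≤k (x , [] , w , u , le) = case ≤-trans 3≤k le of λ ()
  owned-cycle {O} {k} owners 3≤k (x , z ∷ zs , w , u , le) with last-step w
  ... | ps , c , eq , wp , e , o = inj₁ x , es ++ inj₂ e ∷ inj₁ x ∷ [] ,
    walk ⊕ (O-inc o ∷ O-inc (O-sym o) ∷ []) , uniq-all , long
    where
    open Owned O owners
    up : Unique (x ∷ ps)
    up = uniq-↭ (↭-sym (∷↭∷ʳ x ps)) (subst Unique eq u)
    open Expansion (expand wp up)
    len : length (z ∷ zs) ≡ suc (length ps)
    len = trans (cong length eq) (sym (↭-length (∷↭∷ʳ x ps)))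
    short : ∀ {b t} → ps ≡ b ∷ t → b ≡ c → Walk Γ x ps c → Unique (x ∷ ps) → length ps ≤ 1
    short {t = []} refl refl _ _ = ≤-refl
    short {t = _ ∷ _} refl refl (_ ∷ (_ ∷ w')) (_ ∷ u') = ⊥-elim (uniq-head u' (end∈ w'))
    e∉ : inj₂ e ∉ es
    e∉ p with on-E p
    ... | inj₁ (b , t , eq' , o') = case O-inj o' o of λ
      { (inj₁ (refl , refl)) → O-irr o'
      ; (inj₂ (_ , b≡c)) → <⇒≱ (s≤s (s≤s (short eq' b≡c wp up))) (≤-trans 3≤k (≤-trans le (≤-reflexive len))) }
    ... | inj₂ (a , b , a∈ , b∈ , o') = case O-inj o' o of λ
      { (inj₁ (_ , refl)) → uniq-head up b∈ ; (inj₂ (refl , _)) → uniq-head up a∈ }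
    uniq-all : Unique (es ++ inj₂ e ∷ inj₁ x ∷ [])
    uniq-all = uniq-++ (uniq-tail uniq) (uniq-∷ (λ { (here ()) ; (there ()) }) ([] ∷ []))
      (λ { p (here refl) → e∉ p ; p (there (here refl)) → uniq-head uniq p })
    long : k ≤ total vertices (es ++ inj₂ e ∷ inj₁ x ∷ [])
    long = ≤-trans le (≤-reflexive (trans len (trans (cong suc (sym weight))
      (trans (+-comm 1 _) (sym (total-++ vertices es (inj₂ e ∷ inj₁ x ∷ [])))))))

  module Extremal {r' t' s₀ g k : ℕ} (2≤r' : 2 ≤ r') (r≤t : suc r' ≤ suc t') (s₀≡ : s₀ ≡ g + suc (suc (suc r')))
    (t+s₀ : suc t' + s₀ ≡ k) (k≤2t+2 : k ≤ suc (suc t') + suc (suc t'))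
    (uniform : ∀ j → ∣ E j ∣ ≡ suc r') (E-inj : ∀ {i j} → E i ≡ E j → i ≡ j)
    (connected : Connectivity) (no-cycle : ∀ {K} → k ≤ K → ¬ AdjCycle K) where

    private
      t = suc t'

      3≤t : 3 ≤ t
      3≤t = ≤-trans (s≤s 2≤r') r≤t

      3≤s₀ : 3 ≤ s₀
      3≤s₀ = ≤-trans (s≤s (s≤s (s≤s z≤n))) (≤-trans (m≤n+m (suc (suc (suc r'))) g) (≤-reflexive (sym s₀≡)))

      3≤k : 3 ≤ k
      3≤k = ≤-trans 3≤t (≤-trans (m≤m+n t s₀) (≤-reflexive t+s₀))

      r≤k : suc r' ≤ k
      r≤k = ≤-trans r≤t (≤-trans (m≤m+n t s₀) (≤-reflexive t+s₀))

    -- With d' = C(t, r') - 1, a low core of fewer than `k` vertices would give at most n d' + k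
    -- C(k, r') hyperedges. From this n on, that is at most C(t, r') (n - s₀).
    threshold : ℕ
    threshold = s₀ + (s₀ * (t C r' ∸ 1) + k * (k C r'))

    module _ (RB : RedBlue E) where

      open RedBlue RB
      open Deletion E RB 2≤r' uniform E-inj

      module Cores {Ws Vs : List (Fin n)} (uW : Unique Ws) (W-large : suc s₀ ≤ length Ws)
        (W-deg : ∀ {v} → v ∈ Ws → HasNbrs (suc t) v Ws) (uV : Unique Vs) (V-large : k ≤ length Vs)
        (W⊆V : ∀ {v} → v ∈ Ws → v ∈ Vs) (V-deg : ∀ {v} → v ∈ Vs → HasNbrs t v Vs) where

        O : Fin n → Fin n → Fin m → Set
        O u v e = u ∈ Vs × v ∈ Vs × Own u v e

        O-owners : Owners O
        O-owners = record
          { O-sym = λ { (p , q , o) → q , p , Owners.O-sym owners o }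
          ; O-inc = λ { (_ , _ , o) → Owners.O-inc owners o }
          ; O-irr = λ { (_ , _ , o) → Owners.O-irr owners o }
          ; O-inj = λ { (_ , _ , o) (_ , _ , o') → Owners.O-inj owners o o' } }

        open Owned O O-owners using (Γ; Γ-sym; Γ-irr)

        V-deg' : ∀ {v} → v ∈ Vs → ∃ λ ns → Unique ns × t ≤ length ns × (∀ {u} → u ∈ ns → Γ v u)
        V-deg' v∈ with V-deg v∈
        ... | ns , un , le , ok = ns , un , le , λ p → proj₁ (proj₁ (ok p)) , v∈ , proj₂ (ok p) , proj₂ (proj₁ (ok p))

        W-deg' : ∀ {v} → v ∈ Ws → ∃ λ ns → Unique ns × suc t ≤ length ns × (∀ {u} → u ∈ ns → Γ v u × u ∈ Ws)
        W-deg' v∈ with W-deg v∈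
        ... | ns , un , le , ok = ns , un , le , λ p →
          (proj₁ (proj₁ (ok p)) , W⊆V v∈ , W⊆V (proj₂ (ok p)) , proj₂ (proj₁ (ok p))) , proj₂ (ok p)

        open Dense E connected O O-owners t' 3≤t Vs proj₁ V-deg'

        Joined : Fin n → Fin n → Set
        Joined u v = ∃ λ us → Walk Γ u us v

        absurd : ¬ ¬ ⊥
        absurd = ¬¬-∀Fin (λ u → ¬¬-∀Fin (λ v → em (Joined u v))) >>= λ J? →
          ¬¬-∀Fin (λ z → ¬¬-∀Fin (λ u → ¬¬-∀Fin (λ v → em (Avoiding z u v)))) >>= λ A? →
          em (∃₂ λ u v → u ∈ Vs × v ∈ Vs × ¬ Joined u v) >>= λ
          { (yes (u , v , u∈ , v∈ , ¬j)) → two-components⇒cycle u∈ v∈ ¬j >>= λ c → return (no-cycle k≤2t+2 c)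
          ; (no none) → cut-case A? (λ {u} {v} u∈ v∈ → case J? u v of λ
              { (yes j) → j ; (no ¬j) → ⊥-elim (none (u , v , u∈ , v∈ , ¬j)) }) }
          where
          cut-case : (∀ z u v → Dec (Avoiding z u v)) → (∀ {u v} → u ∈ Vs → v ∈ Vs → Joined u v) → ¬ ¬ ⊥
          cut-case A? joined = em (∃₂ λ z u → ∃ λ v → u ∈ Vs × v ∈ Vs × u ≢ z × v ≢ z × ¬ Avoiding z u v) >>= λ
            { (yes (z , u , v , u∈ , v∈ , u≢z , v≢z , ¬a)) → separated z u∈ v∈ u≢z v≢z ¬a
            ; (no none) → return (Kopylov.contradiction k t 3≤k (s≤s z≤n) k≤2t+2 Γ Γ-sym Vs Ws
                (λ { (e , u∈ , v∈ , o) → u∈ , v∈ , λ { refl → Owners.O-irr owners o } })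
                uV uW W⊆V V-large
                (≤-trans (≤-reflexive (cong suc (sym (trans (+-comm s₀ t) t+s₀)))) (+-monoˡ-≤ t W-large))
                (≤-trans (s≤s (≤-trans (s≤s z≤n) 3≤s₀)) W-large)
                V-deg' W-deg'
                (λ {x} {y} z x∈ y∈ x≢z y≢z → case A? z x y of λ
                  { (yes a) → a ; (no ¬a) → ⊥-elim (none (z , x , y , x∈ , y∈ , x≢z , y≢z , ¬a)) })
                (λ c → no-cycle ≤-refl (owned-cycle O-owners 3≤k c))) }
            where
            open import Data.List.Membership.DecPropositional (Fin._≟_ {n}) using (_∈?_)
            on-walk : ∀ {u us v} → u ∈ Vs → Walk Γ u us v → ∀ {z} → z ∈ u ∷ us → z ∈ Vs
            on-walk = walk-in (λ r → proj₁ (proj₂ (proj₂ r)))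
            cut-off : ∀ {z w y} → w ∈ Ws → w ≢ z → z ∈ Vs → y ∈ Vs → y ≢ z → ¬ Avoiding z w y → ¬ ¬ ⊥
            cut-off w∈ w≢z z∈ y∈ y≢z ¬a =
              cut-vertex⇒cycle Ws W-deg' w∈ y∈ w≢z y≢z (joined z∈ (W⊆V w∈)) (joined z∈ y∈) ¬a >>= λ c →
              return (no-cycle k≤2t+2 c)
            -- `z` separates two vertices of `Vs`, not necessarily from `Ws`. But a vertex `w` of
            -- `Ws` other than `z` cannot be joined to both of them without `z`, so it is cut off
            -- from one.
            separated : ∀ z {u v} → u ∈ Vs → v ∈ Vs → u ≢ z → v ≢ z → ¬ Avoiding z u v → ¬ ¬ ⊥
            separated z {u} {v} u∈ v∈ u≢z v≢z ¬a
              with pick Fin._≟_ uW (≤-trans 3≤s₀ (≤-trans (n≤1+n s₀) W-large)) z z | joined u∈ v∈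
            ... | w , w∈ , w≢z , _ | us , wuv with z ∈? (u ∷ us)
            ... | no z∉ = ⊥-elim (¬a (us , wuv , z∉))
            ... | yes z∈ with A? z w u | A? z w v
            ... | yes p | yes q = ⊥-elim (¬a (avoiding-trans (avoiding-sym p) q))
            ... | no ¬p | _ = cut-off w∈ w≢z (on-walk u∈ wuv z∈) u∈ u≢z ¬p
            ... | yes _ | no ¬q = cut-off w∈ w≢z (on-walk u∈ wuv z∈) v∈ v≢z ¬q

      too-many : threshold ≤ n → ¬ (m ≤ (t C r') * (n ∸ s₀) + s₀ C suc r') → ¬ ¬ ⊥
      too-many thr≤n many = high-core t' r≤t {g = g} s₀≡ (n ∸ s₀) (allFin n) (Uniq.allFin⁺ n)
          (trans (length-allFin n) (sym (m∸n+n≡m s₀≤n))) >>= λ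
        { (inj₂ B) → return (many (≤-trans (all-inside B) (≤-reflexive (cong (_+ s₀ C suc r') (*-comm (n ∸ s₀) (t C r'))))))
        ; (inj₁ (Ws , uW , W-large , W-deg)) →
            low-core t' r≤t {Ws = Ws} d≡ W-deg n (allFin n) (Uniq.allFin⁺ n) (length-allFin n) (λ {v} _ → ∈-allFin v) >>= λ
            { (Vs , uV , W⊆V , V-deg , B) → Cores.absurd uW W-large W-deg uV (V-large Vs uV B) W⊆V V-deg } }
        where
        d' = t C r' ∸ 1
        q = n ∸ s₀
        s₀≤n : s₀ ≤ n
        s₀≤n = ≤-trans (m≤m+n s₀ _) thr≤n
        d≡ : t C r' ≡ suc d'
        d≡ = sym (m+[n∸m]≡n (C-positive t r' (≤-trans (n≤1+n r') r≤t)))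
        q≥ : s₀ * d' + k * (k C r') ≤ q
        q≥ = ≤-trans (≤-reflexive (sym (m+n∸m≡n s₀ _))) (∸-monoˡ-≤ s₀ thr≤n)
        open ≤-Reasoning
        V-large : ∀ Vs → Unique Vs → (∀ c → Bounded Vs c → Bounded (allFin n) (n * d' + c)) → k ≤ length Vs
        V-large Vs uV B with k ≤? length Vs
        ... | yes le = le
        ... | no ≰ = ⊥-elim (many (begin
          m ≤⟨ all-inside (B _ (crude-bound k Vs r≤k uV V≤k)) ⟩
          n * d' + length Vs * (k C r') ≤⟨ +-mono-≤ (≤-reflexive n*d') (*-monoˡ-≤ (k C r') V≤k) ⟩
          (s₀ * d' + q * d') + k * (k C r') ≡⟨ solve 3 (λ a b c → (a :+ b) :+ c
            := (a :+ c) :+ b) refl (s₀ * d') (q * d') (k * (k C r')) ⟩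
          (s₀ * d' + k * (k C r')) + q * d' ≤⟨ +-monoˡ-≤ (q * d') q≥ ⟩
          q + q * d' ≡⟨ cong (q +_) (*-comm q d') ⟩
          suc d' * q ≡⟨ cong (_* q) d≡ ⟨
          (t C r') * q ≤⟨ m≤m+n _ _ ⟩
          (t C r') * q + s₀ C suc r' ∎))
          where
          open import Data.Nat.Solver using (module +-*-Solver)
          open +-*-Solver
          V≤k : length Vs ≤ k
          V≤k = ≤-trans (n≤1+n _) (≰⇒> ≰)
          n*d' : n * d' ≡ s₀ * d' + q * d'
          n*d' = trans (cong (_* d') (sym (m+[n∸m]≡n s₀≤n))) (*-distribʳ-+ d' s₀ q)

    edge-bound : threshold ≤ n → m ≤ (t C r') * (n ∸ s₀) + s₀ C suc r'
    edge-bound thr≤n with m ≤? (t C r') * (n ∸ s₀) + s₀ C suc r'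
    ... | yes le = le
    ... | no many = ⊥-elim (red-blue E (λ RB → too-many RB thr≤n many (λ ())))

  ¬¬-∀Node : {P : Node → Set} → (∀ x → ¬ ¬ P x) → ¬ ¬ (∀ x → P x)
  ¬¬-∀Node f = ¬¬-∀Fin (f ∘ inj₁) >>= λ p → ¬¬-∀Fin (f ∘ inj₂) >>= λ q → return λ { (inj₁ v) → p v ; (inj₂ e) → q e }

-- Connectivity of the incidence graph

module _ {r n : ℕ} (H : RGraph r n) (2-conn : TwoConnected H) (3≤r : 3 ≤ r) where

  open Incidence (edge H)

  edge-size : ∀ j → ∣ edge H j ∣ ≡ r
  edge-size j = All.lookup (uniform H) (∈-lookup {xs = edges H} j)

  private
    Reach : Node → Fin n → Fin n → Set
    Reach z a b = ∃ λ xs → Walk Adj (inj₁ a) xs (inj₁ b) × z ∉ inj₁ a ∷ xs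

    reach-edge : ∀ {z a b c} j → Reach z a b → b ∈ₛ edge H j → c ∈ₛ edge H j → inj₂ j ≢ z → inj₁ c ≢ z → Reach z a c
    reach-edge {c = c} j (xs , w , z∉) b∈ c∈ j≢z c≢z = xs ++ inj₂ j ∷ inj₁ c ∷ [] , w ⊕ (b∈ ∷ c∈ ∷ []) ,
      λ p → case ∈-++⁻ (_ ∷ xs) p of λ
        { (inj₁ h) → z∉ h ; (inj₂ (here eq)) → j≢z (sym eq) ; (inj₂ (there (here eq))) → c≢z (sym eq) }

    bool : ∀ {P : Set} → Dec P → Bool
    bool (yes _) = true
    bool (no _) = false

    bool-true : ∀ {P : Set} (d : Dec P) → P → bool d ≡ true
    bool-true (yes _) p = refl
    bool-true (no ¬p) p = ⊥-elim (¬p p)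

    bool-false : ∀ {P : Set} (d : Dec P) → ¬ P → bool d ≡ false
    bool-false (yes p) ¬p = ⊥-elim (¬p p)
    bool-false (no _) _ = refl

    -- The vertices reachable from `a` without `z` form one side of a partition that no hyperedge
    -- other than `z` crosses, apart from `z` itself. If `b` were on the other side, `z` would be a
    -- cut vertex or a cut hyperedge.
    reach-all : ∀ z a b → inj₁ a ≢ z → inj₁ b ≢ z → ¬ ¬ Reach z a b
    reach-all z a b a≢z b≢z ¬reach = (¬¬-∀Fin (λ u → em (Reach z a u)) >>= λ R? →
      ¬¬-∀Fin (λ j → em (∃ λ u → u ∈ₛ edge H j × inj₁ u ≢ z × Reach z a u)) >>= λ E? →
      return (contradict z a≢z b≢z ¬reach R? E?)) (λ ())
      where
      self : ∀ {z} → inj₁ a ≢ z → Reach z a a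
      self a≢z = [] , [] , λ { (here eq) → a≢z (sym eq) }
      contradict : ∀ z → inj₁ a ≢ z → inj₁ b ≢ z → ¬ Reach z a b → (∀ u → Dec (Reach z a u)) →
        (∀ j → Dec (∃ λ u → u ∈ₛ edge H j × inj₁ u ≢ z × Reach z a u)) → ⊥
      contradict (inj₁ v) a≢z b≢z ¬reach R? E? = proj₁ (proj₂ 2-conn) v
        ((λ u → bool (R? u)) , (a , a≢z ∘ cong inj₁ , bool-true (R? a) (self a≢z)) ,
         (b , b≢z ∘ cong inj₁ , bool-false (R? b) ¬reach) ,
         λ j → case E? j of λ
           { (yes (u , u∈ , _ , Ru)) → inj₁ λ c c∈ c≢v →
               bool-true (R? c) (reach-edge j Ru u∈ c∈ (λ ()) (c≢v ∘ inj₁-injective))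
           ; (no none) → inj₂ λ c c∈ c≢v → bool-false (R? c) (λ Rc → none (c , c∈ , c≢v ∘ inj₁-injective , Rc)) })
      contradict (inj₂ e₀) a≢z b≢z ¬reach R? E? = proj₂ (proj₂ 2-conn) e₀
        ((λ u → bool (R? u)) , (a , bool-true (R? a) (self a≢z)) , (b , bool-false (R? b) ¬reach) ,
         λ j j≢ → case E? j of λ
           { (yes (u , u∈ , _ , Ru)) → inj₁ λ c c∈ →
               bool-true (R? c) (reach-edge j Ru u∈ c∈ (j≢ ∘ inj₂-injective) (λ ()))
           ; (no none) → inj₂ λ c c∈ → bool-false (R? c) (λ Rc → none (c , c∈ , (λ ()) , Rc)) })

    vertex-of : ∀ (z : Node) (j : Fin (e H)) → ∃ λ v → v ∈ₛ edge H j × inj₁ v ≢ z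
    vertex-of z j = go z
      where
      large : 3 ≤ length (elements (edge H j))
      large = ≤-trans 3≤r (≤-reflexive (sym (trans (length-elements (edge H j)) (edge-size j))))
      choose : ∀ v → ∃ λ u → u ∈ₛ edge H j × u ≢ v
      choose v = let u , u∈ , u≢v , _ = pick Fin._≟_ (elements-uniq (edge H j)) large v v
                 in u , ∈-elements⁻ (edge H j) u∈ , u≢v
      first : ∀ l → 3 ≤ length l → (∀ {v} → v ∈ l → v ∈ₛ edge H j) → ∃ λ v → v ∈ₛ edge H j
      first (v ∷ _) _ f = v , f (here refl)
      go : ∀ z → ∃ λ v → v ∈ₛ edge H j × inj₁ v ≢ z
      go (inj₁ v) = let u , u∈ , u≢v = choose v in u , u∈ , u≢v ∘ inj₁-injective
      go (inj₂ _) = let u , u∈ = first _ large (∈-elements⁻ (edge H j)) in u , u∈ , λ ()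

  -- Hyperedge nodes reduce to vertices: each has a vertex other than `z`, because r ≥ 3.
  incidence-connected : ¬ ¬ Connectivity
  incidence-connected = ¬¬-∀Node (edge H) (λ z → ¬¬-∀Fin λ a → ¬¬-∀Fin λ b → em (Reach z a b)) >>= λ R? →
    return λ {x} {y} z x≢z y≢z → connect R? x y z x≢z y≢z
    where
    connect : (∀ z a b → Dec (Reach z a b)) → ∀ x y z → x ≢ z → y ≢ z → ∃ λ xs → Walk Adj x xs y × z ∉ x ∷ xs
    connect R? x y z x≢z y≢z = join (start x x≢z) (start y y≢z)
      where
      reach : ∀ {a b} → inj₁ a ≢ z → inj₁ b ≢ z → Reach z a b
      reach {a} {b} a≢z b≢z with R? z a b
      ... | yes r = r
      ... | no ¬r = ⊥-elim (reach-all z a b a≢z b≢z ¬r)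
      Near : Node → Set
      Near x = ∃ λ a → inj₁ a ≢ z × ∃ λ xs → Walk Adj x xs (inj₁ a) × z ∉ x ∷ xs
      start : ∀ x → x ≢ z → Near x
      start (inj₁ a) ne = a , ne , [] , [] , λ { (here eq) → ne (sym eq) }
      start (inj₂ e) ne = let a , a∈ , a≢z = vertex-of z e in a , a≢z , inj₁ a ∷ [] , a∈ ∷ [] ,
        λ { (here eq) → ne (sym eq) ; (there (here eq)) → a≢z (sym eq) }
      join : Near x → Near y → ∃ λ xs → Walk Adj x xs y × z ∉ x ∷ xs
      join (a , a≢z , xs , w , z∉) (b , b≢z , ys , w' , z∉') with reach a≢z b≢z | Adj-rev w'
      ... | zs , wz , z∉'' | ys' , wr , perm = xs ++ zs ++ ys' , w ⊕ wz ⊕ wr , λ p → case ∈-++⁻ (x ∷ xs) p of λ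
        { (inj₁ h) → z∉ h ; (inj₂ h) → case ∈-++⁻ zs h of λ
          { (inj₁ h') → z∉'' (there h') ; (inj₂ h') → z∉' (∈-resp-↭ (↭-sym perm) (there h')) } }

-- Parameters and conclusion

⌊1+2n/2⌋ : ∀ n → ⌊ suc (n + n) /2⌋ ≡ n
⌊1+2n/2⌋ zero = refl
⌊1+2n/2⌋ (suc n) = trans (cong (λ x → ⌊ suc (suc x) /2⌋) (+-suc n n)) (cong suc (⌊1+2n/2⌋ n))

⌈n/2⌉≤1+⌊n/2⌋ : ∀ n → ⌈ n /2⌉ ≤ suc ⌊ n /2⌋
⌈n/2⌉≤1+⌊n/2⌋ zero = z≤n
⌈n/2⌉≤1+⌊n/2⌋ (suc zero) = ≤-refl
⌈n/2⌉≤1+⌊n/2⌋ (suc (suc n)) = s≤s (⌈n/2⌉≤1+⌊n/2⌋ n)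

module Parameters {r' k' : ℕ} (8≤ : 8 ≤ 2 * suc r' + 2) (≤k : 2 * suc r' + 2 ≤ suc k') where

  r t s₀ : ℕ
  r = suc r'
  t = ⌊ k' /2⌋
  -- This is ⌈(k+1)/2⌉ for k = `suc k'`.
  s₀ = suc ⌈ k' /2⌉

  double : 2 * r + 2 ≡ suc (suc (r + r))
  double = trans (+-comm (2 * r) 2) (cong (λ x → suc (suc (r + x))) (+-identityʳ r))

  2≤r' : 2 ≤ r'
  2≤r' with 2 ≤? r'
  ... | yes le = le
  ... | no ≰ = ⊥-elim (<⇒≱ (s≤s (≤-trans (≤-reflexive double) (s≤s (s≤s (+-mono-≤ (≰⇒> ≰) (≰⇒> ≰)))))) 
                 (≤-trans (s≤s (s≤s (s≤s (s≤s (s≤s (s≤s (s≤s z≤n))))))) 8≤))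

  1+2r≤k' : suc (r + r) ≤ k'
  1+2r≤k' = s≤s⁻¹ (≤-trans (≤-reflexive (sym double)) ≤k)

  r≤t : r ≤ t
  r≤t = ≤-trans (≤-reflexive (sym (⌊1+2n/2⌋ r))) (⌊n/2⌋-mono 1+2r≤k')

  -- Needed to start `many-vertices`, which begins at r + 2 vertices; for k = 2r + 2 it holds with
  -- equality.
  r+2≤s₀ : suc (suc r) ≤ s₀
  r+2≤s₀ = s≤s (≤-trans (≤-reflexive (cong suc (sym (⌊1+2n/2⌋ r)))) (≤-trans (≤-reflexive eq) (⌈n/2⌉-mono 1+2r≤k')))
    where
    eq : suc ⌊ suc (r + r) /2⌋ ≡ ⌈ suc (r + r) /2⌉
    eq = cong suc (trans (⌊1+2n/2⌋ r) (half r))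
      where
      half : ∀ n → n ≡ ⌊ n + n /2⌋
      half zero = refl
      half (suc n) = trans (cong suc (half n)) (cong (λ x → ⌊ suc x /2⌋) (sym (+-suc n n)))

  t+s₀≡k : t + s₀ ≡ suc k'
  t+s₀≡k = trans (+-suc t ⌈ k' /2⌉) (cong suc (⌊n/2⌋+⌈n/2⌉≡n k'))

  k≤2t+2 : suc k' ≤ suc t + suc t
  k≤2t+2 = ≤-trans (≤-reflexive (sym t+s₀≡k)) (≤-trans (+-monoʳ-≤ t (s≤s (⌈n/2⌉≤1+⌊n/2⌋ k'))) (≤-reflexive (+-suc t (suc t))))

  threshold : ℕ
  threshold = s₀ + (s₀ * (t C r' ∸ 1) + suc k' * (suc k' C r'))

  edge-count : ∀ {t₀} → t ≡ suc t₀ → ∀ n → threshold ≤ n → (H : RGraph r n) →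
    TwoConnected H → (∀ ℓ → suc k' ≤ ℓ → ¬ BergeCycle H ℓ) → e H ≤ (t C r') * (n ∸ s₀) + s₀ C r
  edge-count {t₀} t≡ n le H conn none = decidable-stable (e H ≤? (t C r') * (n ∸ s₀) + s₀ C r)
    (incidence-connected H conn (s≤s 2≤r') >>= λ connected → return (go t t≡ connected r≤t t+s₀≡k k≤2t+2 le))
    where
    go : ∀ t → t ≡ suc t₀ → Incidence.Connectivity (edge H) → r ≤ t → t + s₀ ≡ suc k' → suc k' ≤ suc t + suc t →
      s₀ + (s₀ * (t C r' ∸ 1) + suc k' * (suc k' C r')) ≤ n → e H ≤ (t C r') * (n ∸ s₀) + s₀ C r
    go .(suc t₀) refl connected r≤t t+s₀≡k k≤2t+2 le =
      Extremal.edge-bound (edge H) {g = s₀ ∸ suc (suc r)} 2≤r' r≤t (sym (m∸n+n≡m r+2≤s₀)) t+s₀≡k k≤2t+2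
        (edge-size H conn (s≤s 2≤r'))
        (lookup-injective (λ S → S) (edges H) (subst Unique (sym (List.map-id (edges H))) (unique H)) _ _)
        connected
        (λ k≤K c → let ℓ , K≤ℓ , berge = adjCycle⇒berge (edge H) (≤-trans (s≤s z≤n) k≤K) c
                   in none ℓ (≤-trans k≤K K≤ℓ) berge)
        le

theorem1p10 : ∀ (r k : ℕ) → 8 ≤ 2 * r + 2 → 2 * r + 2 ≤ k →
    ∃[ N ] (∀ (n : ℕ) → N ≤ n → (H : RGraph r n) → TwoConnected H →
    (∀ (ℓ : ℕ) → k ≤ ℓ → ¬ BergeCycle H ℓ) →
    e H ≤ bound r k n)
theorem1p10 zero k (s≤s (s≤s ())) ≤k
theorem1p10 (suc r') zero 8≤ ()
theorem1p10 (suc r') (suc k') 8≤ ≤k = threshold , λ n le H conn none →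
  subst (e H ≤_) (bound≡ n) (edge-count {t ∸ 1} (sym (m+[n∸m]≡n (≤-trans (s≤s z≤n) r≤t))) n le H conn none)
  where
  open Parameters {r'} {k'} 8≤ ≤k
  bound≡ : ∀ n → (t C r') * (n ∸ s₀) + s₀ C r ≡ bound (suc r') (suc k') n
  bound≡ n rewrite +-comm k' 1 = refl
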